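{- Let $L$ be a regular language of stability index $s$ and let $k>0$ be an integer. Then: (1) $L$ belongs to $\mathrm{FO}^2_k[<,\mathrm{MOD}]$ if and only if it belongs to $\mathrm{FO}^2_k[<,\mathrm{MOD}^{2ks}]$; (2) $L$ belongs to $\mathrm{FO}[=,\mathrm{MOD}]$ if and only if it belongs to $\mathrm{FO}[=,\mathrm{MOD}^{2s}]$. Moreover, the fragments $\mathrm{FO}[=,\mathrm{MOD}]$ and $\mathrm{FO}^2_k[<,\mathrm{MOD}]$, for every $k>0$, are decidable.
   Context: A word $u$ over a finite alphabet $A$ is a set of positions $0,\dots,|u|-1$ labelled by letters; $\mathrm{FO}[\sigma]$ is the set of first order sentences over words using the numerical predicates of $\sigma$ and the letter predicates $\mathbf a(x)$ (position $x$ carries letter $a$); first order variables range over positions. $<$ is the linear order on positions and $=$ is equality. For $d\ge1$, $\mathrm{MOD}^d$ consists of, for $0\le i<d$, the unary predicates $\mathbf{MOD}_i^d(x)$ (position $x$ is congruent to $i$ mod $d$) and the constants $\mathbf D_i^d$ (the length of the word is congruent to $i$ mod $d$); $\mathrm{MOD}=\bigcup_{d\ge1}\mathrm{MOD}^d$. $\mathrm{FO}^2[\sigma]$ is the set of sentences of $\mathrm{FO}[\sigma]$ using only two variable symbols (which may be reused), and $\mathrm{FO}^2_k[\sigma]$ is the set of sentences of $\mathrm{FO}^2[\sigma]$ with at most $k-1$ quantifier alternations: once negations have been pushed to the leaves, on every branch of the parse tree (from the root to a leaf) the sequence of quantifiers has at most $k-1$ alternations between $\exists$ and $\forall$. A language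 belongs to a fragment if it is the set of words satisfying some sentence of it, and a fragment is decidable if, given a regular language, one can decide whether it belongs to the fragment. The stability index of a regular language $L$ with syntactic morphism $\eta_L:A^*\to M_L$ is the least positive integer $s$ with $\eta_L(A^s)=\eta_L(A^{2s})$. -}

module Defs where

open import Algebra.Bundles using (Monoid)
open import Algebra.Morphism.Structures using (module MonoidMorphisms)
open import Data.Fin.Base as Fin using (Fin; toℕ)
open import Data.Fin.Properties using (_≟_; nonZeroIndex)
open import Data.Fin.Subset as Subset using (Subset; ⁅_⁆; ⊥)
open import Data.Fin.Subset.Properties using (x∈p∪q⁻; x∈⁅y⁆⇒x≡y; ∉⊥)
open import Data.List.Base as List using (List; []; _∷_; _++_; length; lookup; foldl)
open import Data.List.Properties using (++-assoc; ++-identityʳ; ++-monoid)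
open import Data.List.Relation.Unary.All using (All)
open import Data.Nat.Base using (ℕ; suc; _*_; _%_; _≤_; _<_)
open import Data.Product.Base using (∃-syntax; Σ-syntax; _×_; _,_)
open import Data.Sum.Base using (_⊎_; inj₁; inj₂)
open import Data.Vec.Base as Vec using (Vec; []; _∷_)
open import Function.Base using (id; _∘_)
open import Function.Bundles using (_⇔_; mk⇔; module Equivalence)
open import Level using (0ℓ)
open import Relation.Binary.PropositionalEquality
  using (_≡_; refl; sym; trans; cong; subst₂)
open import Relation.Nullary using (¬_; Dec; yes; no; contradiction)
open import Relation.Unary using (Pred; _∈_; _∪_; _≐_; ⋃)

-- The finite alphabets are the sets Fin m.

Word : ℕ → Set
Word m = List (Fin m)

Language : ℕ → Set₁
Language m = Pred (Word m) 0ℓ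

record DFA (m : ℕ) : Set where
  field
    states : ℕ
    start  : Fin states
    δ      : Fin states → Fin m → Fin states
    final  : Subset states

  language : Language m
  language w = foldl δ start w Subset.∈ final

Regular : ∀ {m} → Language m → Set
Regular {m} L = ∃[ M ] L ≐ DFA.language {m} M

module Syntactic {m : ℕ} (L : Language m) where

  infix 4 _∼_

  _∼_ : Word m → Word m → Set
  u ∼ v = ∀ x y → (x ++ u ++ y) ∈ L ⇔ (x ++ v ++ y) ∈ L

  private
    ∼-reflexive : ∀ {u v} → u ≡ v → u ∼ v
    ∼-reflexive refl x y = mk⇔ id id

    ∼-sym : ∀ {u v} → u ∼ v → v ∼ u
    ∼-sym p x y = mk⇔ (Equivalence.from (p x y)) (Equivalence.to (p x y))

    ∼-trans : ∀ {u v w} → u ∼ v → v ∼ w → u ∼ w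
    ∼-trans p q x y = mk⇔ (Equivalence.to (q x y) ∘ Equivalence.to (p x y))
                          (Equivalence.from (p x y) ∘ Equivalence.from (q x y))

    ++-congʳ : ∀ {u v} w → u ∼ v → (u ++ w) ∼ (v ++ w)
    ++-congʳ {u} {v} w p x y =
      subst₂ (λ a b → (x ++ a) ∈ L ⇔ (x ++ b) ∈ L)
             (sym (++-assoc u w y)) (sym (++-assoc v w y)) (p x (w ++ y))

    ++-congˡ : ∀ {u v} w → u ∼ v → (w ++ u) ∼ (w ++ v)
    ++-congˡ {u} {v} w p x y =
      subst₂ (λ a b → a ∈ L ⇔ b ∈ L) (shift u) (shift v) (p (x ++ w) y)
      where
      shift : ∀ t → (x ++ w) ++ t ++ y ≡ x ++ (w ++ t) ++ y
      shift t = trans (++-assoc x w (t ++ y)) (cong (x ++_) (sym (++-assoc w t y)))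

  -- M_L is the free monoid with the syntactic congruence as its equality.
  monoid : Monoid 0ℓ 0ℓ
  monoid = record
    { Carrier  = Word m
    ; _≈_      = _∼_
    ; _∙_      = _++_
    ; ε        = []
    ; isMonoid = record
      { isSemigroup = record
        { isMagma = record
          { isEquivalence = record
            { refl  = ∼-reflexive refl
            ; sym   = ∼-sym
            ; trans = ∼-trans
            }
          ; ∙-cong = λ {u} {v} {u′} {v′} p q →
              ∼-trans (++-congʳ u′ p) (++-congˡ v q)
          }
        ; assoc = λ u v w → ∼-reflexive (++-assoc u v w)
        }
      ; identity = (λ u → ∼-reflexive refl) , (λ u → ∼-reflexive (++-identityʳ u))
      }
    }

  open Monoid monoid public using (Carrier; _≈_; rawMonoid)
  open MonoidMorphisms (Monoid.rawMonoid (++-monoid (Fin m))) rawMonoid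
    using (IsMonoidHomomorphism)

  η : Word m → Carrier
  η = id

  η-isMonoidHomomorphism : IsMonoidHomomorphism η
  η-isMonoidHomomorphism = record
    { isMagmaHomomorphism = record
      { isRelHomomorphism = record { cong = ∼-reflexive }
      ; homo = λ _ _ → ∼-reflexive refl
      }
    ; ε-homo = ∼-reflexive refl
    }

  η[A^_] : ℕ → Pred Carrier 0ℓ
  η[A^ n ] a = ∃[ w ] (length w ≡ n × η w ≈ a)

  IsStabilityIndex : ℕ → Set
  IsStabilityIndex s = 0 < s × Stable s × (∀ t → 0 < t → Stable t → s ≤ t)
    where
    Stable : ℕ → Set
    Stable t = η[A^ t ] ≐ η[A^ 2 * t ]

open Syntactic public using (IsStabilityIndex)

data NumPred : Set where
  lt  : NumPred
  eq  : NumPred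
  MOD : (d : ℕ) → Fin d → NumPred
  D   : (d : ℕ) → Fin d → NumPred

arity : NumPred → ℕ
arity lt        = 2
arity eq        = 2
arity (MOD _ _) = 1
arity (D _ _)   = 0

-- Interpretation in a word with ℓ positions.
⟦_⟧ᴺ : (P : NumPred) (ℓ : ℕ) → Vec (Fin ℓ) (arity P) → Set
⟦ lt ⟧ᴺ      ℓ (p ∷ q ∷ []) = p Fin.< q
⟦ eq ⟧ᴺ      ℓ (p ∷ q ∷ []) = p ≡ q
⟦ MOD d i ⟧ᴺ ℓ (p ∷ [])     = _%_ (toℕ p) d ⦃ nonZeroIndex i ⦄ ≡ toℕ i
⟦ D d i ⟧ᴺ   ℓ []           = _%_ ℓ d ⦃ nonZeroIndex i ⦄ ≡ toℕ i

Signature : Set₁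
Signature = Pred NumPred 0ℓ

data [<] : Signature where
  lt : lt ∈ [<]

data [=] : Signature where
  eq : eq ∈ [=]

data MOD^ (d : ℕ) : Signature where
  MOD : ∀ i → MOD d i ∈ MOD^ d
  D   : ∀ i → D d i ∈ MOD^ d

-- The index d = 0 contributes nothing, since Fin 0 is empty.
[MOD] : Signature
[MOD] = ⋃ ℕ MOD^

data Quantifier : Set where
  ∃ᶠ ∀ᶠ : Quantifier

Var : ∀ {n} → Subset n → Set
Var Γ = ∃[ x ] x Subset.∈ Γ

-- Formulas over n variable symbols whose free variables lie in Γ. Variables
-- are named, and a quantifier may reuse a symbol that is already in Γ.
data Formula (m : ℕ) (σ : Signature) {n : ℕ} (Γ : Subset n) : Set where
  num    : (P : NumPred) → P ∈ σ → Vec (Var Γ) (arity P) → Formula m σ Γ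
  letter : Fin m → Var Γ → Formula m σ Γ
  neg    : Formula m σ Γ → Formula m σ Γ
  and or : Formula m σ Γ → Formula m σ Γ → Formula m σ Γ
  quant  : Quantifier → (x : Fin n) → Formula m σ (Γ Subset.∪ ⁅ x ⁆) → Formula m σ Γ

Sentence : ℕ → Signature → ℕ → Set
Sentence m σ n = Formula m σ {n} ⊥

-- The values of the variables, as positions of a word of length ℓ.
Assignment : ∀ {n} → ℕ → Subset n → Set
Assignment ℓ Γ = Var Γ → Fin ℓ

infixl 5 _[_↦_]

_[_↦_] : ∀ {n ℓ} {Γ : Subset n} →
         Assignment ℓ Γ → (x : Fin n) → Fin ℓ → Assignment ℓ (Γ Subset.∪ ⁅ x ⁆)
_[_↦_] {Γ = Γ} ρ x p (y , y∈Γ∪x) with y ≟ x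
... | yes _  = p
... | no y≢x with x∈p∪q⁻ Γ ⁅ x ⁆ y∈Γ∪x
...   | inj₁ y∈Γ = ρ (y , y∈Γ)
...   | inj₂ y∈x = contradiction (x∈⁅y⁆⇒x≡y x y∈x) y≢x

infix 4 _,_⊨_

_,_⊨_ : ∀ {m σ n} {Γ : Subset n} (w : Word m) → Assignment (length w) Γ → Formula m σ Γ → Set
w , ρ ⊨ num P _ xs   = ⟦ P ⟧ᴺ (length w) (Vec.map ρ xs)
w , ρ ⊨ letter a x   = lookup w (ρ x) ≡ a
w , ρ ⊨ neg φ        = ¬ (w , ρ ⊨ φ)
w , ρ ⊨ and φ ψ      = (w , ρ ⊨ φ) × (w , ρ ⊨ ψ)
w , ρ ⊨ or φ ψ       = (w , ρ ⊨ φ) ⊎ (w , ρ ⊨ ψ)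
w , ρ ⊨ quant ∃ᶠ x φ = ∃[ p ] (w , ρ [ x ↦ p ] ⊨ φ)
w , ρ ⊨ quant ∀ᶠ x φ = ∀ p → (w , ρ [ x ↦ p ] ⊨ φ)

⟦_⟧ : ∀ {m σ n} → Sentence m σ n → Language m
⟦ φ ⟧ w = w , (λ (_ , x∈⊥) → contradiction x∈⊥ ∉⊥) ⊨ φ

dual : Quantifier → Quantifier
dual ∃ᶠ = ∀ᶠ
dual ∀ᶠ = ∃ᶠ

-- nnf φ and nnf¬ φ are the negation normal forms of φ and neg φ.
mutual
  nnf : ∀ {m σ n} {Γ : Subset n} → Formula m σ Γ → Formula m σ Γ
  nnf (num P P∈σ xs) = num P P∈σ xs
  nnf (letter a x)   = letter a x
  nnf (neg φ)        = nnf¬ φ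
  nnf (and φ ψ)      = and (nnf φ) (nnf ψ)
  nnf (or φ ψ)       = or (nnf φ) (nnf ψ)
  nnf (quant q x φ)  = quant q x (nnf φ)

  nnf¬ : ∀ {m σ n} {Γ : Subset n} → Formula m σ Γ → Formula m σ Γ
  nnf¬ (num P P∈σ xs) = neg (num P P∈σ xs)
  nnf¬ (letter a x)   = neg (letter a x)
  nnf¬ (neg φ)        = nnf φ
  nnf¬ (and φ ψ)      = or (nnf¬ φ) (nnf¬ ψ)
  nnf¬ (or φ ψ)       = and (nnf¬ φ) (nnf¬ ψ)
  nnf¬ (quant q x φ)  = quant (dual q) x (nnf¬ φ)

-- One entry per leaf: the quantifiers met from the root down to that leaf.
branches : ∀ {m σ n} {Γ : Subset n} → Formula m σ Γ → List (List Quantifier)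
branches (num _ _ _)   = [] ∷ []
branches (letter _ _)  = [] ∷ []
branches (neg φ)       = branches φ
branches (and φ ψ)     = branches φ ++ branches ψ
branches (or φ ψ)      = branches φ ++ branches ψ
branches (quant q _ φ) = List.map (q ∷_) (branches φ)

alternations : List Quantifier → ℕ
alternations []                 = 0
alternations (_ ∷ [])           = 0
alternations (∃ᶠ ∷ qs@(∃ᶠ ∷ _)) = alternations qs
alternations (∀ᶠ ∷ qs@(∀ᶠ ∷ _)) = alternations qs
alternations (∃ᶠ ∷ qs@(∀ᶠ ∷ _)) = suc (alternations qs)
alternations (∀ᶠ ∷ qs@(∃ᶠ ∷ _)) = suc (alternations qs)

-- A fragment is identified with the class of languages its sentences define.
FO[_] : Signature → ∀ {m} → Pred (Language m) 0ℓ
FO[ σ ] {m} L = ∃[ n ] Σ[ φ ∈ Sentence m σ n ] L ≐ ⟦ φ ⟧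

-- "At most k - 1 alternations" is written "fewer than k", which excludes k = 0.
FO²[_,_] : ℕ → Signature → ∀ {m} → Pred (Language m) 0ℓ
FO²[ k , σ ] {m} L =
  Σ[ φ ∈ Sentence m σ 2 ]
    (All (λ qs → alternations qs < k) (branches (nnf φ)) × L ≐ ⟦ φ ⟧)

-- A closed inhabitant of this type is an algorithm: its input is an automaton
-- for the regular language, its answer is a Dec with evidence.
DecidableFragment : (∀ {m} → Pred (Language m) 0ℓ) → Set
DecidableFragment F = ∀ {m} (M : DFA m) → Dec (DFA.language M ∈ F)

{-# OPTIONS --safe #-}

-- Label each position of a word by its letter and its residue modulo d. For
-- FO²_k a formula with modulus d is preserved by the two-pebble game with k
-- blocks of rounds on labelled words. A loop p z = p of the syntactic monoid
-- can, as η(A^s) = η(A^2s), be prolonged to a loop of length s modulo d; its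
-- powers then contain their letters at all residues which agree modulo s, so
-- that inside a Green class only residues modulo s are visible. By induction on
-- k, words that are equivalent for k blocks modulo s are syntactically
-- equivalent: cut u where its prefixes drop in the right Green order and v where
-- its suffixes drop in the left one. There are at most |M_L| cuts of each kind,
-- the game recognises them, the factors between corresponding cuts are
-- equivalent for k - 1 blocks, and loops on both sides of a factor absorb one
-- level of the game. The number of rounds depends only on k and M_L. This works
-- for every s with η(A^s) = η(A^2s), in particular for the multiples 2ks of the
-- stability index.
--
-- For FO[=] the invariants are the numbers of occurrences of each labelled
-- letter, up to a threshold. Two letters whose distance is a multiple of 2s can
-- be exchanged, as the gap between them is long enough to be stretched to a
-- multiple of d.
--
-- In both cases membership in the fragment amounts to saturation under an
-- equivalence with finitely many classes, all definable in the fragment with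
-- the fixed modulus, and this is decidable.
module Submission where

open import Defs
open import Data.Fin.Base as Fin using (Fin; zero; suc; toℕ; fromℕ<; combine; funToFin; finToFun)
open import Data.Fin.Properties as FinP using (toℕ-injective; toℕ-fromℕ<)
open import Data.Fin.Subset as Subset using (Subset; ⁅_⁆; ⊥)
open import Data.Fin.Subset.Properties using (_∈?_; x∈p∪q⁻; x∈p∪q⁺; x∈⁅x⁆; x∈⁅y⁆⇒x≡y; ∉⊥)
open import Data.List.Base as List using (List; []; _∷_; _++_; length; lookup; foldl; map)
open import Data.List.Membership.Propositional as Mem using () renaming (_∈_ to _∈ˡ_)
open import Data.List.Membership.Propositional.Properties as MemP using ()
open import Data.List.Properties as ListP using (++-assoc; ++-identityʳ; ++-monoid; length-++; length-map)
open import Data.List.Relation.Unary.All as All using (All; []; _∷_)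
open import Data.List.Relation.Unary.All.Properties as AllP using ()
open import Data.List.Relation.Unary.Any as Any using (Any; here; there)
open import Data.List.Relation.Unary.Any.Properties as AnyP using ()
open import Data.Maybe.Base using (Maybe; just; nothing)
open import Data.Nat.Base
open import Data.Nat.Divisibility using (_∣_; divides; ∣-trans; m∣m*n; n∣m*n)
open import Data.Nat.DivMod
open import Data.Nat.Properties
open import Data.Nat.Tactic.RingSolver using (solve-∀)
open import Data.Product.Base using (∃; ∃-syntax; Σ-syntax; _×_; _,_; proj₁; proj₂)
open import Data.Sum.Base using (_⊎_; inj₁; inj₂; [_,_]′)
open import Data.Unit.Base using (⊤; tt)
open import Data.Vec.Base as Vec using (Vec; []; _∷_)
open import Data.Vec.Properties.WithK using ([]=-irrelevant)
open import Function.Base using (id; _∘_; case_of_)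
open import Function.Bundles using (_⇔_; mk⇔; module Equivalence)
open import Relation.Binary.Definitions using (tri<; tri≈; tri>)
open import Relation.Binary.PropositionalEquality
open import Relation.Nullary using (¬_; Dec; yes; no; contradiction)
open import Relation.Nullary.Decidable as Dec using (_×-dec_; _⊎-dec_; _→-dec_; ¬?; map′)
open import Relation.Unary using (_∈_; _∪_; _≐_)
open import Tactic.MonoidSolver using (solve)

-- The two-pebble game

-- The modulus d of the given sentence is unknown, and the only access to it is that words
-- equivalent modulo d are congruent. So the induction on the number of blocks must lower the level
-- on two sides at once. On the side of s, passing to the factors between cuts costs a level:
-- confining Duplicator to a factor takes one block in each of the two words. On the side of d, the
-- same level is won back by wrapping a factor into powers of loops, since Spoiler's place in the
-- middle cannot be recognised in the last block. What links the two sides is a new congruence for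
-- the factors, relating words that no context tells apart as long as they stay inside its Green
-- classes. It is coarser than the old one, so the old representatives still serve and the constants
-- do not depend on d. For this iteration the syntactic congruence is replaced by an abstract one,
-- for which stability is kept in the form of a change of length by multiples of s.
--
-- The factor 2 in the case of FO[=] has a simple origin: between two letters at distance s there
-- are only s - 1 letters, one short of a factor that stability can lengthen.

data At {B : Set} : List B → ℕ → B → Set where
  first : ∀ {b u} → At (b ∷ u) zero b
  next  : ∀ {b c u i} → At u i b → At (c ∷ u) (suc i) b

at-unique : ∀ {B : Set} {u : List B} {i b c} → At u i b → At u i c → b ≡ c
at-unique first    first    = refl
at-unique (next p) (next q) = at-unique p q

at-cast : ∀ {B : Set} {u : List B} {i j b c} → i ≡ j → b ≡ c → At u i b → At u j c
at-cast refl refl p = p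

at-< : ∀ {B : Set} {u : List B} {i b} → At u i b → i < length u
at-< first    = z<s
at-< (next p) = s<s (at-< p)

<-at : ∀ {B : Set} (u : List B) {i} → i < length u → ∃[ b ] At u i b
<-at (b ∷ u) {zero}  _         = b , first
<-at (b ∷ u) {suc i} (s≤s i<n) = let c , p = <-at u i<n in c , next p

at-++ˡ : ∀ {B : Set} {u v : List B} {i b} → At u i b → At (u ++ v) i b
at-++ˡ first    = first
at-++ˡ (next p) = next (at-++ˡ p)

at-++ʳ : ∀ {B : Set} (u : List B) {v i b} → At v i b → At (u ++ v) (length u + i) b
at-++ʳ []      p = p
at-++ʳ (_ ∷ u) p = next (at-++ʳ u p)

at-++⁻ : ∀ {B : Set} (u : List B) {v i b} → At (u ++ v) i b →
         At u i b ⊎ ∃[ j ] i ≡ length u + j × At v j b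
at-++⁻ []      p        = inj₂ (_ , refl , p)
at-++⁻ (_ ∷ u) first    = inj₁ first
at-++⁻ (_ ∷ u) (next p) with at-++⁻ u p
... | inj₁ q            = inj₁ (next q)
... | inj₂ (j , e , q)  = inj₂ (j , cong suc e , q)

at-split : ∀ {B : Set} {u : List B} {i b} → At u i b →
           ∃[ l ] ∃[ r ] u ≡ l ++ b ∷ r × length l ≡ i
at-split {u = _ ∷ u} first    = [] , u , refl , refl
at-split {u = c ∷ u} (next p) =
  let l , r , e , f = at-split p in c ∷ l , r , cong (c ∷_) e , cong suc f

at-map : ∀ {B C : Set} (f : B → C) {u i b} → At u i b → At (map f u) i (f b)
at-map f first    = first
at-map f (next p) = next (at-map f p)

at-map⁻ : ∀ {B C : Set} (f : B → C) {u i c} → At (map f u) i c → ∃[ b ] At u i b × c ≡ f b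
at-map⁻ f {_ ∷ _} first    = _ , first , refl
at-map⁻ f {_ ∷ _} (next p) = let b , q , e = at-map⁻ f p in b , next q , e

-- Three implications make transitivity a composition; by trichotomy they can be reversed all the
-- same, see `ord-flip`.
record Ord (i₁ i j₁ j : ℕ) : Set where
  constructor ord
  field
    below : i₁ < i → j₁ < j
    same  : i₁ ≡ i → j₁ ≡ j
    above : i < i₁ → j < j₁

ord-refl : ∀ {i₁ i} → Ord i₁ i i₁ i
ord-refl = ord id id id

ord-trans : ∀ {i₁ i j₁ j l₁ l} → Ord i₁ i j₁ j → Ord j₁ j l₁ l → Ord i₁ i l₁ l
ord-trans (ord a b c) (ord d e f) = ord (d ∘ a) (e ∘ b) (f ∘ c)

ord-lt : ∀ {i₁ i j₁ j} → i₁ < i → j₁ < j → Ord i₁ i j₁ j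
ord-lt p q = ord (λ _ → q) (λ { refl → contradiction p (<-irrefl refl) })
                 (λ r → contradiction r (<-asym p))

ord-gt : ∀ {i₁ i j₁ j} → i < i₁ → j < j₁ → Ord i₁ i j₁ j
ord-gt p q = ord (λ r → contradiction r (<-asym p))
                 (λ { refl → contradiction p (<-irrefl refl) }) (λ _ → q)

ord-eq : ∀ {i j} → Ord i i j j
ord-eq = ord (λ r → contradiction r (<-irrefl refl)) (λ _ → refl)
             (λ r → contradiction r (<-irrefl refl))

ord-swap : ∀ {i₁ i j₁ j} → Ord i₁ i j₁ j → Ord i i₁ j j₁
ord-swap (ord a b c) = ord c (sym ∘ b ∘ sym) a

ord-flip : ∀ {i₁ i j₁ j} → Ord i₁ i j₁ j → Ord j₁ j i₁ i
ord-flip {i₁} {i} (ord a b c) with <-cmp i₁ i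
... | tri< p _ _    = ord-lt (a p) p
... | tri≈ _ refl _ = subst (λ t → Ord t _ _ _) (sym (b refl)) ord-eq
... | tri> _ _ p    = ord-gt (c p) p

ord-+ : ∀ a b {i₁ i j₁ j} → Ord i₁ i j₁ j → Ord (a + i₁) (a + i) (b + j₁) (b + j)
ord-+ a b (ord l e g) = ord (+-monoʳ-< b ∘ l ∘ +-cancelˡ-< a _ _)
                            (cong (b +_) ∘ e ∘ +-cancelˡ-≡ a _ _)
                            (+-monoʳ-< b ∘ g ∘ +-cancelˡ-< a _ _)

ord-+⁻ : ∀ a b {i₁ i j₁ j} → Ord (a + i₁) (a + i) (b + j₁) (b + j) → Ord i₁ i j₁ j
ord-+⁻ a b (ord l e g) = ord (+-cancelˡ-< b _ _ ∘ l ∘ +-monoʳ-< a)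
                             (+-cancelˡ-≡ b _ _ ∘ e ∘ cong (a +_))
                             (+-cancelˡ-< b _ _ ∘ g ∘ +-monoʳ-< a)

-- Both directions are required so that a position past the end, which carries no letter, matches
-- only such positions.
Col : ∀ {B : Set} → List B → ℕ → List B → ℕ → Set
Col u i v j = (∀ {b} → At u i b → At v j b) × (∀ {b} → At v j b → At u i b)

Reply : ∀ {B : Set} → (List B → ℕ → List B → ℕ → Set) → ℕ → List B → ℕ → List B → ℕ → Set
Reply R k u i v j = 0 < k → ∀ {i₁ b} → At u i₁ b → ∃[ j₁ ] Ord i₁ i j₁ j × R u i₁ v j₁

-- Duplicator wins the n-round two-pebble game with k blocks of rounds in which
-- Spoiler stays in one word, starting in u; i and j are the positions of the
-- pebble that is kept. Formulas of FO²_k with outermost quantifier ∃ pass from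
-- (u , i) to (v , j). The positions length u, length v stand for no pebble.
data Sim {B : Set} : ℕ → ℕ → List B → ℕ → List B → ℕ → Set where
  stop : ∀ {k u i v j} → Col u i v j → Sim k zero u i v j
  play : ∀ {k n u i v j} → Col u i v j → Reply (Sim k n) k u i v j →
         Reply (Sim (pred k) n) (pred k) v j u i → Sim k (suc n) u i v j

Sub : ∀ {B : Set} → ℕ → ℕ → List B → List B → Set
Sub k n u v = Sim k n u (length u) v (length v)

at-end : ∀ {B A : Set} {u : List B} {b} → At u (length u) b → A
at-end p = contradiction (at-< p) (<-irrefl refl)

col-end : ∀ {B : Set} {u v : List B} → Col u (length u) v (length v)
col-end = at-end , at-end

sim-col : ∀ {B : Set} {k n} {u v : List B} {i j} → Sim k n u i v j → Col u i v j
sim-col (stop c)     = c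
sim-col (play c _ _) = c

sim-n : ∀ {B : Set} {k n} {u v : List B} {i j} → Sim k (suc n) u i v j → Sim k n u i v j
sim-n {n = zero}  (play c _ _) = stop c
sim-n {n = suc n} (play c f g) = play c
  (λ k>0 p → let j₁ , o , s = f k>0 p in j₁ , o , sim-n s)
  (λ k>0 p → let j₁ , o , s = g k>0 p in j₁ , o , sim-n s)

sim-≤ : ∀ {B : Set} {k n n′} {u v : List B} {i j} → n ≤ n′ → Sim k n′ u i v j → Sim k n u i v j
sim-≤ {n = n} {n′} n≤n′ s = go (≤⇒≤′ n≤n′) s
  where
  go : ∀ {n′} → n ≤′ n′ → Sim _ n′ _ _ _ _ → Sim _ n _ _ _ _
  go (≤′-reflexive refl) s = s
  go (≤′-step p)         s = go p (sim-n s)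

sim-k : ∀ {B : Set} {k n} {u v : List B} {i j} → Sim (suc k) n u i v j → Sim k n u i v j
sim-k {k = k} (stop c)     = stop c
sim-k {k = k} (play c f g) = play c
  (λ _ p → let j₁ , o , s = f z<s p in j₁ , o , sim-k s)
  (λ k>0 p → let j₁ , o , s = g (≤-trans k>0 pred[n]≤n) p in j₁ , o , down k s)
  where
  down : ∀ {n u i v j} k → Sim k n u i v j → Sim (pred k) n u i v j
  down zero    s = s
  down (suc k) s = sim-k s

-- Changing the word costs Spoiler a block, so a game at level `suc k` contains the reverse game at
-- level `k`.
sim-flip : ∀ {B : Set} {k n} {u v : List B} {i j} → Sim (suc k) n u i v j → Sim k n v j u i
sim-flip (stop (c , d)) = stop (d , c)
sim-flip {k = zero}  (play (c , d) f g) = play (d , c) g (λ ())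
sim-flip {k = suc k} (play (c , d) f g) = play (d , c) g
  (λ _ p → let j₁ , o , s = f z<s p in j₁ , o , sim-k (sim-k s))

sim-back : ∀ {B : Set} {k n} {u v : List B} {i j} →
           0 < pred k → Sim k n u i v j → Sim (pred k) n v j u i
sim-back {k = suc k} _ s = sim-flip s

forth : ∀ {B : Set} {k n} {u v : List B} {i j} → Sim (suc k) (suc n) u i v j →
        ∀ {i₁ b} → At u i₁ b → ∃[ j₁ ] Ord i₁ i j₁ j × Sim (suc k) n u i₁ v j₁
forth (play _ f _) = f z<s

sim-refl : ∀ {B : Set} k n (u : List B) i → Sim k n u i u i
sim-refl k zero    u i = stop (id , id)
sim-refl k (suc n) u i = play (id , id) (λ _ p → _ , ord-refl , sim-refl k n u _)
                                        (λ _ p → _ , ord-refl , sim-refl (pred k) n u _)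

sim-trans : ∀ {B : Set} {k n} {u v w : List B} {i j l} →
            Sim k n u i v j → Sim k n v j w l → Sim k n u i w l
sim-trans (stop (a , b)) (stop (c , d)) = stop (c ∘ a , b ∘ d)
sim-trans (play (a , b) f g) (play (c , d) f′ g′) = play (c ∘ a , b ∘ d)
  (λ k>0 p → let j₁ , o , s  = f k>0 p
                 l₁ , o′ , t = f′ k>0 (proj₁ (sim-col s) p)
             in l₁ , ord-trans o o′ , sim-trans s t)
  (λ k>0 p → let j₁ , o , s  = g′ k>0 p
                 l₁ , o′ , t = g k>0 (proj₁ (sim-col s) p)
             in l₁ , ord-trans o o′ , sim-trans s t)

ord-end : ∀ {B : Set} {u v : List B} {i j b c} → At u i b → At v j c →
          Ord i (length u) j (length v)
ord-end p q = ord-lt (at-< p) (at-< q)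

-- Without a pebble the order condition is void, since every position precedes both ends.
sim⇒sub : ∀ {B : Set} {k n} {u v : List B} {i j} → Sim k n u i v j → Sub k n u v
sim⇒sub (stop _) = stop col-end
sim⇒sub (play _ f g) = play col-end
  (λ k>0 p → let j₁ , o , s = f k>0 p in j₁ , ord-end p (proj₁ (sim-col s) p) , s)
  (λ k>0 p → let j₁ , o , s = g k>0 p in j₁ , ord-end p (proj₁ (sim-col s) p) , s)

at-++ˡ⁻ : ∀ {B : Set} (u : List B) {v i b} → i < length u → At (u ++ v) i b → At u i b
at-++ˡ⁻ u i<u p with at-++⁻ u p
... | inj₁ q              = q
... | inj₂ (j , refl , q) = contradiction i<u (m+n≮m (length u) j)

at-++ʳ⁻ : ∀ {B : Set} (u : List B) {v i b} → At (u ++ v) (length u + i) b → At v i b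
at-++ʳ⁻ u p with at-++⁻ u p
... | inj₁ q           = contradiction (at-< q) (m+n≮m (length u) _)
... | inj₂ (j , e , q) = subst (λ t → At _ t _) (sym (+-cancelˡ-≡ (length u) _ _ e)) q

col-++ˡ : ∀ {B : Set} {u₁ v₁ u₂ v₂ : List B} {i j} → i < length u₁ → j < length v₁ →
          Col u₁ i v₁ j → Col (u₁ ++ u₂) i (v₁ ++ v₂) j
col-++ˡ {u₁ = u₁} {v₁} i< j< (c , d) =
  (at-++ˡ ∘ c ∘ at-++ˡ⁻ u₁ i<) , (at-++ˡ ∘ d ∘ at-++ˡ⁻ v₁ j<)

col-++ʳ : ∀ {B : Set} (u₁ v₁ : List B) {u₂ v₂ i j} → Col u₂ i v₂ j →
          Col (u₁ ++ u₂) (length u₁ + i) (v₁ ++ v₂) (length v₁ + j)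
col-++ʳ u₁ v₁ (c , d) = (at-++ʳ v₁ ∘ c ∘ at-++ʳ⁻ u₁) , (at-++ʳ u₁ ∘ d ∘ at-++ʳ⁻ v₁)

mutual
  -- Duplicator plays two games side by side. The pebble lies in one factor, and a move into the
  -- other starts a game there without a pebble, which is why `Sub` is enough for that factor.
  sim-++ˡ : ∀ {B : Set} {k n} {u₁ v₁ u₂ v₂ : List B} {i j} → i < length u₁ → j < length v₁ →
            Sim k n u₁ i v₁ j → Sub k n u₂ v₂ → Sim k n (u₁ ++ u₂) i (v₁ ++ v₂) j
  sim-++ˡ i< j< (stop c) _ = stop (col-++ˡ i< j< c)
  sim-++ˡ i< j< s@(play c f g) t@(play _ f′ g′) = play (col-++ˡ i< j< c)
    (reply-++ˡ i< j< (λ _ → sim-n (sim⇒sub s)) (λ _ → sim-n t) f f′)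
    (reply-++ˡ j< i< (λ k>0 → sim-n (sim⇒sub (sim-back k>0 s)))
                     (λ k>0 → sim-n (sim-back k>0 t)) g g′)

  reply-++ˡ : ∀ {B : Set} {k n} {u₁ v₁ u₂ v₂ : List B} {i j} → i < length u₁ → j < length v₁ →
              (0 < k → Sub k n u₁ v₁) → (0 < k → Sub k n u₂ v₂) →
              Reply (Sim k n) k u₁ i v₁ j →
              Reply (Sim k n) k u₂ (length u₂) v₂ (length v₂) →
              Reply (Sim k n) k (u₁ ++ u₂) i (v₁ ++ v₂) j
  reply-++ˡ {u₁ = u₁} {v₁} i< j< s t f f′ k>0 p with at-++⁻ u₁ p
  ... | inj₁ q = let j₁ , o , r = f k>0 q in
                 j₁ , o , sim-++ˡ (at-< q) (at-< (proj₁ (sim-col r) q)) r (t k>0)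
  ... | inj₂ (i₂ , refl , q) = let j₁ , _ , r = f′ k>0 q in
                 length v₁ + j₁ , ord-gt (≤-trans i< (m≤m+n _ _)) (≤-trans j< (m≤m+n _ _)) ,
                 sim-++ʳ (s k>0) r

  sim-++ʳ : ∀ {B : Set} {k n} {u₁ v₁ u₂ v₂ : List B} {i j} →
            Sub k n u₁ v₁ → Sim k n u₂ i v₂ j →
            Sim k n (u₁ ++ u₂) (length u₁ + i) (v₁ ++ v₂) (length v₁ + j)
  sim-++ʳ {u₁ = u₁} {v₁} _ (stop c) = stop (col-++ʳ u₁ v₁ c)
  sim-++ʳ {u₁ = u₁} {v₁} s@(play _ f g) t@(play c f′ g′) = play (col-++ʳ u₁ v₁ c)
    (reply-++ʳ (λ _ → sim-n s) (λ _ → sim-n (sim⇒sub t)) f f′)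
    (reply-++ʳ (λ k>0 → sim-n (sim-back k>0 s))
               (λ k>0 → sim-n (sim⇒sub (sim-back k>0 t))) g g′)

  reply-++ʳ : ∀ {B : Set} {k n} {u₁ v₁ u₂ v₂ : List B} {i j} →
              (0 < k → Sub k n u₁ v₁) → (0 < k → Sub k n u₂ v₂) →
              Reply (Sim k n) k u₁ (length u₁) v₁ (length v₁) →
              Reply (Sim k n) k u₂ i v₂ j →
              Reply (Sim k n) k (u₁ ++ u₂) (length u₁ + i) (v₁ ++ v₂) (length v₁ + j)
  reply-++ʳ {u₁ = u₁} {v₁} s t f f′ k>0 p with at-++⁻ u₁ p
  ... | inj₁ q = let j₁ , _ , r = f k>0 q ; q′ = proj₁ (sim-col r) q in
                 j₁ , ord-lt (≤-trans (at-< q) (m≤m+n _ _)) (≤-trans (at-< q′) (m≤m+n _ _)) ,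
                 sim-++ˡ (at-< q) (at-< q′) r (t k>0)
  ... | inj₂ (i₂ , refl , q) = let j₁ , o , r = f′ k>0 q in
                 length v₁ + j₁ , ord-+ (length u₁) (length v₁) o , sim-++ʳ (s k>0) r

sub-++ : ∀ {B : Set} {k n} {u₁ v₁ u₂ v₂ : List B} →
         Sub k n u₁ v₁ → Sub k n u₂ v₂ → Sub k n (u₁ ++ u₂) (v₁ ++ v₂)
sub-++ {u₁ = u₁} {v₁} {u₂} {v₂} s t =
  subst₂ (λ a b → Sim _ _ (u₁ ++ u₂) a (v₁ ++ v₂) b)
         (sym (length-++ u₁)) (sym (length-++ v₁)) (sim-++ʳ s t)

sub-refl : ∀ {B : Set} {k n} (u : List B) → Sub k n u u
sub-refl u = sim-refl _ _ u _

sim-map : ∀ {B C : Set} (f : B → C) {k n u v i j} →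
          Sim k n u i v j → Sim k n (map f u) i (map f v) j
sim-map {B} {C} f = go
  where
  col : ∀ {u v i j} → (∀ {b} → At u i b → At v j b) → ∀ {c} → At (map f u) i c → At (map f v) j c
  col c p with at-map⁻ f p
  ... | b , q , refl = at-map f (c q)
  go : ∀ {k n u v i j} → Sim k n u i v j → Sim k n (map f u) i (map f v) j
  go (stop (c , d)) = stop (col c , col d)
  go (play (c , d) g h) = play (col c , col d)
    (λ k>0 p → let b , q , _ = at-map⁻ f p ; j₁ , o , s = g k>0 q in j₁ , o , go s)
    (λ k>0 p → let b , q , _ = at-map⁻ f p ; j₁ , o , s = h k>0 q in j₁ , o , go s)

sub-map : ∀ {B C : Set} (f : B → C) {k n u v} → Sub k n u v → Sub k n (map f u) (map f v)
sub-map f {u = u} {v} s =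
  subst₂ (λ a b → Sim _ _ (map f u) a (map f v) b)
         (sym (length-map f u)) (sym (length-map f v)) (sim-map f s)

-- Absorption by powers of a word

infix 4 _⊆ᴬ_

_⊆ᴬ_ : ∀ {B : Set} → List B → List B → Set
u ⊆ᴬ v = ∀ {i b} → At u i b → ∃[ j ] At v j b

⊆ᴬ-trans : ∀ {B : Set} {u v w : List B} → u ⊆ᴬ v → v ⊆ᴬ w → u ⊆ᴬ w
⊆ᴬ-trans f g p = g (proj₂ (f p))

⊆ᴬ-++ : ∀ {B : Set} (u : List B) {v w} → u ⊆ᴬ w → v ⊆ᴬ w → u ++ v ⊆ᴬ w
⊆ᴬ-++ u f g p with at-++⁻ u p
... | inj₁ q           = f q
... | inj₂ (_ , _ , q) = g q

⊆ᴬ-++ˡ : ∀ {B : Set} {u v : List B} → u ⊆ᴬ u ++ v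
⊆ᴬ-++ˡ p = _ , at-++ˡ p

⊆ᴬ-++ʳ : ∀ {B : Set} (u : List B) {v} → v ⊆ᴬ u ++ v
⊆ᴬ-++ʳ u p = _ , at-++ʳ u p

rep : ∀ {B : Set} → ℕ → List B → List B
rep zero    u = []
rep (suc n) u = u ++ rep n u

rep-+ : ∀ {B : Set} a b (u : List B) → rep (a + b) u ≡ rep a u ++ rep b u
rep-+ zero    b u = refl
rep-+ (suc a) b u = trans (cong (u ++_) (rep-+ a b u)) (sym (++-assoc u _ _))

length-rep : ∀ {B : Set} n (u : List B) → length (rep n u) ≡ n * length u
length-rep zero    u = refl
length-rep (suc n) u = trans (length-++ u) (cong (length u +_) (length-rep n u))

rep-⊆ : ∀ {B : Set} n (u : List B) → rep n u ⊆ᴬ u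
rep-⊆ (suc n) u = ⊆ᴬ-++ u (λ p → _ , p) (rep-⊆ n u)

-- At level 1 Spoiler never leaves the first word, so an empty first word offers no move; hence
-- enlarging the second word only helps Duplicator.
sub-[] : ∀ {B : Set} n (u : List B) → Sub 1 n [] u
sub-[] zero    u = stop col-end
sub-[] (suc n) u = play col-end (λ _ ()) (λ ())

sub-wkʳ : ∀ {B : Set} {n} {u v : List B} w → Sub 1 n u v → Sub 1 n u (v ++ w)
sub-wkʳ {n = n} {u} w s = subst (λ t → Sub 1 n t _) (++-identityʳ u) (sub-++ s (sub-[] n w))

sub-wkˡ : ∀ {B : Set} {n} {u v : List B} w → Sub 1 n u v → Sub 1 n u (w ++ v)
sub-wkˡ {n = n} w s = sub-++ (sub-[] n w) s

sim-point : ∀ {B : Set} {k n} {l l′ r r′ : List B} {b} → Sub k n l l′ → Sub k n r r′ →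
            Sim k n (l ++ b ∷ r) (length l) (l′ ++ b ∷ r′) (length l′)
sim-point {k = k} {n} {l} {l′} {r} {r′} {b} s t =
  subst₂ (λ i j → Sim k n (l ++ b ∷ r) i (l′ ++ b ∷ r′) j)
         (+-identityʳ _) (+-identityʳ _)
         (sim-++ʳ s (sim-++ˡ z<s z<s (sim-refl k n (b ∷ []) 0) t))

-- So many copies of a word answer n moves anywhere in a word over its letters:
-- a middle copy takes the first move and leaves enough copies on both sides.
fill : ℕ → ℕ
fill zero    = zero
fill (suc n) = fill n + suc (fill n)

pump : ∀ {B : Set} n {u z : List B} → u ⊆ᴬ z → Sub 1 n u (rep (fill n) z)
pump zero    u⊆z = stop col-end
pump (suc n) {u} {z} u⊆z = play col-end reply (λ ())
  where
  R = rep (fill n) z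
  reply : Reply (Sim 1 n) 1 u (length u) (rep (fill (suc n)) z) (length (rep (fill (suc n)) z))
  reply _ {i} {b} p with at-split p | at-split (proj₂ (u⊆z p))
  ... | l , r , refl , refl | z₁ , z₂ , refl , _ =
    length (R ++ z₁) , ord-end p (proj₁ (sim-col s) p) , s
    where
    re : (R ++ z₁) ++ b ∷ (z₂ ++ R) ≡ rep (fill (suc n)) z
    re = trans (++-assoc R z₁ _)
               (trans (cong (R ++_) (sym (++-assoc z₁ (b ∷ z₂) R))) (sym (rep-+ (fill n) (suc (fill n)) z)))
    s = subst (λ t → Sim 1 n u (length l) t (length (R ++ z₁))) re
          (sim-point (sub-wkʳ z₁ (pump n (⊆ᴬ-trans (⊆ᴬ-++ˡ {v = b ∷ r}) u⊆z)))
                     (sub-wkˡ z₂ (pump n (⊆ᴬ-trans (⊆ᴬ-++ʳ (l ++ b ∷ []) {r}) u⊆z′))))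
      where
      u⊆z′ : (l ++ b ∷ []) ++ r ⊆ᴬ z
      u⊆z′ = subst (_⊆ᴬ z) (sym (++-assoc l (b ∷ []) r)) u⊆z

sim-cast : ∀ {B : Set} {k n} {u u′ v v′ : List B} {i i′ j j′} →
           u ≡ u′ → v ≡ v′ → i ≡ i′ → j ≡ j′ → Sim k n u i v j → Sim k n u′ i′ v′ j′
sim-cast refl refl refl refl s = s

module Middle {B : Set} (l r z z′ : List B) where

  AbsorbL AbsorbR : ℕ → Set
  AbsorbL n = ∀ {p p′} → p ⊆ᴬ z → p′ ⊆ᴬ z → Sub 1 n (l ++ p) (l ++ p′)
  AbsorbR n = ∀ {p p′} → p ⊆ᴬ z′ → p′ ⊆ᴬ z′ → Sub 1 n (p ++ r) (p′ ++ r)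

  -- The pairs of positions that arise when Duplicator copies Spoiler inside `l` and `r` and follows
  -- the given game in the middle.
  data Mid (k n : ℕ) (x y : List B) : ℕ → ℕ → Set where
    inˡ : ∀ {i} → i < length l → Mid k n x y i i
    inᵐ : ∀ {i j} → i < length x → j < length y → Sim k n x i y j →
          Mid k n x y (length l + i) (length l + j)
    inʳ : ∀ i → Mid k n x y (length l + (length x + i)) (length l + (length y + i))

  Inside : List B → Set
  Inside x = x ⊆ᴬ z × x ⊆ᴬ z′

  inside-++⁻ : ∀ x {y} → Inside (x ++ y) → Inside x × Inside y
  inside-++⁻ x (f , g) = (⊆ᴬ-trans ⊆ᴬ-++ˡ f , ⊆ᴬ-trans ⊆ᴬ-++ˡ g) ,
                         (⊆ᴬ-trans (⊆ᴬ-++ʳ x) f , ⊆ᴬ-trans (⊆ᴬ-++ʳ x) g)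

  -- The loops l and r hide the place in the middle part from the last block.
  mid⇒sim₁ : ∀ {k n x y i j} → AbsorbL n → AbsorbR n → Inside x → Inside y →
             Mid k n x y i j → Sim 1 n (l ++ x ++ r) i (l ++ y ++ r) j
  mid⇒sim₁ aL aR X Y (inˡ i<) = sim-++ˡ i< i< (sim-refl 1 _ l _) (aR (proj₂ X) (proj₂ Y))
  mid⇒sim₁ {n = n} {x} {y} aL aR X Y (inʳ i) =
    sim-cast (++-assoc l x r) (++-assoc l y r) (pos x) (pos y)
      (sim-++ʳ (aL (proj₁ X) (proj₁ Y)) (sim-refl 1 n r i))
    where
    pos : ∀ x → length (l ++ x) + i ≡ length l + (length x + i)
    pos x = trans (cong (_+ i) (length-++ l)) (+-assoc (length l) (length x) i)
  mid⇒sim₁ {n = n} {x} {y} aL aR X Y (inᵐ i< j< s) with <-at x i<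
  ... | b , p with at-split p | at-split (proj₁ (sim-col s) p)
  ... | x₁ , x₂ , refl , refl | y₁ , y₂ , refl , refl =
    sim-cast (re x₁ x₂) (re y₁ y₂) (length-++ l) (length-++ l)
      (sim-point {b = b} (aL (proj₁ (proj₁ X′)) (proj₁ (proj₁ Y′)))
                         (aR (⊆ᴬ-trans (⊆ᴬ-++ʳ (b ∷ [])) (proj₂ (proj₂ X′)))
                             (⊆ᴬ-trans (⊆ᴬ-++ʳ (b ∷ [])) (proj₂ (proj₂ Y′)))))
    where
    X′ = inside-++⁻ x₁ X
    Y′ = inside-++⁻ y₁ Y
    re : ∀ x₁ x₂ → (l ++ x₁) ++ b ∷ (x₂ ++ r) ≡ l ++ (x₁ ++ b ∷ x₂) ++ r
    re x₁ x₂ = trans (++-assoc l x₁ _) (cong (l ++_) (sym (++-assoc x₁ (b ∷ x₂) r)))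

  mid-flip : ∀ {k n x y i j} → Mid (suc k) n x y i j → Mid k n y x j i
  mid-flip (inˡ i<)       = inˡ i<
  mid-flip (inᵐ i< j< s)  = inᵐ j< i< (sim-flip s)
  mid-flip (inʳ i)        = inʳ i

  answer : ∀ {k n x y i j i₁ b} → Sub (suc k) (suc n) x y → Mid (suc k) (suc n) x y i j →
           At (l ++ x ++ r) i₁ b → ∃[ j₁ ] Ord i₁ i j₁ j × Mid (suc k) n x y i₁ j₁
  answer {x = x} {y} s m p with at-++⁻ l p
  ... | inj₁ q = _ , o m , inˡ (at-< q)
    where
    o : ∀ {i j} → Mid _ _ x y i j → Ord _ i _ j
    o (inˡ _)     = ord-refl
    o (inᵐ _ _ _) = ord-lt (≤-trans (at-< q) (m≤m+n _ _)) (≤-trans (at-< q) (m≤m+n _ _))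
    o (inʳ _)     = ord-lt (≤-trans (at-< q) (m≤m+n _ _)) (≤-trans (at-< q) (m≤m+n _ _))
  ... | inj₂ (i₂ , refl , q) with at-++⁻ x q
  ...   | inj₂ (i₃ , refl , q′) = _ , o m , inʳ i₃
    where
    o : ∀ {i j} → Mid _ _ x y i j → Ord _ i _ j
    o (inˡ i<)      = ord-gt (≤-trans i< (m≤m+n _ _)) (≤-trans i< (m≤m+n _ _))
    o (inᵐ i< j< _) = ord-+ (length l) (length l)
                            (ord-gt (≤-trans i< (m≤m+n _ _)) (≤-trans j< (m≤m+n _ _)))
    o (inʳ _)       = ord-+ (length l) (length l) (ord-+ (length x) (length y) ord-refl)
  ...   | inj₁ q′ with m
  ...     | inˡ i< = let j₁ , _ , t = forth s q′ in
      _ , ord-gt (≤-trans i< (m≤m+n _ _)) (≤-trans i< (m≤m+n _ _)) ,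
      inᵐ (at-< q′) (at-< (proj₁ (sim-col t) q′)) t
  ...     | inᵐ _ _ s′ = let j₁ , o , t = forth s′ q′ in
      _ , ord-+ (length l) (length l) o , inᵐ (at-< q′) (at-< (proj₁ (sim-col t) q′)) t
  ...     | inʳ i = let j₁ , _ , t = forth s q′ ; q″ = proj₁ (sim-col t) q′ in
      _ , ord-+ (length l) (length l)
            (ord-lt (≤-trans (at-< q′) (m≤m+n _ _)) (≤-trans (at-< q″) (m≤m+n _ _))) ,
      inᵐ (at-< q′) (at-< q″) t

  -- The game in the middle lasts for k blocks only. In the last block Spoiler cannot return to the
  -- other word, and Duplicator changes to the strategy of `mid⇒sim₁`, which needs no relation
  -- between the places in the middle; this gains one level.
  mid⇒sim : ∀ k n {x y i j} → AbsorbL n → AbsorbR n → Inside x → Inside y →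
            Sub k n x y → Sub k n y x → Mid k n x y i j →
            Sim (suc k) n (l ++ x ++ r) i (l ++ y ++ r) j
  mid⇒sim zero    n       aL aR X Y s t m = mid⇒sim₁ aL aR X Y m
  mid⇒sim (suc k) zero    aL aR X Y s t m = stop (sim-col (mid⇒sim₁ aL aR X Y m))
  mid⇒sim (suc k) (suc n) aL aR X Y s t m =
    play (sim-col (mid⇒sim₁ aL aR X Y m))
         (λ _ p → let j₁ , o , m′ = answer s m p in
                  j₁ , o , mid⇒sim (suc k) n (λ p q → sim-n (aL p q)) (λ p q → sim-n (aR p q))
                                   X Y (sim-n s) (sim-n t) m′)
         -- After a change of word it is the reverse game that continues: its first reply is the
         -- answer to this move.
         (λ _ p → forth (mid⇒sim k (suc n) aL aR Y X (sim-k t) (sim-k s) (mid-flip m)) p)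

sub-between : ∀ {B : Set} k n {x y z z′ : List B} →
              x ⊆ᴬ z → y ⊆ᴬ z → x ⊆ᴬ z′ → y ⊆ᴬ z′ → Sub k n x y → Sub k n y x →
              Sub (suc k) n (rep (fill n) z ++ x ++ rep (fill n) z′)
                            (rep (fill n) z ++ y ++ rep (fill n) z′)
sub-between k n {x} {y} {z} {z′} xz yz xz′ yz′ s t =
  sim-cast refl refl (len x) (len y)
    (Middle.mid⇒sim l r z z′ k n aL aR (xz , xz′) (yz , yz′) s t (Middle.inʳ (length r)))
  where
  l = rep (fill n) z
  r = rep (fill n) z′
  len : ∀ x → length l + (length x + length r) ≡ length (l ++ x ++ r)
  len x = sym (trans (length-++ l) (cong (length l +_) (length-++ x)))
  aL : Middle.AbsorbL l r z z′ n
  aL {p} {p′} f g = sub-wkʳ p′ (pump n (⊆ᴬ-++ l (rep-⊆ (fill n) z) f))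
  aR : Middle.AbsorbR l r z z′ n
  aR {p} {p′} f g = sub-wkˡ p′ (pump n (⊆ᴬ-++ p f (rep-⊆ (fill n) z′)))

sub-zero : ∀ {B : Set} n (u v : List B) → Sub 0 n u v
sub-zero zero    u v = stop col-end
sub-zero (suc n) u v = play col-end (λ ()) (λ ())

-- Each of the k layers of powers raises the level by one, starting from level 0, where all words
-- are equivalent.
sub-around : ∀ {B : Set} k n {x y z z′ : List B} → z ⊆ᴬ z′ → z′ ⊆ᴬ z → x ⊆ᴬ z → y ⊆ᴬ z →
             Sub k n (rep (k * fill n) z ++ x ++ rep (k * fill n) z′)
                     (rep (k * fill n) z ++ y ++ rep (k * fill n) z′)
sub-around zero    n _ _ f g = sub-zero n _ _
sub-around (suc k) n {x} {y} {z} {z′} zz′ z′z f g =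
  subst₂ (Sub (suc k) n) (re x) (re y)
    (sub-between k n (in-z f) (in-z g) (⊆ᴬ-trans (in-z f) zz′) (⊆ᴬ-trans (in-z g) zz′)
       (sub-around k n zz′ z′z f g) (sub-around k n zz′ z′z g f))
  where
  E = rep (fill n) z
  E′ = rep (fill n) z′
  K = rep (k * fill n) z
  K′ = rep (k * fill n) z′
  in-z : ∀ {x} → x ⊆ᴬ z → K ++ x ++ K′ ⊆ᴬ z
  in-z f = ⊆ᴬ-++ K (rep-⊆ (k * fill n) z) (⊆ᴬ-++ _ f (⊆ᴬ-trans (rep-⊆ (k * fill n) z′) z′z))
  re : ∀ x → E ++ (K ++ x ++ K′) ++ E′ ≡ rep (suc k * fill n) z ++ x ++ rep (suc k * fill n) z′
  re x = trans (cong (E ++_) (trans (++-assoc K _ E′) (cong (K ++_) (++-assoc x K′ E′))))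
         (trans (sym (++-assoc E K _))
         (cong₂ (λ a b → a ++ x ++ b) (sym (rep-+ (fill n) (k * fill n) z))
                (trans (sym (rep-+ (k * fill n) (fill n) z′))
                       (cong (λ t → rep t z′) (+-comm (k * fill n) (fill n))))))

-- Positions modulo d

-- Congruence of numbers, symmetric in the two sides so that no subtraction and
-- no non-zero modulus is needed.
infix 4 _≋_[_]

data _≋_[_] (a b d : ℕ) : Set where
  mk≋ : ∀ x y → a + x * d ≡ b + y * d → a ≋ b [ d ]

≋-refl : ∀ {a d} → a ≋ a [ d ]
≋-refl = mk≋ 0 0 refl

≋-reflexive : ∀ {a b d} → a ≡ b → a ≋ b [ d ]
≋-reflexive refl = ≋-refl

≋-sym : ∀ {a b d} → a ≋ b [ d ] → b ≋ a [ d ]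
≋-sym (mk≋ x y e) = mk≋ y x (sym e)

≋-trans : ∀ {a b c d} → a ≋ b [ d ] → b ≋ c [ d ] → a ≋ c [ d ]
≋-trans {a} {b} {c} {d} (mk≋ x y e) (mk≋ x′ y′ e′) = mk≋ (x + x′) (y′ + y) (begin
  a + (x + x′) * d      ≡⟨ shuffle a x x′ d ⟩
  (a + x * d) + x′ * d  ≡⟨ cong (_+ x′ * d) e ⟩
  (b + y * d) + x′ * d  ≡⟨ swap b (y * d) (x′ * d) ⟩
  (b + x′ * d) + y * d  ≡⟨ cong (_+ y * d) e′ ⟩
  (c + y′ * d) + y * d  ≡⟨ sym (shuffle c y′ y d) ⟩
  c + (y′ + y) * d      ∎)
  where
  open ≡-Reasoning
  shuffle : ∀ a x y d → a + (x + y) * d ≡ (a + x * d) + y * d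
  shuffle = solve-∀
  swap : ∀ a x y → (a + x) + y ≡ (a + y) + x
  swap = solve-∀

≋-+ : ∀ {a a′ b b′ d} → a ≋ a′ [ d ] → b ≋ b′ [ d ] → a + b ≋ a′ + b′ [ d ]
≋-+ {a} {a′} {b} {b′} {d} (mk≋ x y e) (mk≋ x′ y′ e′) = mk≋ (x + x′) (y + y′)
  (trans (shuffle a b x x′ d) (trans (cong₂ _+_ e e′) (sym (shuffle a′ b′ y y′ d))))
  where
  shuffle : ∀ a b x y d → (a + b) + (x + y) * d ≡ (a + x * d) + (b + y * d)
  shuffle = solve-∀

≋-cancelˡ : ∀ {a b d} c → c + a ≋ c + b [ d ] → a ≋ b [ d ]
≋-cancelˡ {a} {b} {d} c (mk≋ x y e) = mk≋ x y (+-cancelˡ-≡ c _ _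
  (trans (sym (+-assoc c a _)) (trans e (+-assoc c b _))))

≋-cancelʳ : ∀ {a b d} c → a + c ≋ b + c [ d ] → a ≋ b [ d ]
≋-cancelʳ {a} {b} {d} c e = ≋-cancelˡ c (subst₂ (λ x y → x ≋ y [ d ]) (+-comm a c) (+-comm b c) e)

≋-*0 : ∀ k d → k * d ≋ 0 [ d ]
≋-*0 k d = mk≋ 0 k (+-identityʳ (k * d))

≋-* : ∀ {a b d} k → a ≋ b [ d ] → k * a ≋ k * b [ d ]
≋-* zero    e = ≋-refl
≋-* (suc k) e = ≋-+ e (≋-* k e)

≋-factor : ∀ {a b} q s → a ≋ b [ q * s ] → a ≋ b [ s ]
≋-factor {a} {b} q s (mk≋ x y e) = mk≋ (x * q) (y * q)
  (trans (cong (a +_) (*-assoc x q s)) (trans e (cong (b +_) (sym (*-assoc y q s)))))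

-- Modulo `suc q * s`, going back by `x * s` is the same as going forward by `x * q * s`; so `j`
-- needs no sign.
≋-lift : ∀ {a b} q s → a ≋ b [ s ] → ∃[ j ] a ≋ b + j * s [ suc q * s ]
≋-lift {a} {b} q s (mk≋ x y e) = y + x * q , mk≋ x 0
  (trans (left a x q s) (trans (cong (_+ x * q * s) e) (right b x y q s)))
  where
  left : ∀ a x q s → a + x * (suc q * s) ≡ (a + x * s) + x * q * s
  left = solve-∀
  right : ∀ b x y q s → (b + y * s) + x * q * s ≡ (b + (y + x * q) * s) + 0
  right = solve-∀

≋⇒% : ∀ {a b d} .{{_ : NonZero d}} → a ≋ b [ d ] → a % d ≡ b % d
≋⇒% {a} {b} {d} (mk≋ x y e) =
  trans (sym ([m+kn]%n≡m%n a x d)) (trans (cong (_% d) e) ([m+kn]%n≡m%n b y d))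

%-≋ : ∀ a d .{{_ : NonZero d}} → a % d ≋ a [ d ]
%-≋ a d = mk≋ (a / d) 0 (trans (sym (m≡m%n+[m/n]*n a d)) (sym (+-identityʳ a)))

%⇒≋ : ∀ {a b d} .{{_ : NonZero d}} → a % d ≡ b % d → a ≋ b [ d ]
%⇒≋ {a} {b} {d} e = ≋-trans (≋-sym (%-≋ a d)) (≋-trans (≋-reflexive e) (%-≋ b d))

-- The labelled word. The offset `o` is the place where `u` starts inside a longer word, so that
-- factors of labelled words are again of this form.
enr : ∀ {A : Set} (d : ℕ) .{{_ : NonZero d}} → ℕ → List A → List (A × ℕ)
enr d o []      = []
enr d o (a ∷ u) = (a , o % d) ∷ enr d (suc o) u

module _ {A : Set} where

  length-enr : ∀ {d} .{{_ : NonZero d}} o (u : List A) → length (enr d o u) ≡ length u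
  length-enr o []      = refl
  length-enr o (a ∷ u) = cong suc (length-enr (suc o) u)

  enr-++ : ∀ {d} .{{_ : NonZero d}} o (u v : List A) →
           enr d o (u ++ v) ≡ enr d o u ++ enr d (o + length u) v
  enr-++ o []      v = cong (λ t → enr _ t v) (sym (+-identityʳ o))
  enr-++ o (a ∷ u) v = cong (_ ∷_) (trans (enr-++ (suc o) u v)
                         (cong (λ t → enr _ (suc o) u ++ enr _ t v) (sym (+-suc o (length u)))))

  enr-≋ : ∀ {d} .{{_ : NonZero d}} {o o′} (u : List A) → o ≋ o′ [ d ] → enr d o u ≡ enr d o′ u
  enr-≋ []      e = refl
  enr-≋ (a ∷ u) e = cong₂ _∷_ (cong (a ,_) (≋⇒% e)) (enr-≋ u (≋-+ (≋-refl {1}) e))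

  at-enr : ∀ {d} .{{_ : NonZero d}} o {u : List A} {i a} → At u i a → At (enr d o u) i (a , (o + i) % d)
  at-enr {d} o {a ∷ u} first = at-cast refl (cong (λ t → a , t % d) (sym (+-identityʳ o))) first
  at-enr {d} o {i = suc i} {a} (next p) =
    next (at-cast refl (cong (λ t → a , t % d) (sym (+-suc o i))) (at-enr (suc o) p))

  at-enr⁻ : ∀ {d} .{{_ : NonZero d}} o {u : List A} {i b} → At (enr d o u) i b →
            ∃[ a ] At u i a × b ≡ (a , (o + i) % d)
  at-enr⁻ {d} o {a ∷ u} first = a , first , cong (λ t → a , t % d) (sym (+-identityʳ o))
  at-enr⁻ {d} o {c ∷ u} {suc i} (next p) =
    let a , q , e = at-enr⁻ (suc o) p in a , next q , trans e (cong (λ t → a , t % d) (sym (+-suc o i)))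

  enr-rep : ∀ {d} .{{_ : NonZero d}} o n (u : List A) → length u ≋ 0 [ d ] →
            enr d o (rep n u) ≡ rep n (enr d o u)
  enr-rep o zero    u e = refl
  enr-rep o (suc n) u e = trans (enr-++ o u (rep n u)) (cong (enr _ o u ++_)
    (trans (enr-rep (o + length u) n u e)
           (cong (rep n) (enr-≋ u (≋-trans (≋-+ (≋-refl {o}) e) (≋-reflexive (+-identityʳ o)))))))

  at-rep : ∀ {h : List A} {t a} i n → At h t a → At (rep (suc i + n) h) (i * length h + t) a
  at-rep zero    n p = at-++ˡ p
  at-rep {h} {t} (suc i) n p =
    at-cast (sym (+-assoc (length h) (i * length h) t)) refl (at-++ʳ h (at-rep i n p))

Cover : ∀ {A : Set} → ℕ → ℕ → List A → ℕ → List A → Set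
Cover s o u o′ h = ∀ {t a} → At u t a → ∃[ t′ ] At h t′ a × o + t ≋ o′ + t′ [ s ]

private
  row< : ∀ {i q} → i < q → ∃[ n ] q ≡ suc i + n
  row< {i} {q} p = q ∸ suc i , sym (m+[n∸m]≡n p)

-- Each copy of `h` starts `s` further on than the one before, modulo d; so the `suc q` copies show
-- every letter of `h` at all residues that agree with its own modulo `s`.
cover⇒⊆ᴬ : ∀ {A : Set} {s q o o′} .{{_ : NonZero (suc q * s)}} {u h : List A} →
           length h ≋ s [ suc q * s ] → Cover s o u o′ h →
           enr (suc q * s) o u ⊆ᴬ enr (suc q * s) o′ (rep (suc q) h)
cover⇒⊆ᴬ {A} {s} {q} {o} {o′} {u} {h} len cov {i} p with at-enr⁻ o p
... | a , p′ , refl with cov p′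
... | t , r , e = let j , f = ≋-lift q s e in found j f
  where
  d = suc q * s
  found : ∀ j → o + i ≋ (o′ + t) + j * s [ d ] → ∃[ k ] At (enr d o′ (rep (suc q) h)) k (a , (o + i) % d)
  found j f with row< (m%n<n j (suc q))
  -- Only `j` modulo `suc q` matters for the choice of the copy, because `suc q` shifts by `s` make
  -- up d.
  ... | n , eqn = let k = j % suc q in
    k * length h + t ,
    subst (λ z → At (enr d o′ (rep (suc q) h)) (k * length h + t) (a , z))
          (sym (≋⇒% (≋-trans f (≋-trans (≋-+ (≋-refl {o′ + t}) (≋-trans jk (≋-* k (≋-sym len))))
                                        (≋-reflexive (reorder o′ t (k * length h)))))))
          (at-enr o′ (subst (λ z → At (rep z h) (k * length h + t) a) (sym eqn) (at-rep k n r)))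
    where
    reorder : ∀ a b c → (a + b) + c ≡ a + (c + b)
    reorder = solve-∀
    jk : j * s ≋ (j % suc q) * s [ d ]
    jk = mk≋ 0 (j / suc q)
      (trans (+-identityʳ (j * s)) (trans (cong (_* s) (m≡m%n+[m/n]*n j (suc q)))
            (distrib (j % suc q) (j / suc q) (suc q) s)))
      where
      distrib : ∀ a b c s → (a + b * c) * s ≡ a * s + b * (c * s)
      distrib = solve-∀

-- Congruences of finite index and their loops

record Eqv {m : ℕ} (k n d : ℕ) .{{_ : NonZero d}} (u v : Word m) : Set where
  constructor eqv
  field
    lengths : length u ≋ length v [ d ]
    to      : Sub k n (enr d 0 u) (enr d 0 v)
    from    : Sub k n (enr d 0 v) (enr d 0 u)

eqv-sym : ∀ {m k n d} .{{_ : NonZero d}} {u v : Word m} → Eqv k n d u v → Eqv k n d v u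
eqv-sym (eqv l s t) = eqv (≋-sym l) t s

eqv-trans : ∀ {m k n d} .{{_ : NonZero d}} {u v w : Word m} →
            Eqv k n d u v → Eqv k n d v w → Eqv k n d u w
eqv-trans (eqv l s t) (eqv l′ s′ t′) = eqv (≋-trans l l′) (sim-trans s s′) (sim-trans t′ t)

enr-raise : ∀ {A : Set} {d} .{{_ : NonZero d}} t o (u : List A) →
            map (λ (a , r) → a , (t + r) % d) (enr d o u) ≡ enr d (t + o) u
enr-raise t o []      = refl
enr-raise {d = d} t o (a ∷ u) = cong₂ _∷_ (cong (a ,_) (≋⇒% (≋-+ (≋-refl {t}) (%-≋ o d))))
  (trans (enr-raise t (suc o) u) (cong (λ z → enr d z u) (+-suc t o)))

-- Adding `t` to all residues is a renaming of the labelled letters, and the game is invariant under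
-- renamings.
sub-raise : ∀ {A : Set} {k n d} .{{_ : NonZero d}} {o o′ p p′} {u v : List A} t →
            t + o ≋ p [ d ] → t + o′ ≋ p′ [ d ] →
            Sub k n (enr d o u) (enr d o′ v) → Sub k n (enr d p u) (enr d p′ v)
sub-raise {k = k} {n} {o = o} {o′} {u = u} {v} t e e′ s = subst₂ (Sub k n)
  (trans (enr-raise t o u) (enr-≋ u e)) (trans (enr-raise t o′ v) (enr-≋ v e′)) (sub-map _ s)

eqv-++ : ∀ {m k n d} .{{_ : NonZero d}} {u u′ v v′ : Word m} →
         Eqv k n d u u′ → Eqv k n d v v′ → Eqv k n d (u ++ v) (u′ ++ v′)
eqv-++ {k = k} {n} {d} {u} {u′} {v} {v′} (eqv l s t) (eqv l′ s′ t′) =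
  eqv (subst₂ (λ a b → a ≋ b [ d ]) (sym (length-++ u)) (sym (length-++ u′)) (≋-+ l l′))
      (subst₂ (Sub k n) (sym (enr-++ 0 u v)) (sym (enr-++ 0 u′ v′))
        (sub-++ s (sub-raise (length u) e e′ s′)))
      (subst₂ (Sub k n) (sym (enr-++ 0 u′ v′)) (sym (enr-++ 0 u v))
        (sub-++ t (sub-raise (length u) e′ e t′)))
  where
  e : length u + 0 ≋ length u [ d ]
  e = ≋-reflexive (+-identityʳ (length u))
  e′ : length u + 0 ≋ length u′ [ d ]
  e′ = ≋-trans e l

eqv-refl : ∀ {m k n d} .{{_ : NonZero d}} {u : Word m} → Eqv k n d u u
eqv-refl = eqv ≋-refl (sub-refl _) (sub-refl _)

-- Abstract because the induction on the level replaces the congruence by a coarser one. The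
-- representatives are data: their number is the constant from which the rounds are computed, and
-- quantification over words is decided on them.
record Congruence (m s : ℕ) : Set₁ where
  infix 4 _~_ _~?_
  field
    _~_      : Word m → Word m → Set
    ~-refl   : ∀ {u} → u ~ u
    ~-sym    : ∀ {u v} → u ~ v → v ~ u
    ~-trans  : ∀ {u v w} → u ~ v → v ~ w → u ~ w
    ~-++     : ∀ {u u′ v v′} → u ~ u′ → v ~ v′ → u ++ v ~ u′ ++ v′
    _~?_     : ∀ u v → Dec (u ~ v)
    ~-length : ∀ {u v} → u ~ v → length u ≋ length v [ s ]
    reps     : List (Word m)
    reps-complete : ∀ u → Any (_~ u) reps
    -- This is where the stability of s enters.
    adjust   : ∀ g → 0 < length g → length g ≋ 0 [ s ] →
               ∀ j → ∃[ g′ ] length g′ ≡ suc j * s × g′ ~ g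

length-++³ : ∀ {A : Set} (u v w : List A) →
             length (u ++ v ++ w) ≡ length u + (length v + length w)
length-++³ u v w = trans (length-++ u) (cong (length u +_) (length-++ v))

cover-factor : ∀ {A : Set} {s o o′} (a : List A) {x} b → o ≋ o′ + length a [ s ] →
               Cover s o x o′ (a ++ x ++ b)
cover-factor {s = s} {o} {o′} a b e {t} p = length a + t , at-++ʳ a (at-++ˡ p) ,
  ≋-trans (≋-+ e (≋-refl {t})) (≋-reflexive (+-assoc o′ (length a) t))

cover-++ : ∀ {A : Set} {s o o′} {u v h : List A} → Cover s o u o′ h → Cover s (o + length u) v o′ h →
           Cover s o (u ++ v) o′ h
cover-++ {o = o} {u = u} c c′ p with at-++⁻ u p
... | inj₁ q = c q
... | inj₂ (j , refl , q) = let t , r , e = c′ q in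
  t , r , ≋-trans (≋-reflexive (sym (+-assoc o (length u) j))) e

cover-≋ : ∀ {A : Set} {s o₁ o₂ o₁′ o₂′} {u h : List A} → o₁ ≋ o₂ [ s ] → o₁′ ≋ o₂′ [ s ] →
          Cover s o₂ u o₂′ h → Cover s o₁ u o₁′ h
cover-≋ e e′ c {t} p = let t′ , q , f = c p in
  t′ , q , ≋-trans (≋-+ e (≋-refl {t})) (≋-trans f (≋-+ (≋-sym e′) (≋-refl {t′})))

cover-rep : ∀ {A : Set} {s o} n {h : List A} → length h ≋ 0 [ s ] → Cover s o (rep n h) o h
cover-rep zero e ()
cover-rep {s = s} {o} (suc n) {h} e =
  cover-++ {o = o} {u = h} (λ {t} p → t , p , ≋-refl)
    (cover-≋ {o₁′ = o} (≋-trans (≋-+ (≋-refl {o}) e) (≋-reflexive (+-identityʳ o))) ≋-refl (cover-rep {o = o} n e))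

length-[] : ∀ {A : Set} (u : List A) → ¬ 0 < length u → u ≡ []
length-[] []      p = refl
length-[] (_ ∷ _) p = contradiction z<s p

module Stable {m s : ℕ} {{s≢0 : NonZero s}} (C : Congruence m s) where

  open Congruence C public

  ~-reflexive : ∀ {u v} → u ≡ v → u ~ v
  ~-reflexive refl = ~-refl

  ~-++ˡ : ∀ p {u v} → u ~ v → p ++ u ~ p ++ v
  ~-++ˡ p e = ~-++ (~-refl {p}) e

  ~-++ʳ : ∀ q {u v} → u ~ v → u ++ q ~ v ++ q
  ~-++ʳ q e = ~-++ e (~-refl {q})

  ~-cast : ∀ {u u′ v v′} → u ≡ u′ → v ≡ v′ → u ~ v → u′ ~ v′
  ~-cast refl refl e = e

  -- p x lies in the right Green class of p, and x q in the left Green class of q.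
  StabR StabL : Word m → Word m → Set
  StabR p x = ∃[ r ] p ++ x ++ r ~ p
  StabL q x = ∃[ r ] r ++ x ++ q ~ q

  rep-fixʳ : ∀ {p z} n → p ++ z ~ p → p ++ rep n z ~ p
  rep-fixʳ {p} zero    e = ~-reflexive (++-identityʳ p)
  rep-fixʳ {p} {z} (suc n) e =
    ~-trans (~-reflexive (sym (++-assoc p z (rep n z))))
            (~-trans (~-++ʳ (rep n z) e) (rep-fixʳ n e))

  rep-fixˡ : ∀ {q z} n → z ++ q ~ q → rep n z ++ q ~ q
  rep-fixˡ zero    e = ~-refl
  rep-fixˡ {q} {z} (suc n) e =
    ~-trans (~-reflexive (++-assoc z (rep n z) q)) (~-trans (~-++ˡ z (rep-fixˡ n e)) e)

  fixʳ-length : ∀ {p z} → p ++ z ~ p → length z ≋ 0 [ s ]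
  fixʳ-length {p} {z} e = ≋-cancelˡ (length p)
    (≋-trans (≋-reflexive (sym (length-++ p)))
             (≋-trans (~-length e) (≋-reflexive (sym (+-identityʳ _)))))

  fixˡ-length : ∀ {q z} → z ++ q ~ q → length z ≋ 0 [ s ]
  fixˡ-length {q} {z} e = ≋-cancelʳ (length q)
    (≋-trans (≋-reflexive (sym (length-++ z))) (~-length e))


  pad : ∀ q {z} → 0 < length z → length z ≋ 0 [ s ] →
        ∃[ g ] g ~ z × length z + length g ≋ s [ suc q * s ]
  pad q {z} z>0 e with ≋-lift q s e
  -- Modulo d the word `z` has length `j * s`; a copy of length `suc (j * q) * s` brings the sum to
  -- `s + j * d`.
  ... | j , f with adjust z z>0 e (j * q)
  ... | g , l , g~z = g , g~z ,
    ≋-trans (≋-+ f (≋-reflexive l))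
            (≋-trans (≋-reflexive (total j q s)) (≋-trans (≋-+ (≋-refl {s}) (≋-*0 j _)) (≋-reflexive (+-identityʳ s))))
    where
    total : ∀ j q s → j * s + suc (j * q) * s ≡ s + j * (suc q * s)
    total = solve-∀

  module Saturated (q : ℕ) where

    d : ℕ
    d = suc q * s

    instance
      d≢0 : NonZero d
      d≢0 = m*n≢0 (suc q) s

    ≋-s : ∀ {a b} → a ≋ b [ d ] → a ≋ b [ s ]
    ≋-s = ≋-factor (suc q) s

    s≋0 : s ≋ 0 [ s ]
    s≋0 = mk≋ 0 1 refl

    period : Word m → Word m
    period h = rep (suc q) h

    lift-⊆ : ∀ h → length h ≋ s [ d ] → ∀ {o o′ u} → Cover s o u o′ h →
             enr d o u ⊆ᴬ enr d o′ (period h)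
    lift-⊆ h e = cover⇒⊆ᴬ {s = s} {q} e

    period-length : ∀ h → length h ≋ s [ d ] → length (period h) ≋ 0 [ d ]
    period-length h e = ≋-trans (≋-reflexive (length-rep (suc q) h))
      (≋-trans (≋-* (suc q) e) (mk≋ 0 1 (solved q s)))
      where
      solved : ∀ q s → suc q * s + 0 ≡ 0 + 1 * (suc q * s)
      solved = solve-∀

    enr-between : ∀ E x E′ h h′ → length h ≋ s [ d ] → length (period h′) ≋ 0 [ d ] →
                  enr d 0 (rep E (period h) ++ x ++ rep E′ (period h′)) ≡
                  rep E (enr d 0 (period h)) ++ enr d 0 x ++ rep E′ (enr d (length x) (period h′))
    enr-between E x E′ h h′ e e′ = begin
      enr d 0 (R ++ x ++ R′)
        ≡⟨ enr-++ 0 R _ ⟩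
      enr d 0 R ++ enr d (length R) (x ++ R′)
        ≡⟨ cong₂ _++_ (enr-rep 0 E (period h) ph) (enr-≋ (x ++ R′) R≋0) ⟩
      rep E (enr d 0 (period h)) ++ enr d 0 (x ++ R′)
        ≡⟨ cong (rep E (enr d 0 (period h)) ++_) (enr-++ 0 x R′) ⟩
      rep E (enr d 0 (period h)) ++ enr d 0 x ++ enr d (length x) R′
        ≡⟨ cong (λ t → rep E (enr d 0 (period h)) ++ enr d 0 x ++ t)
                (enr-rep (length x) E′ (period h′) e′) ⟩
      rep E (enr d 0 (period h)) ++ enr d 0 x ++ rep E′ (enr d (length x) (period h′)) ∎
      where
      open ≡-Reasoning
      R  = rep E (period h)
      R′ = rep E′ (period h′)
      ph = period-length h e
      R≋0 : length R ≋ 0 [ d ]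
      R≋0 = ≋-trans (≋-reflexive (length-rep E (period h)))
                    (≋-trans (≋-* E ph) (≋-reflexive (*-zeroʳ E)))

    length-between : ∀ R (x y : Word m) R′ → length x ≋ length y [ d ] →
                     length (R ++ x ++ R′) ≋ length (R ++ y ++ R′) [ d ]
    length-between R x y R′ e =
      subst₂ (λ a b → a ≋ b [ d ]) (sym (length-++³ R x R′)) (sym (length-++³ R y R′))
        (≋-+ (≋-refl {length R}) (≋-+ e (≋-refl {length R′})))

    length-rep-++ : ∀ h j (y : Word m) → length h ≋ s [ d ] → length (rep j h ++ y) ≋ length y + j * s [ d ]
    length-rep-++ h j y e = ≋-trans (≋-reflexive (trans (length-++ (rep j h)) (+-comm (length (rep j h)) (length y))))
      (≋-+ (≋-refl {length y}) (≋-trans (≋-reflexive (length-rep j h)) (≋-* j e)))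


    -- Between powers of `h`, words over its letters are equivalent at level k once their lengths
    -- agree modulo d. The copies `rep j h` repair the length; a prefix fixed by `h` absorbs them.
    between-loops : ∀ {k n h x y} → (∀ u v → Eqv k n d u v → u ~ v) → length h ≋ s [ d ] →
           Cover s 0 x 0 h → Cover s 0 y 0 h → length x ≋ 0 [ s ] → length y ≋ 0 [ s ] →
           ∃[ E ] ∃[ j ] rep E (period h) ++ x ++ rep E (period h) ~
                         rep E (period h) ++ (rep j h ++ y) ++ rep E (period h)
    between-loops {k} {n} {h} {x} {y} sat e cx cy x≋0 y≋0
      with ≋-lift q s (≋-trans x≋0 (≋-sym y≋0))
    ... | j , f = E , j , sat _ _ (eqv (length-between R x y′ R l) (sub cx cy′ l x≋0)
                                       (sub cy′ cx (≋-sym l) y′≋0))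
      where
      E = k * fill n
      R = rep E (period h)
      h≋0 : length h ≋ 0 [ s ]
      h≋0 = ≋-trans (≋-s e) s≋0
      y′ = rep j h ++ y
      l : length x ≋ length y′ [ d ]
      l = ≋-trans f (≋-sym (length-rep-++ h j y e))
      y′≋0 : length y′ ≋ 0 [ s ]
      y′≋0 = ≋-trans (≋-sym (≋-s l)) x≋0
      cy′ : Cover s 0 y′ 0 h
      cy′ = cover-++ (cover-rep {o = 0} j h≋0)
        (cover-≋ {o₁′ = 0} (≋-trans (≋-reflexive (length-rep j h)) (≋-trans (≋-* j h≋0) (≋-reflexive (*-zeroʳ j))))
                 ≋-refl cy)
      moved : ∀ {o o′} → o ≋ o′ [ s ] → enr d o (period h) ⊆ᴬ enr d o′ (period h)
      moved o≋o′ = lift-⊆ h e (cover-≋ o≋o′ ≋-refl (cover-rep (suc q) h≋0))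
      sub : ∀ {x y} → Cover s 0 x 0 h → Cover s 0 y 0 h → length x ≋ length y [ d ] → length x ≋ 0 [ s ] →
            Sub k n (enr d 0 (R ++ x ++ R)) (enr d 0 (R ++ y ++ R))
      sub {x} {y} cx cy l x≋0 = subst₂ (Sub k n)
        (sym (enr-between E x E h h e (period-length h e)))
        (sym (trans (enr-between E y E h h e (period-length h e))
                    (cong (λ t → rep E (enr d 0 (period h)) ++ enr d 0 y ++ rep E t)
                          (enr-≋ (period h) (≋-sym l)))))
        (sub-around k n (moved (≋-sym x≋0)) (moved x≋0) (lift-⊆ h e cx) (lift-⊆ h e cy))

    between : ∀ {k n h h′ u v} → (∀ u v → Eqv (suc k) n d u v → u ~ v) →
              length h ≋ s [ d ] → length h′ ≋ s [ d ] →
              Cover s 0 u 0 h → Cover s 0 u (length u) h′ →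
              enr d 0 v ⊆ᴬ enr d 0 u → Eqv k n d u v →
              rep (fill n) (period h) ++ u ++ rep (fill n) (period h′) ~
              rep (fill n) (period h) ++ v ++ rep (fill n) (period h′)
    between {k} {n} {h} {h′} {u} {v} sat e e′ c c′ v⊆u (eqv l s₁ s₂) =
      sat _ _ (eqv (length-between (rep (fill n) (period h)) u v (rep (fill n) (period h′)) l)
        (subst₂ (Sub (suc k) n) (sym eu) (sym ev) (sub-between k n uz vz uz′ vz′ s₁ s₂))
        (subst₂ (Sub (suc k) n) (sym ev) (sym eu) (sub-between k n vz uz vz′ uz′ s₂ s₁)))
      where
      eu = enr-between (fill n) u (fill n) h h′ e (period-length h′ e′)
      ev = trans (enr-between (fill n) v (fill n) h h′ e (period-length h′ e′))
                 (cong (λ t → rep (fill n) (enr d 0 (period h)) ++ enr d 0 v ++ rep (fill n) t)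
                       (enr-≋ (period h′) (≋-sym l)))
      uz = lift-⊆ h e c
      uz′ = lift-⊆ h′ e′ c′
      vz = ⊆ᴬ-trans v⊆u uz
      vz′ = ⊆ᴬ-trans v⊆u uz′

    module _ {n : ℕ} (sat : ∀ u v → Eqv 1 n d u v → u ~ v) where

      private F = fill n


      -- At level 1 the powers swallow what stands between them: the left one absorbs `w` and
      -- `rep j h`, the right one absorbs `w′`, and what the other word has in addition does no
      -- harm.
      split₁ : ∀ {h h′ w w′} → length h ≋ s [ d ] → length h′ ≋ s [ d ] →
               Cover s 0 w 0 h → Cover s 0 w′ (length w′) h′ → length w ≋ length w′ [ s ] →
               ∃[ j ] rep F (period h) ++ w ++ rep F (period h′) ~
                      rep F (period h) ++ (rep j h ++ w′) ++ rep F (period h′)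
      split₁ {h} {h′} {w} {w′} e e′ c c′ f with ≋-lift q s f
      ... | j , f′ = j , sat _ _ (eqv (length-between (rep F (period h)) w v (rep F (period h′)) l)
          (subst₂ (Sub 1 n) (sym ew) (sym ev) up) (subst₂ (Sub 1 n) (sym ev) (sym ew) down))
        where
        v = rep j h ++ w′
        l : length w ≋ length v [ d ]
        l = ≋-trans f′ (≋-sym (length-rep-++ h j w′ e))
        Z  = enr d 0 (period h)
        Z′ = enr d (length w) (period h′)
        ew = enr-between F w F h h′ e (period-length h′ e′)
        ev = trans (enr-between F v F h h′ e (period-length h′ e′))
                   (cong (λ t → rep F Z ++ enr d 0 v ++ rep F t) (enr-≋ (period h′) (≋-sym l)))
        h≋0 : length h ≋ 0 [ s ]
        h≋0 = ≋-trans (≋-s e) s≋0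
        o = length (rep j h)
        o≋0 : o ≋ 0 [ s ]
        o≋0 = ≋-trans (≋-reflexive (length-rep j h)) (≋-trans (≋-* j h≋0) (≋-reflexive (*-zeroʳ j)))
        up : Sub 1 n (rep F Z ++ enr d 0 w ++ rep F Z′) (rep F Z ++ enr d 0 v ++ rep F Z′)
        up = subst (λ t → Sub 1 n t (rep F Z ++ enr d 0 v ++ rep F Z′)) (++-assoc (rep F Z) _ _)
               (sub-++ (pump n (⊆ᴬ-++ (rep F Z) (rep-⊆ F Z) (lift-⊆ h e c)))
                       (sub-wkˡ (enr d 0 v) (sub-refl (rep F Z′))))
        down : Sub 1 n (rep F Z ++ enr d 0 v ++ rep F Z′) (rep F Z ++ enr d 0 w ++ rep F Z′)
        down = subst (λ t → Sub 1 n t (rep F Z ++ enr d 0 w ++ rep F Z′))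
                 (trans (solve-list (rep F Z) (enr d 0 (rep j h)) (enr d o w′) (rep F Z′))
                        (cong (λ t → rep F Z ++ t ++ rep F Z′) (sym (enr-++ 0 (rep j h) w′))))
                 (sub-++ (pump n (⊆ᴬ-++ (rep F Z) (rep-⊆ F Z) (lift-⊆ h e (cover-rep {o = 0} j h≋0))))
                         (sub-wkˡ (enr d 0 w) (pump n (⊆ᴬ-++ (enr d o w′)
                            (lift-⊆ h′ e′ (cover-≋ o≋0 f c′)) (rep-⊆ F Z′)))))
          where
          solve-list : (a b c d : List (Fin m × ℕ)) → (a ++ b) ++ (c ++ d) ≡ a ++ (b ++ c) ++ d
          solve-list a b c d = solve (++-monoid (Fin m × ℕ))

      -- This lemma and `splitˡ` serve the cases where one of the two factors is empty and therefore
      -- provides no loop of positive length.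
      splitʳ : ∀ {h w} → length h ≋ s [ d ] → Cover s 0 w 0 h → length w ≋ 0 [ s ] →
               ∃[ j ] rep F (period h) ++ w ~ rep F (period h) ++ rep j h
      splitʳ {h} {w} e c f with ≋-lift q s f
      ... | j , f′ = j , sat _ _ (eqv len (sub c) (sub (cover-rep {o = 0} j (≋-trans (≋-s e) s≋0))))
        where
        R = rep F (period h)
        Z = enr d 0 (period h)
        len : length (R ++ w) ≋ length (R ++ rep j h) [ d ]
        len = subst₂ (λ a b → a ≋ b [ d ]) (sym (length-++ R)) (sym (length-++ R))
          (≋-+ (≋-refl {length R}) (≋-trans f′ (≋-sym (≋-trans (≋-reflexive (length-rep j h)) (≋-* j e)))))
        en : ∀ x → enr d 0 (R ++ x) ≡ rep F Z ++ enr d 0 x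
        en x = trans (cong (enr d 0) (cong (R ++_) (sym (++-identityʳ x))))
                 (trans (enr-between F x 0 h h e (period-length h e))
                        (cong (rep F Z ++_) (++-identityʳ (enr d 0 x))))
        sub : ∀ {x y} → Cover s 0 x 0 h → Sub 1 n (enr d 0 (R ++ x)) (enr d 0 (R ++ y))
        sub {x} {y} c = subst₂ (Sub 1 n) (sym (en x)) (sym (en y))
          (sub-wkʳ (enr d 0 y) (pump n (⊆ᴬ-++ (rep F Z) (rep-⊆ F Z) (lift-⊆ h e c))))

      splitˡ : ∀ {h w} → length h ≋ s [ d ] → Cover s 0 w (length w) h → length w ≋ 0 [ s ] →
               ∃[ j ] w ++ rep F (period h) ~ rep j h ++ rep F (period h)
      splitˡ {h} {w} e c f with ≋-lift q s f
      ... | j , f′ = j , sat _ _ (eqv len (sub c f″)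
                           (sub (cover-≋ {o₂ = 0} {o₂′ = 0} ≋-refl (≋-trans (≋-sym (≋-s f″)) f)
                                   (cover-rep j (≋-trans (≋-s e) s≋0))) (≋-sym f″)))
        where
        R = rep F (period h)
        f″ : length w ≋ length (rep j h) [ d ]
        f″ = ≋-trans f′ (≋-sym (≋-trans (≋-reflexive (length-rep j h)) (≋-* j e)))
        len : length (w ++ R) ≋ length (rep j h ++ R) [ d ]
        len = subst₂ (λ a b → a ≋ b [ d ]) (sym (length-++ w)) (sym (length-++ (rep j h)))
          (≋-+ f″ (≋-refl {length R}))
        en : ∀ x → enr d 0 (x ++ R) ≡ enr d 0 x ++ rep F (enr d (length x) (period h))
        en x = enr-between 0 x F h h e (period-length h e)
        sub : ∀ {x y} → Cover s 0 x (length x) h → length x ≋ length y [ d ] →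
              Sub 1 n (enr d 0 (x ++ R)) (enr d 0 (y ++ R))
        sub {x} {y} c l = subst₂ (Sub 1 n) (sym (en x))
          (sym (trans (en y) (cong (λ t → enr d 0 y ++ rep F t) (enr-≋ (period h) (≋-sym l)))))
          (sub-wkˡ (enr d 0 y) (pump n (⊆ᴬ-++ (enr d 0 x) (lift-⊆ h e c) (rep-⊆ F Z))))
          where Z = enr d (length x) (period h)

cover-in : ∀ {A : Set} {s o o′} {h : List A} a {x} b → h ≡ a ++ x ++ b → o ≋ o′ + length a [ s ] →
           Cover s o x o′ h
cover-in a b refl e = cover-factor a b e

cover-trans : ∀ {A : Set} {s o o′ o″} {u v w : List A} →
              Cover s o u o′ v → Cover s o′ v o″ w → Cover s o u o″ w
cover-trans c c′ p = let t , q , e = c p ; t′ , r , e′ = c′ q in t′ , r , ≋-trans e e′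

-- Green classes and the derived congruence

infix 3 _⇌_

_⇌_ : Set → Set → Set
A ⇌ B = (A → B) × (B → A)

module Green {m s : ℕ} {{s≢0 : NonZero s}} (C : Congruence m s) where

  open Stable C public

  stabR-fst : ∀ {p u v} → StabR p (u ++ v) → StabR p u
  stabR-fst {p} {u} {v} (r , e) = v ++ r , ~-trans (~-reflexive (cong (p ++_) (sym (++-assoc u v r)))) e

  stabR-snd : ∀ {p u v} → StabR p (u ++ v) → StabR (p ++ u) v
  stabR-snd {p} {u} {v} (r , e) = r ++ u , ~-trans (~-reflexive (lemma p u v r)) (~-++ʳ u e)
    where
    lemma : (p u v r : Word m) → (p ++ u) ++ v ++ r ++ u ≡ (p ++ (u ++ v) ++ r) ++ u
    lemma p u v r = solve (++-monoid (Fin m))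

  stabR-++ : ∀ {p u v} → StabR p u → StabR (p ++ u) v → StabR p (u ++ v)
  stabR-++ {p} {u} {v} (r , e) (r′ , e′) = r′ ++ r ,
    ~-trans (~-reflexive (lemma p u v r r′))
            (~-trans (~-++ʳ r e′) (~-trans (~-reflexive (++-assoc p u r)) e))
    where
    lemma : (p u v r r′ : Word m) → p ++ (u ++ v) ++ r′ ++ r ≡ ((p ++ u) ++ v ++ r′) ++ r
    lemma p u v r r′ = solve (++-monoid (Fin m))

  stabL-snd : ∀ {q u v} → StabL q (u ++ v) → StabL q v
  stabL-snd {q} {u} {v} (r , e) = r ++ u , ~-trans (~-reflexive (lemma r u v q)) e
    where
    lemma : (r u v q : Word m) → (r ++ u) ++ v ++ q ≡ r ++ (u ++ v) ++ q
    lemma r u v q = solve (++-monoid (Fin m))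

  stabL-fst : ∀ {q u v} → StabL q (u ++ v) → StabL (v ++ q) u
  stabL-fst {q} {u} {v} (r , e) = v ++ r , ~-trans (~-reflexive (lemma r u v q)) (~-++ˡ v e)
    where
    lemma : (r u v q : Word m) → (v ++ r) ++ u ++ v ++ q ≡ v ++ r ++ (u ++ v) ++ q
    lemma r u v q = solve (++-monoid (Fin m))

  stabL-++ : ∀ {q u v} → StabL q v → StabL (v ++ q) u → StabL q (u ++ v)
  stabL-++ {q} {u} {v} (r , e) (r′ , e′) = r ++ r′ ,
    ~-trans (~-reflexive (lemma r r′ u v q)) (~-trans (~-++ˡ r e′) e)
    where
    lemma : (r r′ u v q : Word m) → (r ++ r′) ++ (u ++ v) ++ q ≡ r ++ (r′ ++ u ++ v ++ q)
    lemma r r′ u v q = solve (++-monoid (Fin m))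

  stabR-[] : ∀ {p} → StabR p []
  stabR-[] {p} = [] , ~-reflexive (++-identityʳ p)

  stabL-[] : ∀ {q} → StabL q []
  stabL-[] = [] , ~-refl

  stabR-~ : ∀ {p p′ x x′} → p ~ p′ → x ~ x′ → StabR p x → StabR p′ x′
  stabR-~ e f (r , g) = r , ~-trans (~-++ (~-sym e) (~-++ʳ r (~-sym f))) (~-trans g e)

  stabL-~ : ∀ {q q′ x x′} → q ~ q′ → x ~ x′ → StabL q x → StabL q′ x′
  stabL-~ e f (r , g) = r , ~-trans (~-++ˡ r (~-++ (~-sym f) (~-sym e))) (~-trans g e)

  ∀? : {P : Word m → Set} → (∀ {u v} → u ~ v → P u → P v) → (∀ u → Dec (P u)) → Dec (∀ u → P u)
  ∀? {P} resp P? with All.all? P? reps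
  ... | yes ps = yes (λ u → let r , r∈ , e = Mem.find (reps-complete u) in resp e (All.lookup ps r∈))
  ... | no ¬ps = no (λ f → ¬ps (All.universal f reps))

  ∃? : {P : Word m → Set} → (∀ {u v} → u ~ v → P u → P v) → (∀ u → Dec (P u)) → Dec (∃ P)
  ∃? {P} resp P? with Any.any? P? reps
  ... | yes ps = yes (Any.satisfied ps)
  ... | no ¬ps = no (λ (u , p) → ¬ps (Any.map (λ e → resp (~-sym e) p) (reps-complete u)))

  StabR? : ∀ p x → Dec (StabR p x)
  StabR? p x = ∃? (λ e f → ~-trans (~-++ˡ p (~-++ˡ x (~-sym e))) f) (λ r → p ++ x ++ r ~? p)

  StabL? : ∀ q x → Dec (StabL q x)
  StabL? q x = ∃? (λ e f → ~-trans (~-++ʳ (x ++ q) (~-sym e)) f) (λ r → r ++ x ++ q ~? q)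

  -- The congruence for the next lower level: `x` and `y` may be exchanged wherever they stay inside
  -- the right Green class of the prefix and the left one of the suffix. Equal stability makes this
  -- condition symmetric.
  record _≈_ (x y : Word m) : Set where
    constructor mk≈
    field
      ≈-length : length x ≋ length y [ s ]
      stabR⇌   : ∀ p → StabR p x ⇌ StabR p y
      stabL⇌   : ∀ q → StabL q x ⇌ StabL q y
      middle   : ∀ p q → StabR p x → StabL q x → p ++ x ++ q ~ p ++ y ++ q

  open _≈_ public

  ~⇒≈ : ∀ {x y} → x ~ y → x ≈ y
  ~⇒≈ e = mk≈ (~-length e) (λ p → stabR-~ ~-refl e , stabR-~ ~-refl (~-sym e))
              (λ q → stabL-~ ~-refl e , stabL-~ ~-refl (~-sym e)) (λ p q _ _ → ~-++ˡ p (~-++ʳ q e))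

  ≈-sym : ∀ {x y} → x ≈ y → y ≈ x
  ≈-sym (mk≈ l R L M) = mk≈ (≋-sym l) (λ p → let a , b = R p in b , a) (λ q → let a , b = L q in b , a)
    (λ p q f g → ~-sym (M p q (proj₂ (R p) f) (proj₂ (L q) g)))

  ≈-trans : ∀ {x y z} → x ≈ y → y ≈ z → x ≈ z
  ≈-trans (mk≈ l R L M) (mk≈ l′ R′ L′ M′) = mk≈ (≋-trans l l′)
    (λ p → proj₁ (R′ p) ∘ proj₁ (R p) , proj₂ (R p) ∘ proj₂ (R′ p))
    (λ p → proj₁ (L′ p) ∘ proj₁ (L p) , proj₂ (L p) ∘ proj₂ (L′ p))
    (λ p q f g → ~-trans (M p q f g) (M′ p q (proj₁ (R p) f) (proj₁ (L q) g)))

  ⇌? : ∀ {A B : Set} → Dec A → Dec B → Dec (A ⇌ B)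
  ⇌? a b = (a →-dec b) ×-dec (b →-dec a)

  stabR⇌? : ∀ x y → Dec (∀ p → StabR p x ⇌ StabR p y)
  stabR⇌? x y = ∀? {λ p → StabR p x ⇌ StabR p y}
    (λ e (f , g) → (λ z → stabR-~ e ~-refl (f (stabR-~ (~-sym e) ~-refl z))) ,
                   (λ z → stabR-~ e ~-refl (g (stabR-~ (~-sym e) ~-refl z))))
    (λ p → ⇌? (StabR? p x) (StabR? p y))

  stabL⇌? : ∀ x y → Dec (∀ q → StabL q x ⇌ StabL q y)
  stabL⇌? x y = ∀? {λ q → StabL q x ⇌ StabL q y}
    (λ e (f , g) → (λ z → stabL-~ e ~-refl (f (stabL-~ (~-sym e) ~-refl z))) ,
                   (λ z → stabL-~ e ~-refl (g (stabL-~ (~-sym e) ~-refl z))))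
    (λ q → ⇌? (StabL? q x) (StabL? q y))

  Middle~ : Word m → Word m → Word m → Word m → Set
  Middle~ x y p q = StabR p x → StabL q x → p ++ x ++ q ~ p ++ y ++ q

  middle? : ∀ x y → Dec (∀ p q → Middle~ x y p q)
  middle? x y = ∀? {λ p → ∀ q → Middle~ x y p q}
    (λ e f q a b → ~-trans (~-++ʳ (x ++ q) (~-sym e))
                     (~-trans (f q (stabR-~ (~-sym e) ~-refl a) b) (~-++ʳ (y ++ q) e)))
    (λ p → ∀? {Middle~ x y p}
      (λ e f a b → ~-trans (~-++ˡ p (~-++ˡ x (~-sym e)))
                     (~-trans (f a (stabL-~ (~-sym e) ~-refl b)) (~-++ˡ p (~-++ˡ y e))))
      (λ q → StabR? p x →-dec (StabL? q x →-dec (p ++ x ++ q ~? p ++ y ++ q))))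

  _≈?_ : ∀ x y → Dec (x ≈ y)
  x ≈? y with length x % s ≟ length y % s | stabR⇌? x y | stabL⇌? x y | middle? x y
  ... | yes l | yes R | yes L | yes M = yes (mk≈ (%⇒≋ l) R L M)
  ... | no ¬l | _     | _     | _     = no (λ e → ¬l (≋⇒% (≈-length e)))
  ... | _     | no ¬R | _     | _     = no (λ e → ¬R (stabR⇌ e))
  ... | _     | _     | no ¬L | _     = no (λ e → ¬L (stabL⇌ e))
  ... | _     | _     | _     | no ¬M = no (λ e → ¬M (middle e))

  fix³ : ∀ {p a b c} → p ++ a ~ p → p ++ b ~ p → p ++ c ~ p → p ++ a ++ b ++ c ~ p
  fix³ {p} {a} {b} {c} e f g =
    ~-trans (~-reflexive (sym (++-assoc p a (b ++ c)))) (~-trans (~-++ʳ (b ++ c) e)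
      (~-trans (~-reflexive (sym (++-assoc p b c))) (~-trans (~-++ʳ c f) g)))

  fix³ˡ : ∀ {q a b c} → a ++ q ~ q → b ++ q ~ q → c ++ q ~ q → (a ++ b ++ c) ++ q ~ q
  fix³ˡ {q} {a} {b} {c} e f g =
    ~-trans (~-reflexive (trans (++-assoc a (b ++ c) q) (cong (a ++_) (++-assoc b c q))))
      (~-trans (~-++ˡ a (~-++ˡ b g)) (~-trans (~-++ˡ a f) e))

  module Loops (q₀ : ℕ) where

    open Saturated q₀ public

    loopʳ : ∀ {p c} → 0 < length c → p ++ c ~ p →
            ∃[ g ] length (c ++ g) ≋ s [ d ] × p ++ (c ++ g) ~ p
    loopʳ {p} {c} c>0 e =
      let g , g~c , l = pad q₀ {c} c>0 (fixʳ-length {p} {c} e) in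
      g , ≋-trans (≋-reflexive (length-++ c)) l ,
      ~-trans (~-reflexive (sym (++-assoc p c g))) (~-trans (~-++ {p ++ c} {p} {g} {c} e g~c) e)

    loopˡ : ∀ {q c} → 0 < length c → c ++ q ~ q →
            ∃[ g ] length (g ++ c) ≋ s [ d ] × (g ++ c) ++ q ~ q
    loopˡ {q} {c} c>0 e =
      let g , g~c , l = pad q₀ {c} c>0 (fixˡ-length {q} {c} e) in
      g , ≋-trans (≋-reflexive (trans (length-++ g) (+-comm (length g) (length c)))) l ,
      ~-trans (~-reflexive (++-assoc g c q)) (~-trans (~-++ {g} {c} {c ++ q} {q} g~c e) e)

    period-fixʳ : ∀ {p h} E → p ++ h ~ p → p ++ rep E (period h) ~ p
    period-fixʳ E e = rep-fixʳ E (rep-fixʳ (suc q₀) e)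

    period-fixˡ : ∀ {q h} E → h ++ q ~ q → rep E (period h) ++ q ~ q
    period-fixˡ E e = rep-fixˡ E (rep-fixˡ (suc q₀) e)

    cover-[] : ∀ {x c : Word m} → Cover s 0 x 0 c → ¬ 0 < length c → x ≡ []
    cover-[] {x} cov c≯0 = length-[] x (λ x>0 →
      c≯0 (≤-trans z<s (at-< (proj₁ (proj₂ (cov (proj₂ (<-at x x>0))))))))

    -- Between powers of a prolonged loop, `x` cannot be told from a power of the loop itself, and
    -- `p` absorbs all of these; the right-hand power is the word `r`.
    absorbʳ : ∀ {k n p c x} → (∀ u v → Eqv k n d u v → u ~ v) →
              p ++ c ~ p → Cover s 0 x 0 c → length x ≋ 0 [ s ] → ∃[ r ] p ++ x ++ r ~ p
    absorbʳ {k} {n} {p} {c} {x} sat e cov x≋0 = go (0 <? length c)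
      where
      looped : ∀ g → length (c ++ g) ≋ s [ d ] → p ++ (c ++ g) ~ p → ∃[ r ] p ++ x ++ r ~ p
      looped g l e′ =
        let E , j , f = between-loops {k} {n} {c ++ g} {x} {[]} sat l
                          (cover-trans {v = c} cov (cover-factor [] {c} g ≋-refl)) (λ ()) x≋0 ≋-refl
        in rep E (period (c ++ g)) , via E j f
        where
        via : ∀ E j → (let R = rep E (period (c ++ g)) in
              R ++ x ++ R ~ R ++ (rep j (c ++ g) ++ []) ++ R → p ++ x ++ R ~ p)
        via E j f =
          ~-trans (~-++ʳ (x ++ R) (~-sym pR)) (~-trans (~-reflexive (++-assoc p R (x ++ R)))
            (~-trans (~-++ˡ p f) (fix³ pR pj pR)))
          where
          R = rep E (period (c ++ g))
          pR : p ++ R ~ p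
          pR = period-fixʳ {p} {c ++ g} E e′
          pj : p ++ (rep j (c ++ g) ++ []) ~ p
          pj = ~-trans (~-++ˡ p (~-reflexive (++-identityʳ (rep j (c ++ g))))) (rep-fixʳ j e′)
      go : Dec (0 < length c) → ∃[ r ] p ++ x ++ r ~ p
      go (no c≯0)  = [] , ~-reflexive (trans (cong (λ t → p ++ t ++ []) (cover-[] cov c≯0)) (++-identityʳ p))
      go (yes c>0) = let g , l , e′ = loopʳ {p} {c} c>0 e in looped g l e′

    absorbˡ : ∀ {k n q c x} → (∀ u v → Eqv k n d u v → u ~ v) →
              c ++ q ~ q → Cover s 0 x 0 c → length x ≋ 0 [ s ] → ∃[ r ] r ++ x ++ q ~ q
    absorbˡ {k} {n} {q} {c} {x} sat e cov x≋0 = go (0 <? length c)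
      where
      looped : ∀ g → length (g ++ c) ≋ s [ d ] → (g ++ c) ++ q ~ q → ∃[ r ] r ++ x ++ q ~ q
      looped g l e′ =
        let E , j , f = between-loops {k} {n} {g ++ c} {x} {[]} sat l
                          (cover-trans {v = c} cov
                            (cover-in g {c} [] (cong (g ++_) (sym (++-identityʳ c))) (≋-sym g≋0)))
                          (λ ()) x≋0 ≋-refl
        in rep E (period (g ++ c)) , via E j f
        where
        g≋0 : length g ≋ 0 [ s ]
        g≋0 = ≋-cancelʳ (length c) (≋-trans (≋-reflexive (sym (length-++ g)))
                (≋-trans (≋-trans (≋-s l) s≋0) (≋-sym (fixˡ-length {q} {c} e))))
        via : ∀ E j → (let R = rep E (period (g ++ c)) in
              R ++ x ++ R ~ R ++ (rep j (g ++ c) ++ []) ++ R → R ++ x ++ q ~ q)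
        via E j f =
          ~-trans (~-++ˡ R (~-++ˡ x (~-sym pR)))
            (~-trans (~-reflexive (lemma R x R q)) (~-trans (~-++ʳ q f) (fix³ˡ pR pj pR)))
          where
          R = rep E (period (g ++ c))
          pR : R ++ q ~ q
          pR = period-fixˡ {q} {g ++ c} E e′
          pj : (rep j (g ++ c) ++ []) ++ q ~ q
          pj = ~-trans (~-++ʳ q (~-reflexive (++-identityʳ (rep j (g ++ c))))) (rep-fixˡ j e′)
          lemma : (a b c d : Word m) → a ++ b ++ c ++ d ≡ (a ++ b ++ c) ++ d
          lemma a b c d = solve (++-monoid (Fin m))
      go : Dec (0 < length c) → ∃[ r ] r ++ x ++ q ~ q
      go (no c≯0)  = [] , ~-reflexive (cong (_++ q) (cover-[] cov c≯0))
      go (yes c>0) = let g , l , e′ = loopˡ {q} {c} c>0 e in looped g l e′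

    module Derive {k n : ℕ} (sat : ∀ u v → Eqv k n d u v → u ~ v) where

      -- The letters readable within a Green class depend only on the residue
      -- of the position where they are read.
      transferʳ : ∀ {p x y z} → StabR p (x ++ z) → StabR p y → length x ≋ length y [ s ] →
                  StabR p (y ++ z)
      transferʳ {p} {x} {y} {z} (r , e) (r′ , e′) l =
        let R , f = absorbʳ sat loop cov len in
        r ++ R , ~-trans (~-reflexive (cong (p ++_) (lemma y z r R))) f
        where
        lemma : (y z r R : Word m) → (y ++ z) ++ r ++ R ≡ (y ++ z ++ r) ++ R
        lemma y z r R = solve (++-monoid (Fin m))
        -- One loop through both `x z r` and `y r′`. The word `y z r` finds `y` in the second part
        -- and `z r` in the first, at the same residues because `x` and `y` have congruent lengths.
        loop : p ++ (((x ++ z) ++ r) ++ y ++ r′) ~ p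
        loop = ~-trans (~-reflexive (sym (++-assoc p ((x ++ z) ++ r) (y ++ r′)))) (~-trans (~-++ʳ (y ++ r′) e) e′)
        first≋0 : length ((x ++ z) ++ r) ≋ 0 [ s ]
        first≋0 = fixʳ-length e
        split : (x y z r r′ : Word m) → ((x ++ z) ++ r) ++ y ++ r′ ≡ x ++ (z ++ r) ++ y ++ r′
        split x y z r r′ = solve (++-monoid (Fin m))
        cov : Cover s 0 (y ++ z ++ r) 0 (((x ++ z) ++ r) ++ y ++ r′)
        cov = cover-++ {o = 0} {u = y} (cover-in ((x ++ z) ++ r) r′ refl (≋-sym first≋0))
                       (cover-in x (y ++ r′) (split x y z r r′) (≋-sym l))
        len : length (y ++ z ++ r) ≋ 0 [ s ]
        len = ≋-trans (≋-reflexive (length-++ y)) (≋-trans (≋-+ (≋-sym l) (≋-refl {length (z ++ r)}))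
          (≋-trans (≋-reflexive (trans (sym (length-++ x)) (cong length (sym (++-assoc x z r))))) first≋0))

      transferˡ : ∀ {q x y z} → StabL q (z ++ x) → StabL q y → length x ≋ length y [ s ] →
                  StabL q (z ++ y)
      transferˡ {q} {x} {y} {z} (r , e) (r′ , e′) l =
        let R , f = absorbˡ sat loop cov len in
        R ++ r , ~-trans (~-reflexive (lemma R r z y q)) f
        where
        lemma : (R r z y q : Word m) → (R ++ r) ++ (z ++ y) ++ q ≡ R ++ (r ++ z ++ y) ++ q
        lemma R r z y q = solve (++-monoid (Fin m))
        c₁ c₂ : Word m
        c₁ = r ++ z ++ x
        c₂ = r′ ++ y
        fix₁ : c₁ ++ q ~ q
        fix₁ = ~-trans (~-reflexive (assoc r z x q)) e
          where
          assoc : (r z x q : Word m) → (r ++ z ++ x) ++ q ≡ r ++ (z ++ x) ++ q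
          assoc r z x q = solve (++-monoid (Fin m))
        fix₂ : c₂ ++ q ~ q
        fix₂ = ~-trans (~-reflexive (++-assoc r′ y q)) e′
        loop : (c₁ ++ c₂) ++ q ~ q
        loop = ~-trans (~-reflexive (++-assoc c₁ c₂ q)) (~-trans (~-++ˡ c₁ fix₂) fix₁)
        len′ : length (r ++ z) + length x ≋ 0 [ s ]
        len′ = ≋-trans (≋-reflexive (trans (sym (length-++ (r ++ z))) (cong length (++-assoc r z x)))) (fixˡ-length fix₁)
        rz+y : length (r ++ z) + length y ≋ 0 [ s ]
        rz+y = ≋-trans (≋-+ (≋-refl {length (r ++ z)}) (≋-sym l)) len′
        cov : Cover s 0 (r ++ z ++ y) 0 (c₁ ++ c₂)
        cov = subst (λ t → Cover s 0 t 0 (c₁ ++ c₂)) (++-assoc r z y)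
          (cover-++ {o = 0} {u = r ++ z}
            (cover-in [] (x ++ c₂) (split r z x c₂) ≋-refl)
            (cover-in (c₁ ++ r′) [] (split′ c₁ r′ y) (≋-cancelʳ (length y)
              (≋-trans rz+y (≋-trans (≋-sym (fixˡ-length loop))
                 (≋-reflexive (trans (cong length (sym (++-assoc c₁ r′ y))) (length-++ (c₁ ++ r′)))))))))
          where
          split : (r z x c : Word m) → (r ++ z ++ x) ++ c ≡ (r ++ z) ++ x ++ c
          split r z x c = solve (++-monoid (Fin m))
          split′ : (c r y : Word m) → c ++ r ++ y ≡ (c ++ r) ++ y ++ []
          split′ c r y = solve (++-monoid (Fin m))
        len : length (r ++ z ++ y) ≋ 0 [ s ]
        len = ≋-trans (≋-reflexive (trans (cong length (sym (++-assoc r z y))) (length-++ (r ++ z)))) rz+y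

      -- Exchanging `u` changes the prefix in front of `v`; `transferʳ` shows that `v` is stable for
      -- the new prefix as well, so that it can be exchanged next.
      ≈-++ : ∀ {u u′ v v′} → u ≈ u′ → v ≈ v′ → (u ++ v) ≈ (u′ ++ v′)
      ≈-++ {u} {u′} {v} {v′} a b = mk≈
        (subst₂ (λ x y → x ≋ y [ s ]) (sym (length-++ u)) (sym (length-++ u′)) (≋-+ (≈-length a) (≈-length b)))
        (λ p → right a b p , right (≈-sym a) (≈-sym b) p)
        (λ q → left a b q , left (≈-sym a) (≈-sym b) q)
        (λ p q f g → ~-trans (~-reflexive (cong (p ++_) (++-assoc u v q)))
          (~-trans (middle a p (v ++ q) (stabR-fst f) (stabL-fst g))
          (~-trans (~-reflexive (sym (++-assoc p u′ (v ++ q))))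
          (~-trans (middle b (p ++ u′) q (stabR-snd (mixedR a f)) (stabL-snd g))
                   (~-reflexive (lemma p u′ v′ q))))))
        where
        lemma : (p u v q : Word m) → (p ++ u) ++ v ++ q ≡ p ++ (u ++ v) ++ q
        lemma p u v q = solve (++-monoid (Fin m))
        mixedR : ∀ {u u′ v p} → u ≈ u′ → StabR p (u ++ v) → StabR p (u′ ++ v)
        mixedR a f = transferʳ f (proj₁ (stabR⇌ a _) (stabR-fst f)) (≈-length a)
        mixedL : ∀ {u v v′ q} → v ≈ v′ → StabL q (u ++ v) → StabL q (u ++ v′)
        mixedL b f = transferˡ f (proj₁ (stabL⇌ b _) (stabL-snd f)) (≈-length b)
        right : ∀ {u u′ v v′} → u ≈ u′ → v ≈ v′ → ∀ p → StabR p (u ++ v) → StabR p (u′ ++ v′)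
        right {u} {u′} {v} {v′} a b p f = let g = mixedR {v = v} a f in
          stabR-++ (stabR-fst {p} {u′} {v} g) (proj₁ (stabR⇌ b (p ++ u′)) (stabR-snd {p} {u′} {v} g))
        left : ∀ {u u′ v v′} → u ≈ u′ → v ≈ v′ → ∀ q → StabL q (u ++ v) → StabL q (u′ ++ v′)
        left {u} {u′} {v} {v′} a b q f = let g = mixedL {u} b f in
          stabL-++ (stabL-snd {q} {u} {v′} g) (proj₁ (stabL⇌ a (v′ ++ q)) (stabL-fst {q} {u} {v′} g))

      derived : Congruence m s
      derived = record
        { _~_ = _≈_
        ; ~-refl = ~⇒≈ ~-refl
        ; ~-sym = ≈-sym
        ; ~-trans = ≈-trans
        ; ~-++ = ≈-++
        ; _~?_ = _≈?_
        ; ~-length = ≈-length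
        -- The coarser congruence keeps the list, hence the same constant enters the number of
        -- rounds at all levels.
        ; reps = reps
        ; reps-complete = λ u → Any.map ~⇒≈ (reps-complete u)
        ; adjust = λ g g>0 e j → let g′ , l , f = adjust g g>0 e j in g′ , l , ~⇒≈ f
        }

    enr-cover : ∀ {u v : Word m} → enr d 0 v ⊆ᴬ enr d 0 u → Cover s 0 v 0 u
    enr-cover f {t} p with f (at-enr 0 p)
    ... | t′ , r with at-enr⁻ 0 r
    ...   | _ , r′ , e with cong proj₁ e
    ...     | refl = t′ , r′ , ≋-s (%⇒≋ (cong proj₂ e))

    sub⇒⊇ᴬ : ∀ {B : Set} {k n} {u v : List B} → Sub (suc k) (suc n) v u → v ⊆ᴬ u
    sub⇒⊇ᴬ s p = let j , _ , t = forth s p in j , proj₁ (sim-col t) p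

    >0-++ˡ : ∀ (u v : Word m) → 0 < length u → 0 < length (u ++ v)
    >0-++ˡ (_ ∷ _) v _ = z<s

    >0-++ʳ : ∀ (u v : Word m) → 0 < length v → 0 < length (u ++ v)
    >0-++ʳ []      v p = p
    >0-++ʳ (_ ∷ _) v _ = z<s

    insert : ∀ F {p q h h′} → p ++ h ~ p → h′ ++ q ~ q → ∀ x →
             p ++ (rep F (period h) ++ x ++ rep F (period h′)) ++ q ~ p ++ x ++ q
    insert F {p} {q} {h} {h′} f f′ x = ~-trans (~-reflexive (lemma p (rep F (period h)) x (rep F (period h′)) q))
      (~-++ (period-fixʳ {p} {h} F f) (~-++ˡ x (period-fixˡ {q} {h′} F f′)))
      where
      lemma : (p R x R′ q : Word m) → p ++ (R ++ x ++ R′) ++ q ≡ (p ++ R) ++ x ++ (R′ ++ q)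
      lemma p R x R′ q = solve (++-monoid (Fin m))

    cover-last : ∀ g r u → length (g ++ r ++ u) ≋ s [ d ] → Cover s 0 u (length u) (g ++ r ++ u)
    cover-last g r u l = cover-in (g ++ r) [] (split g r u)
      (≋-trans (≋-sym (≋-trans (≋-s l) s≋0)) (≋-reflexive (trans (cong length (sym (++-assoc g r u)))
         (trans (length-++ (g ++ r)) (+-comm (length (g ++ r)) (length u))))))
      where
      split : (g r u : Word m) → g ++ r ++ u ≡ (g ++ r) ++ u ++ []
      split g r u = solve (++-monoid (Fin m))

    -- One level of the game is absorbed by the loops on both sides.
    derived-saturated : ∀ {k n} → (∀ u v → Eqv (suc (suc k)) n d u v → u ~ v) →
                        ∀ u v → Eqv (suc k) (suc n) d u v → u ≈ v
    derived-saturated {k} {n} sat u v E = mk≈ (≋-s (Eqv.lengths E))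
      (λ p → stabʳ E , stabʳ (eqv-sym E)) (λ q → stabˡ E , stabˡ (eqv-sym E)) mid
      where
      -- One round of the game shows that the labelled letters of `v` occur in `u`; therefore the
      -- loop `u r` covers `v r`. This is what the additional round is spent on.
      stabʳ : ∀ {u v p} → Eqv (suc k) (suc n) d u v → StabR p u → StabR p v
      stabʳ {u} {v} {p} (eqv l _ t) (r , e) =
        let R , f = absorbʳ {x = v ++ r} sat e (cover-++ {o = 0} {u = v}
                      (cover-trans (enr-cover (sub⇒⊇ᴬ t)) (cover-factor [] r ≋-refl))
                      (cover-in u [] (cong (u ++_) (sym (++-identityʳ r))) (≋-sym (≋-s l))))
                      (≋-trans (≋-reflexive (length-++ v)) (≋-trans (≋-+ (≋-sym (≋-s l)) (≋-refl {length r}))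
                         (≋-trans (≋-reflexive (sym (length-++ u))) (fixʳ-length e))))
        in r ++ R , ~-trans (~-reflexive (cong (p ++_) (sym (++-assoc v r R)))) f
      stabˡ : ∀ {u v q} → Eqv (suc k) (suc n) d u v → StabL q u → StabL q v
      stabˡ {u} {v} {q} (eqv l _ t) (r , e) =
        let e₁ = ~-trans (~-reflexive (++-assoc r u q)) e
            len = ≋-trans (≋-reflexive (sym (length-++ r))) (fixˡ-length e₁)
            R , f = absorbˡ {x = r ++ v} sat e₁ (cover-++ {o = 0} {u = r}
                      (cover-factor [] u ≋-refl)
                      (cover-≋ {o₂ = length r} {o₂′ = 0} ≋-refl ≋-refl
                        (cover-trans {o′ = length r} (λ {_} → shift (enr-cover (sub⇒⊇ᴬ t)))
                           (cover-in r [] (cong (r ++_) (sym (++-identityʳ u))) ≋-refl))))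
                      (≋-trans (≋-reflexive (length-++ r)) (≋-trans (≋-+ (≋-refl {length r}) (≋-sym (≋-s l))) len))
        in R ++ r , ~-trans (~-reflexive (lemma R r v q)) f
        where
        lemma : (a b c d : Word m) → (a ++ b) ++ c ++ d ≡ a ++ (b ++ c) ++ d
        lemma a b c d = solve (++-monoid (Fin m))
        shift : ∀ {o x y} → Cover s 0 x 0 y → Cover s o x o y
        shift {o} c {t} p = let t′ , q , e = c p in t′ , q , ≋-+ (≋-refl {o}) e
      mid : ∀ p q → StabR p u → StabL q u → p ++ u ++ q ~ p ++ v ++ q
      mid p q (r , e) (r′ , e′) = go (0 <? length u)
        where
        cov : Cover s 0 v 0 u
        cov = enr-cover (sub⇒⊇ᴬ (Eqv.from E))
        e″ : (r′ ++ u) ++ q ~ q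
        e″ = ~-trans (~-reflexive (++-assoc r′ u q)) e′
        looped : ∀ g g′ → length ((u ++ r) ++ g) ≋ s [ d ] → p ++ ((u ++ r) ++ g) ~ p →
                 length (g′ ++ r′ ++ u) ≋ s [ d ] → (g′ ++ r′ ++ u) ++ q ~ q → p ++ u ++ q ~ p ++ v ++ q
        -- Powers of the two loops are inserted around `u`; there `u` can be exchanged for `v`, as
        -- the level is higher by one, and the powers are removed again.
        looped g g′ l f l′ f′ = ~-trans (~-sym (insert (fill n) f f′ u)) (~-trans (~-++ˡ p (~-++ʳ q btw)) (insert (fill n) f f′ v))
          where
          btw = between {k = suc k} {n} {(u ++ r) ++ g} {g′ ++ r′ ++ u} {u} {v} sat l l′
            (cover-in [] (r ++ g) (++-assoc u r g) ≋-refl) (cover-last g′ r′ u l′)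
            (sub⇒⊇ᴬ (Eqv.from E)) (eqv (Eqv.lengths E) (sim-n (Eqv.to E)) (sim-n (Eqv.from E)))
        go : Dec (0 < length u) → p ++ u ++ q ~ p ++ v ++ q
        go (no u≯0)  = ~-++ˡ p (~-++ʳ q (~-reflexive (trans (length-[] u u≯0) (sym (cover-[] cov u≯0)))))
        go (yes u>0) = let g , l , f = loopʳ {p} {u ++ r} (>0-++ˡ u r u>0) e
                           g′ , l′ , f′ = loopˡ {q} {r′ ++ u} (>0-++ʳ r′ u u>0) e″
                       in looped g g′ l f l′ f′

    -- At level 1 the factors need only have congruent lengths: `w` disappears in a loop at `p`, and
    -- `w′` in a loop at `q`.
    segment₁ : ∀ {n} → (∀ u v → Eqv 1 n d u v → u ~ v) → ∀ {p q w w′} →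
               StabR p w → StabL q w′ → length w ≋ length w′ [ s ] → p ++ w ++ q ~ p ++ w′ ++ q
    segment₁ {n} sat {p} {q} {w} {w′} (r , e) (r′ , e′) len = go (0 <? length w) (0 <? length w′)
      where
      F = fill n
      e″ : (r′ ++ w′) ++ q ~ q
      e″ = ~-trans (~-reflexive (++-assoc r′ w′ q)) e′
      right : w′ ≡ [] → ∀ g → length ((w ++ r) ++ g) ≋ s [ d ] → p ++ ((w ++ r) ++ g) ~ p → p ++ w ~ p
      right w′≡[] g l f =
        let h = (w ++ r) ++ g ; R = rep F (period h) ; pR = period-fixʳ {p} {h} F f
            j , x = splitʳ sat {h} {w} l (cover-in [] (r ++ g) (++-assoc w r g) ≋-refl)
                      (≋-trans len (≋-reflexive (cong length w′≡[])))
        in ~-trans (~-++ʳ w (~-sym pR)) (~-trans (~-reflexive (++-assoc p R w))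
             (~-trans (~-++ˡ p x) (~-trans (~-reflexive (sym (++-assoc p R (rep j h))))
               (~-trans (~-++ʳ (rep j h) pR) (rep-fixʳ j f)))))
      left : w ≡ [] → ∀ g → length (g ++ r′ ++ w′) ≋ s [ d ] → (g ++ r′ ++ w′) ++ q ~ q → w′ ++ q ~ q
      left w≡[] g l f =
        let h = g ++ r′ ++ w′ ; R = rep F (period h) ; pR = period-fixˡ {q} {h} F f
            j , x = splitˡ sat {h} {w′} l (cover-last g r′ w′ l)
                      (≋-trans (≋-sym len) (≋-reflexive (cong length w≡[])))
        in ~-trans (~-++ˡ w′ (~-sym pR)) (~-trans (~-reflexive (sym (++-assoc w′ R q)))
             (~-trans (~-++ʳ q x) (~-trans (~-reflexive (++-assoc (rep j h) R q))
               (~-trans (~-++ˡ (rep j h) pR) (rep-fixˡ j f)))))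
      both : ∀ g g′ → length ((w ++ r) ++ g) ≋ s [ d ] → p ++ ((w ++ r) ++ g) ~ p →
             length (g′ ++ r′ ++ w′) ≋ s [ d ] → (g′ ++ r′ ++ w′) ++ q ~ q → p ++ w ++ q ~ p ++ w′ ++ q
      both g g′ l f l′ f′ =
        let h = (w ++ r) ++ g
            j , x = split₁ sat {h} {g′ ++ r′ ++ w′} {w} {w′} l l′
                      (cover-in [] (r ++ g) (++-assoc w r g) ≋-refl) (cover-last g′ r′ w′ l′) len
        in ~-trans (~-sym (insert F f f′ w)) (~-trans (~-++ˡ p (~-++ʳ q x))
             (~-trans (insert F f f′ (rep j h ++ w′))
               (~-trans (~-reflexive (cong (p ++_) (++-assoc (rep j h) w′ q)))
                 (~-trans (~-reflexive (sym (++-assoc p (rep j h) (w′ ++ q)))) (~-++ʳ (w′ ++ q) (rep-fixʳ j f))))))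
      go : Dec (0 < length w) → Dec (0 < length w′) → p ++ w ++ q ~ p ++ w′ ++ q
      go (no ¬w) (no ¬w′) = ~-++ˡ p (~-++ʳ q (~-reflexive (trans (length-[] w ¬w) (sym (length-[] w′ ¬w′)))))
      go (yes w>0) (no ¬w′) =
        let g , l , f = loopʳ {p} {w ++ r} (>0-++ˡ w r w>0) e in
        ~-trans (~-reflexive (sym (++-assoc p w q)))
          (~-trans (~-++ʳ q (right (length-[] w′ ¬w′) g l f))
                   (~-++ˡ p (~-reflexive (cong (_++ q) (sym (length-[] w′ ¬w′))))))
      go (no ¬w) (yes w′>0) =
        let g , l , f = loopˡ {q} {r′ ++ w′} (>0-++ʳ r′ w′ w′>0) e″ in
        ~-++ˡ p (~-trans (~-reflexive (cong (_++ q) (length-[] w ¬w))) (~-sym (left (length-[] w ¬w) g l f)))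
      go (yes w>0) (yes w′>0) =
        let g , l , f = loopʳ {p} {w ++ r} (>0-++ˡ w r w>0) e
            g′ , l′ , f′ = loopˡ {q} {r′ ++ w′} (>0-++ʳ r′ w′ w′>0) e″
        in both g g′ l f l′ f′

-- Boundaries recognised by the game

-- Apart from the ends of the word, a left boundary stands just behind its letter and a right
-- boundary at its letter. The two components keep the play strictly beyond that letter, or beyond
-- it or on it.
LHalf RHalf : ∀ {B : Set} → ℕ → List B → ℕ → List B → ℕ → Set
LHalf n U x V x′ = ∀ {r r′ b} → At U r b → Sim 1 n U r V r′ →
                   (x ≤ r → x′ ≤ r′) × (x ≤ suc r → x′ ≤ suc r′)
RHalf n U y V y′ = ∀ {r r′ b} → At U r b → Sim 1 n U r V r′ →
                   (r < y → r′ < y′) × (r ≤ y → r′ ≤ y′)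

-- Boundaries fixed by a leftmost (rightmost) occurrence of a letter after
-- (before) such a boundary: one block of n rounds confines the play of
-- Duplicator to the same side of the boundary.
LRigid RRigid : ∀ {B : Set} → ℕ → List B → ℕ → List B → ℕ → Set
LRigid n U x V x′ = LHalf n U x V x′ × LHalf n V x′ U x
RRigid n U y V y′ = RHalf n U y V y′ × RHalf n V y′ U y

lhalf-≤ : ∀ {B : Set} {n n′} {U V : List B} {x x′} → n ≤ n′ → LHalf n U x V x′ → LHalf n′ U x V x′
lhalf-≤ n≤ h p s = h p (sim-≤ n≤ s)

rhalf-≤ : ∀ {B : Set} {n n′} {U V : List B} {x x′} → n ≤ n′ → RHalf n U x V x′ → RHalf n′ U x V x′
rhalf-≤ n≤ h p s = h p (sim-≤ n≤ s)

lhalf-start : ∀ {B : Set} {U V : List B} → LHalf 0 U 0 V 0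
lhalf-start _ _ = (λ _ → z≤n) , (λ _ → z≤n)

rhalf-end : ∀ {B : Set} {U V : List B} → RHalf 0 U (length U) V (length V)
rhalf-end p s = let q = proj₁ (sim-col s) p in (λ _ → at-< q) , (λ _ → <⇒≤ (at-< q))

module _ {B : Set} {n : ℕ} {U V : List B} where

  -- If Duplicator were on the wrong side, Spoiler would play `X`: the answer has the same letter
  -- and lies behind `x′`, hence not before the first such position `X′`. This takes one more round.
  lhalf-step : ∀ {x x′ X X′ a} → LHalf n U x V x′ → x ≤ X → At U X a →
               (∀ {t} → x′ ≤ t → At V t a → X′ ≤ t) → LHalf (suc n) U (suc X) V (suc X′)
  lhalf-step {x} {x′} {X} {X′} {a} h x≤X pX least {r} {r′} p s = after , upto
    where
    after : X < r → X′ < r′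
    after X<r = let t , o , s₁ = forth s pX in
      ≤-<-trans (least (proj₁ (h pX s₁) x≤X) (proj₁ (sim-col s₁) pX)) (Ord.below o X<r)
    upto : suc X ≤ suc r → suc X′ ≤ suc r′
    upto (s≤s X≤r) with m≤n⇒m<n∨m≡n X≤r
    ... | inj₁ X<r  = m≤n⇒m≤1+n (after X<r)
    ... | inj₂ refl = s≤s (least (proj₁ (h p (sim-n s)) x≤X) (proj₁ (sim-col s) pX))

  rhalf-step : ∀ {y y′ Y Y′ a} → RHalf n U y V y′ → Y < y → At U Y a →
               (∀ {t} → t < y′ → At V t a → t ≤ Y′) → RHalf (suc n) U Y V Y′
  rhalf-step {y} {y′} {Y} {Y′} {a} h Y<y pY greatest {r} {r′} p s = before , upto
    where
    before : r < Y → r′ < Y′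
    before r<Y = let t , o , s₁ = forth s pY in
      <-≤-trans (Ord.above o r<Y) (greatest (proj₁ (h pY s₁) Y<y) (proj₁ (sim-col s₁) pY))
    upto : r ≤ Y → r′ ≤ Y′
    upto r≤Y with m≤n⇒m<n∨m≡n r≤Y
    ... | inj₁ r<Y  = <⇒≤ (before r<Y)
    ... | inj₂ refl = greatest (proj₁ (h p (sim-n s)) Y<y) (proj₁ (sim-col s) pY)

  -- Spoiler plays `X`, and the answer is confined by both boundaries: it is not before `X′` and not
  -- after `Y′`.
  cross-≤ : ∀ {X X′ Y Y′ a b} → Sub 1 (suc (suc n)) U V →
            LHalf (suc n) U (suc X) V (suc X′) → RHalf n U Y V Y′ → At U X a → At U Y b →
            X ≤ Y → X′ ≤ Y′
  cross-≤ s L R pX pY X≤Y =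
    let t , _ , s₁ = forth s pX in
    ≤-trans (s≤s⁻¹ (proj₂ (L pX s₁) ≤-refl)) (proj₂ (R pX (sim-n s₁)) X≤Y)

  cross-< : ∀ {X X′ Y Y′ a b} → Sub 1 (suc (suc n)) U V →
            LHalf (suc n) U (suc X) V (suc X′) → RHalf n U Y V Y′ → At U X a → At U Y b →
            X < Y → X′ < Y′
  cross-< s L R pX pY X<Y =
    let t , _ , s₁ = forth s pX
    in ≤-<-trans (s≤s⁻¹ (proj₂ (L pX s₁) ≤-refl)) (proj₁ (R pX (sim-n s₁)) X<Y)

least : ∀ {P : ℕ → Set} → (∀ i → Dec (P i)) → ∀ t → ∃[ i ] i ≤ t × P i →
        ∃[ X ] P X × (∀ {j} → P j → X ≤ j)
least P? zero    (.zero , z≤n , p) = zero , p , λ _ → z≤n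
least P? (suc t) (i , i≤ , p) with anyUpTo? P? (suc t)
... | yes (j , s≤s j≤t , q) = least P? t (j , j≤t , q)
... | no ¬q = i , p , λ {j} q → ≮⇒≥ (λ j<i → ¬q (j , ≤-trans j<i i≤ , q))

greatest : ∀ {P : ℕ → Set} → (∀ i → Dec (P i)) → ∀ y → ∃[ i ] i < y × P i →
           ∃[ Y ] Y < y × P Y × (∀ {j} → j < y → P j → j ≤ Y)
greatest P? (suc y) (i , s≤s i≤y , p) with P? y
... | yes q = y , ≤-refl , q , λ j<y _ → s≤s⁻¹ j<y
... | no ¬q with m≤n⇒m<n∨m≡n i≤y
...   | inj₂ refl = contradiction p ¬q
...   | inj₁ i<y  = let Y , Y<y , q , g = greatest P? y (i , i<y , p) in
  Y , m≤n⇒m≤1+n Y<y , q , λ { {j} j<1+y r → case m≤n⇒m<n∨m≡n (s≤s⁻¹ j<1+y) of λ where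
    (inj₁ j<y)  → g j<y r
    (inj₂ refl) → contradiction r ¬q }

At? : ∀ {B : Set} → (∀ b c → Dec (b ≡ c)) → ∀ (u : List B) i b → Dec (At u i b)
At? _≟ᴮ_ []      i       b = no λ ()
At? _≟ᴮ_ (c ∷ u) zero    b with c ≟ᴮ b
... | yes refl = yes first
... | no ¬p    = no λ { first → ¬p refl }
At? _≟ᴮ_ (c ∷ u) (suc i) b with At? _≟ᴮ_ u i b
... | yes p = yes (next p)
... | no ¬p = no λ { (next p) → ¬p p }

-- Level 2 is asked for because it contains level 1 games in both directions, and the two halves of
-- a rigid boundary use one each.
Bound : ∀ {B : Set} → ℕ → List B → ℕ → List B → ℕ → Set
Bound c U x V x′ = ∀ {i j b} → At U i b → Sim 2 c U i V j ⊎ Sim 2 c V j U i →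
                   (i < x → j < x′) × (j < x′ → i < x)

bound-flip : ∀ {B : Set} {c} {U V : List B} {x x′} → Bound c U x V x′ → Bound c V x′ U x
bound-flip bd p (inj₁ s) = let a , b = bd (proj₁ (sim-col s) p) (inj₂ s) in b , a
bound-flip bd p (inj₂ s) = let a , b = bd (proj₂ (sim-col s) p) (inj₁ s) in b , a

sim₁-both : ∀ {B : Set} {c} {U V : List B} {i j b} → At U i b → Sim 2 c U i V j ⊎ Sim 2 c V j U i →
            At V j b × Sim 1 c U i V j × Sim 1 c V j U i
sim₁-both p (inj₁ s) = proj₁ (sim-col s) p , sim-k s , sim-flip s
sim₁-both p (inj₂ s) = proj₂ (sim-col s) p , sim-flip s , sim-k s

lrigid⇒bound : ∀ {B : Set} {c} {U V : List B} {x x′} → LRigid c U x V x′ → Bound c U x V x′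
lrigid⇒bound (h , h′) p s = let q , s₁ , s₂ = sim₁-both p s in
  (λ i<x → ≰⇒> (λ x′≤j → <⇒≱ i<x (proj₁ (h′ q s₂) x′≤j))) ,
  (λ j<x′ → ≰⇒> (λ x≤i → <⇒≱ j<x′ (proj₁ (h p s₁) x≤i)))

lrigid⇒bound′ : ∀ {B : Set} {c} {U V : List B} {X X′} → LRigid c U (suc X) V (suc X′) → Bound c U X V X′
lrigid⇒bound′ (h , h′) p s = let q , s₁ , s₂ = sim₁-both p s in
  (λ i<X → ≰⇒> (λ X′≤j → <⇒≱ i<X (s≤s⁻¹ (proj₂ (h′ q s₂) (s≤s X′≤j))))) ,
  (λ j<X′ → ≰⇒> (λ X≤i → <⇒≱ j<X′ (s≤s⁻¹ (proj₂ (h p s₁) (s≤s X≤i)))))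

rrigid⇒bound : ∀ {B : Set} {c} {U V : List B} {y y′} → RRigid c U y V y′ → Bound c U y V y′
rrigid⇒bound (h , h′) p s = let q , s₁ , s₂ = sim₁-both p s in proj₁ (h p s₁) , proj₁ (h′ q s₂)

rrigid⇒bound′ : ∀ {B : Set} {c} {U V : List B} {y y′} → RRigid c U y V y′ → Bound c U (suc y) V (suc y′)
rrigid⇒bound′ (h , h′) p s = let q , s₁ , s₂ = sim₁-both p s in
  (λ i<y → s≤s (proj₂ (h p s₁) (s≤s⁻¹ i<y))) , (λ j<y → s≤s (proj₂ (h′ q s₂) (s≤s⁻¹ j<y)))

record Factors {B : Set} (c : ℕ) (U V w w′ : List B) : Set where
  constructor factors
  field
    {l r l′ r′} : List B
    U≡   : U ≡ l ++ w ++ r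
    V≡   : V ≡ l′ ++ w′ ++ r′
    lo   : Bound c U (length l) V (length l′)
    hi   : Bound c U (length l + length w) V (length l′ + length w′)

factors-flip : ∀ {B : Set} {c} {U V w w′ : List B} → Factors c U V w w′ → Factors c V U w′ w
factors-flip (factors {l} {r} {l′} {r′} e e′ lo hi) =
  factors {l = l′} {r′} {l} {r} e′ e (bound-flip lo) (bound-flip hi)

at-mid : ∀ {B : Set} (l : List B) {w r i b} → At w i b → At (l ++ w ++ r) (length l + i) b
at-mid l p = at-++ʳ l (at-++ˡ p)

at-mid⁻ : ∀ {B : Set} (l w : List B) {r i b} → i < length w → At (l ++ w ++ r) (length l + i) b → At w i b
at-mid⁻ l w i< p = at-++ˡ⁻ w i< (at-++ʳ⁻ l p)

sim-two : ∀ {B : Set} {c} k n {U V : List B} {i j} → Sim (suc (suc k)) (n + c) U i V j → Sim 2 c U i V j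
sim-two {c = c} zero    n s = sim-≤ (m≤n+m c n) s
sim-two (suc k) n s = sim-two k n (sim-k s)

-- One level of the game is enough to keep the play inside matching factors.
module _ {B : Set} {c : ℕ} where

  factor-reply : ∀ k n {U V w w′ : List B} (F : Factors c U V w w′) {I J i₁ b} →
    Sim (suc (suc k)) (suc n + c) U I V J → At w i₁ b →
    ∃[ j₁ ] Ord (length (Factors.l F) + i₁) I (length (Factors.l′ F) + j₁) J × At w′ j₁ b ×
            Sim (suc (suc k)) (n + c) U (length (Factors.l F) + i₁) V (length (Factors.l′ F) + j₁)
  factor-reply k n {w = w} {w′} F@(factors {l} {r} {l′} {r′} refl refl lo hi) {i₁ = i₁} {b} s p
    with forth s (at-mid l p)
  ... | j , o , s₁ = place (proj₁ (sim-col s₁) (at-mid l p)) refl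
    where
    -- The `c` rounds kept in reserve make this game long enough for both boundaries.
    two = sim-two k n s₁
    l′≤j : length l′ ≤ j
    l′≤j = ≮⇒≥ (λ j<l′ → m+n≮m (length l) _ (proj₂ (lo (at-mid l p) (inj₁ two)) j<l′))
    j<hi : j < length l′ + length w′
    j<hi = proj₁ (hi (at-mid l p) (inj₁ two)) (+-monoʳ-< (length l) (at-< p))
    place : ∀ {j′} → At (l′ ++ w′ ++ r′) j b → j ≡ j′ → _
    place q _ = j ∸ length l′ ,
      subst (λ t → Ord (length l + i₁) _ t _) (sym e) o ,
      at-mid⁻ l′ w′ (+-cancelˡ-< (length l′) _ _ (subst (_< length l′ + length w′) (sym e) j<hi))
                    (at-cast (sym e) refl q) ,
      subst (λ t → Sim _ _ _ _ _ t) (sym e) s₁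
      where
      e : length l′ + (j ∸ length l′) ≡ j
      e = m+[n∸m]≡n l′≤j

  factor-sim : ∀ k n {U V w w′ : List B} (F : Factors c U V w w′) {i j} → i < length w → j < length w′ →
               Sim (suc (suc k)) (n + c) U (length (Factors.l F) + i) V (length (Factors.l′ F) + j) →
               Sim (suc k) n w i w′ j
  factor-sim k n {w = w} {w′} F@(factors {l} {r} {l′} {r′} refl refl lo hi) {i} {j} i< j< s = go k n s
    where
    col : Col w i w′ j
    col = (λ p → at-mid⁻ l′ w′ j< (proj₁ (sim-col s) (at-mid l p))) ,
          (λ p → at-mid⁻ l w i< (proj₂ (sim-col s) (at-mid l′ p)))
    back : ∀ k n → Sim (suc (suc k)) (suc n + c) (l ++ w ++ r) (length l + i) (l′ ++ w′ ++ r′) (length l′ + j) →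
           Reply (Sim k n) k w′ j w i
    back zero    n s ()
    back (suc k) n s _ p =
      let i₁ , o , q , s₁ = factor-reply k n (factors-flip F) (sim-flip s) p in
      i₁ , ord-+⁻ (length l′) (length l) o , factor-sim k n (factors-flip F) (at-< p) (at-< q) s₁
    go : ∀ k n → Sim (suc (suc k)) (n + c) (l ++ w ++ r) (length l + i) (l′ ++ w′ ++ r′) (length l′ + j) →
         Sim (suc k) n w i w′ j
    go k zero    s = stop col
    go k (suc n) s = play col
      (λ _ p → let j₁ , o , q , s₁ = factor-reply k n F s p in
        j₁ , ord-+⁻ (length l) (length l′) o , factor-sim k n F (at-< p) (at-< q) s₁)
      (back k n s)

  factor-sub : ∀ k n {U V w w′ : List B} → Factors c U V w w′ → Sub (suc (suc k)) (n + c) U V → Sub (suc k) n w w′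
  factor-sub k zero    F s = stop col-end
  factor-sub k (suc n) {U} {V} {w} {w′} F s = play col-end
    (λ _ p → let j₁ , _ , q , s₁ = factor-reply k n F s p in
       j₁ , ord-end p q , factor-sim k n F (at-< p) (at-< q) s₁)
    (back k s)
    where
    back : ∀ k → Sub (suc (suc k)) (suc n + c) U V → Reply (Sim k n) k w′ (length w′) w (length w)
    back zero    s ()
    back (suc k) s _ p = let i₁ , _ , q , s₁ = factor-reply k n (factors-flip F) (sim-flip s) p in
      i₁ , ord-end p q , factor-sim k n (factors-flip F) (at-< p) (at-< q) s₁

-- Cutting two words at their drops

Letter : ℕ → Set
Letter m = Fin m × ℕ

_≟ˡ_ : ∀ {m} (b c : Letter m) → Dec (b ≡ c)
(a , r) ≟ˡ (b , t) with a FinP.≟ b | r ≟ t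
... | yes refl | yes refl = yes refl
... | no ¬p    | _        = no (¬p ∘ cong proj₁)
... | _        | no ¬p    = no (¬p ∘ cong proj₂)

count : ∀ {A : Set} {P : A → Set} → (∀ x → Dec (P x)) → List A → ℕ
count P? []       = 0
count P? (x ∷ xs) with P? x
... | yes _ = suc (count P? xs)
... | no _  = count P? xs

count-≤-length : ∀ {A : Set} {P : A → Set} (P? : ∀ x → Dec (P x)) xs → count P? xs ≤ length xs
count-≤-length P? []       = z≤n
count-≤-length P? (x ∷ xs) with P? x
... | yes _ = s≤s (count-≤-length P? xs)
... | no _  = m≤n⇒m≤1+n (count-≤-length P? xs)

count-mono : ∀ {A : Set} {P Q : A → Set} (P? : ∀ x → Dec (P x)) (Q? : ∀ x → Dec (Q x)) →
             (∀ x → Q x → P x) → ∀ xs → count Q? xs ≤ count P? xs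
count-mono P? Q? f []       = z≤n
count-mono P? Q? f (x ∷ xs) with P? x | Q? x
... | yes _ | yes _ = s≤s (count-mono P? Q? f xs)
... | yes _ | no _  = m≤n⇒m≤1+n (count-mono P? Q? f xs)
... | no ¬p | yes q = contradiction (f x q) ¬p
... | no _  | no _  = count-mono P? Q? f xs

count-< : ∀ {A : Set} {P Q : A → Set} (P? : ∀ x → Dec (P x)) (Q? : ∀ x → Dec (Q x)) →
          (∀ x → Q x → P x) → ∀ {xs} → Any (λ x → P x × ¬ Q x) xs → count Q? xs < count P? xs
count-< P? Q? f {x ∷ xs} (here (p , ¬q)) with P? x | Q? x
... | no ¬p | _     = contradiction p ¬p
... | yes _ | yes q = contradiction q ¬q
... | yes _ | no _  = s≤s (count-mono P? Q? f xs)
count-< P? Q? f {x ∷ xs} (there a) with P? x | Q? x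
... | yes _ | yes _ = s≤s (count-< P? Q? f a)
... | yes _ | no _  = m≤n⇒m≤1+n (count-< P? Q? f a)
... | no ¬p | yes q = contradiction (f x q) ¬p
... | no _  | no _  = count-< P? Q? f a

split-< : ∀ {A : Set} (x w : List A) {a b y s} → x ++ a ∷ y ≡ w ++ b ∷ s → length x < length w →
          ∃[ z ] w ≡ x ++ a ∷ z × y ≡ z ++ b ∷ s
split-< []      (_ ∷ w) refl _      = w , refl , refl
split-< (_ ∷ x) (_ ∷ w) e    (s≤s l) with ListP.∷-injective e
... | refl , e′ = let z , p , q = split-< x w e′ l in z , cong (_ ∷_) p , q

split-≡ : ∀ {A : Set} (x w : List A) {a b y s} → x ++ a ∷ y ≡ w ++ b ∷ s → length x ≡ length w →
          x ≡ w × a ≡ b × y ≡ s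
split-≡ []      []      refl _ = refl , refl , refl
split-≡ (_ ∷ x) (c ∷ w) e    l with ListP.∷-injective e
... | refl , e′ = let p , q , r = split-≡ x w e′ (suc-injective l) in cong (c ∷_) p , q , r

length-snoc : ∀ {A : Set} (u v : List A) (a : A) → length (u ++ v ++ a ∷ []) ≡ suc (length u + length v)
length-snoc u v a = trans (length-++ u) (trans (cong (length u +_) (trans (length-++ v) (+-comm (length v) 1)))
                      (+-suc (length u) (length v)))

snoc-++ : ∀ {m} (u v : Word m) a w → (u ++ v ++ a ∷ []) ++ w ≡ u ++ v ++ a ∷ w
snoc-++ u v a w = trans (++-assoc u (v ++ a ∷ []) w) (cong (u ++_) (++-assoc v (a ∷ []) w))

-- The word u is cut where its prefixes drop in the right Green order, v where
-- its suffixes drop in the left Green order, and each word is cut at the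
-- positions matching the cuts of the other. Going from right to left, the
-- factors of u between cuts are then replaced by those of v: the prefix of u
-- and the suffix of v around a factor are stable for it.
module Cuts {m s : ℕ} {{s≢0 : NonZero s}} (C : Congruence m s) where

  open Green C

  BelowR BelowL : Word m → Word m → Set
  BelowR p r = ∃[ t ] p ++ t ~ r
  BelowL q r = ∃[ t ] t ++ q ~ r

  BelowR? : ∀ p r → Dec (BelowR p r)
  BelowR? p r = ∃? (λ e f → ~-trans (~-++ˡ p (~-sym e)) f) (λ t → p ++ t ~? r)

  BelowL? : ∀ q r → Dec (BelowL q r)
  BelowL? q r = ∃? (λ e f → ~-trans (~-++ʳ q (~-sym e)) f) (λ t → t ++ q ~? r)

  -- The number of representatives in the right (left) ideal generated by the word. It decreases at
  -- each drop, so that there are at most `length reps` drops.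
  rankR rankL : Word m → ℕ
  rankR p = count (BelowR? p) reps
  rankL q = count (BelowL? q) reps

  rankR-drop : ∀ {p z} → ¬ StabR p z → rankR (p ++ z) < rankR p
  rankR-drop {p} {z} ¬st = count-< (BelowR? p) (BelowR? (p ++ z))
    (λ r (t , e) → z ++ t , ~-trans (~-reflexive (sym (++-assoc p z t))) e)
    (Any.map (λ e → ([] , ~-trans (~-reflexive (++-identityʳ p)) (~-sym e)) ,
                    (λ (t , f) → ¬st (t , ~-trans (~-reflexive (sym (++-assoc p z t))) (~-trans f e))))
             (reps-complete p))

  rankL-drop : ∀ {q z} → ¬ StabL q z → rankL (z ++ q) < rankL q
  rankL-drop {q} {z} ¬st = count-< (BelowL? q) (BelowL? (z ++ q))
    (λ r (t , e) → t ++ z , ~-trans (~-reflexive (++-assoc t z q)) e)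
    (Any.map (λ e → ([] , ~-sym e) , (λ (t , f) → ¬st (t , ~-trans f e))) (reps-complete q))

  firstDrop : ∀ p cur → StabR p cur ⊎
    ∃[ x ] ∃[ a ] ∃[ y ] cur ≡ x ++ a ∷ y × StabR p x × ¬ StabR p (x ++ a ∷ [])
  firstDrop p cur = go [] cur stabR-[]
    where
    go : ∀ x z → StabR p x → StabR p (x ++ z) ⊎
         ∃[ x′ ] ∃[ a ] ∃[ y ] x ++ z ≡ x′ ++ a ∷ y × StabR p x′ × ¬ StabR p (x′ ++ a ∷ [])
    go x []      st = inj₁ (subst (StabR p) (sym (++-identityʳ x)) st)
    go x (a ∷ z) st with StabR? p (x ++ a ∷ [])
    ... | no ¬st = inj₂ (x , a , z , refl , st , ¬st)
    ... | yes st′ = subst (λ t → StabR p t ⊎ ∃[ x′ ] ∃[ a ] ∃[ y ] t ≡ x′ ++ a ∷ y × StabR p x′ × ¬ StabR p (x′ ++ a ∷ []))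
                          (++-assoc x (a ∷ []) z) (go (x ++ a ∷ []) z st′)

  lastDrop : ∀ q p → StabL q p ⊎
    ∃[ y ] ∃[ b ] ∃[ x ] p ≡ y ++ b ∷ x × StabL q x × ¬ StabL q (b ∷ x)
  lastDrop q []      = inj₁ stabL-[]
  lastDrop q (a ∷ p) with lastDrop q p
  ... | inj₂ (y , b , x , e , st , ¬st) = inj₂ (a ∷ y , b , x , cong (a ∷_) e , st , ¬st)
  ... | inj₁ st with StabL? q (a ∷ p)
  ...   | yes st′ = inj₁ st′
  ...   | no ¬st  = inj₂ ([] , a , p , refl , st , ¬st)

  letter-at : ∀ (u x : Word m) {a y w} → u ≡ x ++ a ∷ y → length x ≡ w → At (enr s 0 u) w (a , w % s)
  letter-at u x refl refl = at-enr 0 (at-cast (+-identityʳ (length x)) refl (at-++ʳ x first))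

  letter-at⁻ : ∀ {u : Word m} {t a r} → At (enr s 0 u) t (a , r % s) → At u t a × t ≋ r [ s ]
  letter-at⁻ p with at-enr⁻ 0 p
  ... | b , q , e = at-cast refl (sym (cong proj₁ e)) q , ≋-sym (%⇒≋ (cong proj₂ e))

  -- The transfer properties and the exchange of a single factor are parameters, so that one merging
  -- of cuts serves both level 1 and the induction step.
  module Match
    (transferʳ : ∀ {p x y z} → StabR p (x ++ z) → StabR p y → length x ≋ length y [ s ] → StabR p (y ++ z))
    (transferˡ : ∀ {q x y z} → StabL q (z ++ x) → StabL q y → length x ≋ length y [ s ] → StabL q (z ++ y))
    (u v : Word m)
    (up : Sub 1 (suc (suc (length reps))) (enr s 0 u) (enr s 0 v))
    (down : Sub 1 (suc (suc (length reps))) (enr s 0 v) (enr s 0 u))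
    (u≋v : length u ≋ length v [ s ])
    (segment : ∀ pre w post pre′ w′ post′ → u ≡ pre ++ w ++ post → v ≡ pre′ ++ w′ ++ post′ →
       length pre ≋ length pre′ [ s ] → length w ≋ length w′ [ s ] →
       Bound (length reps) (enr s 0 u) (length pre) (enr s 0 v) (length pre′) →
       Bound (length reps) (enr s 0 u) (length pre + length w) (enr s 0 v) (length pre′ + length w′) →
       StabR pre w → StabL post′ w′ → pre ++ w ++ post′ ~ pre ++ w′ ++ post′)
    where

    U V : List (Fin m × ℕ)
    U = enr s 0 u
    V = enr s 0 v

    c : ℕ
    c = length reps

    -- The remaining cuts coming from v, x and x′ being the current positions.
    data RightCuts : ℕ → Word m → ℕ → Word m → Set where
      end : ∀ {x cur x′ cur′} → StabL [] cur′ → RightCuts x cur x′ cur′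
      cut : ∀ {x x′} w b y w′ y′ → StabL (b ∷ y′) w′ →
            RRigid c U (x + length w) V (x′ + length w′) →
            x + length w ≋ x′ + length w′ [ s ] →
            RightCuts (suc (x + length w)) y (suc (x′ + length w′)) y′ →
            RightCuts x (w ++ b ∷ y) x′ (w′ ++ b ∷ y′)

    -- A later occurrence of `b` at the same residue within `p` would lie inside the stable word
    -- `x`. By `transferˡ`, `b` could then also be read in front of the whole of `x` without leaving
    -- the left Green class, so there would be no drop.
    last-in-v : ∀ {p q y b x} → v ≡ p ++ q → p ≡ y ++ b ∷ x → StabL q x → ¬ StabL q (b ∷ x) →
                ∀ {t} → t < length p → At V t (b , length y % s) → t ≤ length y
    last-in-v {q = q} {y} {b} {x} refl refl st ¬st {t} t<p pt =
      ≮⇒≥ (λ y<t → bad (m≤n⇒∃[o]m+o≡n y<t))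
      where
      pt′ : At ((y ++ b ∷ x) ++ q) t b
      pt′ = proj₁ (letter-at⁻ {r = length y} pt)
      bad : ¬ (∃[ j ] suc (length y) + j ≡ t)
      bad (j , refl) = clash (at-split at-x)
        where
        at-x : At x j b
        at-x = at-++ʳ⁻ (b ∷ []) (at-++ʳ⁻ y (at-cast (sym (+-suc (length y) j)) refl
                 (at-++ˡ⁻ (y ++ b ∷ x) t<p pt′)))
        j+1≋0 : suc j ≋ 0 [ s ]
        j+1≋0 = ≋-cancelˡ (length y) (≋-trans (≋-reflexive (+-suc (length y) j))
          (≋-trans (proj₂ (letter-at⁻ {r = length y} pt)) (≋-reflexive (sym (+-identityʳ (length y))))))
        clash : ¬ (∃[ l ] ∃[ r ] x ≡ l ++ b ∷ r × length l ≡ j)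
        clash (l , r , e , lj) = ¬st (transferˡ {x = r} {x} {b ∷ []}
          (stabL-snd {u = l} (subst (StabL q) e st)) st
          (≋-sym (≋-trans (≋-reflexive (trans (cong length e) (trans (length-++ l) (+-suc (length l) (length r)))))
                          (≋-+ (≋-trans (≋-reflexive (cong suc lj)) j+1≋0) (≋-refl {length r})))))

    first-in-u : ∀ {p t x a y} → u ≡ (p ++ t) ++ x ++ a ∷ y → StabR p t → StabR (p ++ t) x →
                 ¬ StabR (p ++ t) (x ++ a ∷ []) →
                 ∀ {i} → length p ≤ i → At U i (a , (length (p ++ t) + length x) % s) →
                 length (p ++ t) + length x ≤ i
    first-in-u {p} {t} {x} {a} {y} refl st st′ ¬st {i} p≤i pi =
      ≮⇒≥ (λ i<X → bad i<X (m≤n⇒∃[o]m+o≡n p≤i))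
      where
      X = length (p ++ t) + length x
      X≡ : X ≡ length p + length (t ++ x)
      X≡ = trans (cong (_+ length x) (length-++ p))
                 (trans (+-assoc (length p) (length t) (length x)) (cong (length p +_) (sym (length-++ t))))
      pi′ = letter-at⁻ {r = X} pi
      whole : (p ++ t) ++ x ++ a ∷ y ≡ p ++ (t ++ x) ++ a ∷ y
      whole = trans (++-assoc p t _) (cong (p ++_) (sym (++-assoc t x _)))
      bad : i < X → ¬ (∃[ j ] length p + j ≡ i)
      bad i<X (j , refl) = clash (at-split at-tx)
        where
        at-tx : At (t ++ x) j a
        at-tx = at-mid⁻ p (t ++ x) (+-cancelˡ-< (length p) _ _ (subst (length p + j <_) X≡ i<X))
                  (subst (λ z → At z (length p + j) a) whole (proj₁ pi′))
        clash : ¬ (∃[ l ] ∃[ r ] t ++ x ≡ l ++ a ∷ r × length l ≡ j)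
        clash (l , r , e , lj) = ¬st (stabR-snd {p} {t} {x ++ a ∷ []}
          (subst (StabR p) (++-assoc t x (a ∷ []))
            (transferʳ {p} {l} {t ++ x} {a ∷ []}
              (stabR-fst {p} {l ++ a ∷ []} {r} (subst (StabR p) (trans e (sym (++-assoc l (a ∷ []) r))) tx))
              tx
              (≋-cancelˡ (length p) (≋-trans (≋-reflexive (cong (length p +_) lj)) (≋-trans (proj₂ pi′) (≋-reflexive X≡)))))))
          where
          tx : StabR p (t ++ x)
          tx = stabR-++ st st′

    positions : ∀ {i j a r r′} → At U i (a , r % s) → At V j (a , r′ % s) → r ≋ r′ [ s ] → i ≋ j [ s ]
    positions {r = r} {r′} p q e = ≋-trans (proj₂ (letter-at⁻ {r = r} p))
                                     (≋-trans e (≋-sym (proj₂ (letter-at⁻ {r = r′} q))))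

    rightCuts : RightCuts 0 u 0 v
    rightCuts = build (length v) u [] v [] 0 (sym (++-identityʳ u)) (sym (++-identityʳ v)) ≤-refl
      (count-≤-length (BelowL? []) reps)
      (subst₂ (λ x y → RRigid 0 U x V y) (length-enr 0 u) (length-enr 0 v) (rhalf-end , rhalf-end))
      (λ y y′ _ _ st → end (subst (StabL []) (sym (++-identityʳ y′)) st))
      where
      -- `f` is fuel and `n` the number of cuts made so far; the bound on `n + rankL q′` keeps the
      -- rounds that recognise them within `c`.
      build : ∀ f p q p′ q′ n → u ≡ p ++ q → v ≡ p′ ++ q′ → length p′ ≤ f → n + rankL q′ ≤ c →
              RRigid n U (length p) V (length p′) →
              (∀ {x x′} y y′ → x + length y ≡ length p → x′ + length y′ ≡ length p′ → StabL q′ y′ →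
                RightCuts x (y ++ q) x′ (y′ ++ q′)) →
              RightCuts 0 u 0 v
      build f p q p′ q′ n eu ev p′≤f n≤c rigid tail with lastDrop q′ p′
      ... | inj₁ st = subst₂ (λ a b → RightCuts 0 a 0 b) (sym eu) (sym ev) (tail p p′ refl refl st)
      ... | inj₂ (y , b , x , e , st , ¬st) = step f p′≤f
        where
        Y′ = length y
        β = b , Y′ % s
        ev′ : v ≡ y ++ b ∷ x ++ q′
        ev′ = trans ev (trans (cong (_++ q′) e) (++-assoc y (b ∷ x) q′))
        atY′ : At V Y′ β
        atY′ = letter-at v y ev′ refl
        Y′<p′ : Y′ < length p′
        Y′<p′ = subst (Y′ <_) (sym (trans (cong length e) (length-++ y))) (m<m+n Y′ z<s)
        n≤ : suc n ≤ c
        n≤ = ≤-trans (≤-reflexive (+-comm 1 n)) (≤-trans (+-monoʳ-≤ n (≤-trans (s≤s z≤n) (rankL-drop ¬st))) n≤c)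
        n≤′ : suc n + rankL (b ∷ x ++ q′) ≤ c
        n≤′ = ≤-trans (≤-reflexive (sym (+-suc n _))) (≤-trans (+-monoʳ-≤ n (rankL-drop ¬st)) n≤c)
        -- Duplicator's answer to the drop proves that `u` has this labelled letter before the end
        -- of `p`; the cut is placed at its last occurrence there.
        guess = forth down atY′
        guess-< : proj₁ guess < length p
        guess-< = proj₁ (proj₂ rigid atY′ (sim-≤ (m≤n⇒m≤1+n (≤-trans (n≤1+n n) n≤)) (proj₂ (proj₂ guess)))) Y′<p′
        found = greatest (λ i → At? _≟ˡ_ U i β) (length p)
                  (proj₁ guess , guess-< , proj₁ (sim-col (proj₂ (proj₂ guess))) atY′)
        Y = proj₁ found
        Y<p = proj₁ (proj₂ found)
        atY = proj₁ (proj₂ (proj₂ found))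
        rigid′ : RRigid (suc n) U Y V Y′
        rigid′ = rhalf-step (proj₁ rigid) Y<p atY (last-in-v ev e st ¬st) ,
                 rhalf-step (proj₂ rigid) Y′<p′ atY′ (proj₂ (proj₂ (proj₂ found)))
        step : ∀ f → length p′ ≤ f → RightCuts 0 u 0 v
        step zero    p′≤0 = contradiction (≤-trans Y′<p′ p′≤0) λ ()
        step (suc f) p′≤f =
          decompose (at-split (at-++ˡ⁻ p Y<p (subst (λ z → At z Y b) eu (proj₁ (letter-at⁻ {r = Y′} atY)))))
          where
          decompose : ∃[ z ] ∃[ z′ ] p ≡ z ++ b ∷ z′ × length z ≡ Y → RightCuts 0 u 0 v
          decompose (z , z′ , ep , lz) = build f z (b ∷ z′ ++ q) y (b ∷ x ++ q′) (suc n)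
            (trans eu (trans (cong (_++ q) ep) (++-assoc z (b ∷ z′) q))) ev′
            (s≤s⁻¹ (≤-trans Y′<p′ p′≤f)) n≤′
            (subst (λ t → RRigid (suc n) U t V Y′) (sym lz) rigid′)
            (λ {x₀} {x₀′} w w′ ew ew′ st′ → cut w b (z′ ++ q) w′ (x ++ q′) st′
              (subst₂ (λ i j → RRigid c U i V j) (sym (trans ew lz)) (sym ew′)
                (rhalf-≤ n≤ (proj₁ rigid′) , rhalf-≤ n≤ (proj₂ rigid′)))
              (≋-trans (≋-reflexive (trans ew lz)) (≋-trans (positions {r = Y′} atY atY′ ≋-refl) (≋-reflexive (sym ew′))))
              (tail z′ x
                (trans (cong (λ t → suc t + length z′) (trans ew lz))
                  (trans (sym (+-suc Y (length z′)))
                    (trans (cong (_+ suc (length z′)) (sym lz)) (trans (sym (length-++ z)) (cong length (sym ep))))))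
                (trans (cong (λ t → suc t + length x) ew′)
                  (trans (sym (+-suc Y′ (length x))) (trans (sym (length-++ y)) (cong length (sym e)))))
                st))

    -- The last cut coming from u. The field after says that the next one stays
    -- behind the current position in v, too.
    record LeftCut (pre pre′ : Word m) : Set where
      constructor leftCut
      field
        p t    : Word m
        x′ n   : ℕ
        pre≡   : pre ≡ p ++ t
        stable : StabR p t
        rigid  : LRigid n U (length p) V x′
        rank   : n + rankR p ≤ c
        after  : ∀ {X X′ b} → length pre ≤ X → At U X b → At V X′ b → LRigid c U (suc X) V (suc X′) →
                 x′ ≤ X′ → length pre′ ≤ X′

    lrigid-c : ∀ {n x x′} → n ≤ c → LRigid n U x V x′ → LRigid c U x V x′
    lrigid-c n≤ (h , h′) = lhalf-≤ n≤ h , lhalf-≤ n≤ h′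

    -- The crossing lemmas are applied from `u` to `v` and back. Thus a cut coming from `u` and one
    -- coming from `v` have the same order in both words, and the two sequences of cuts can be
    -- merged.
    cross : ∀ {X X′ Y Y′ a b} → LRigid c U (suc X) V (suc X′) → RRigid c U Y V Y′ →
            At U X a → At V X′ a → At U Y b → At V Y′ b → Ord X Y X′ Y′
    cross L R pX pX′ pY pY′ = ord
      (cross-< up (lhalf-≤ (n≤1+n c) (proj₁ L)) (proj₁ R) pX pY)
      (λ { refl → ≤-antisym
             (cross-≤ up (lhalf-≤ (n≤1+n c) (proj₁ L)) (proj₁ R) pX pY ≤-refl)
             (≮⇒≥ (λ X′<Y′ → <-irrefl refl (cross-< down (lhalf-≤ (n≤1+n c) (proj₂ L)) (proj₂ R) pX′ pY′ X′<Y′))) })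
      (λ Y<X → ≰⇒> (λ X′≤Y′ → <⇒≱ Y<X (cross-≤ down (lhalf-≤ (n≤1+n c) (proj₂ L)) (proj₂ R) pX′ pY′ X′≤Y′)))

    record NextLeft (pre pre′ x : Word m) (a : Fin m) : Set where
      field
        X′    : ℕ
        n     : ℕ
        rigid : LRigid (suc n) U (suc (length pre + length x)) V (suc X′)
        rank  : suc n + rankR (pre ++ x ++ a ∷ []) ≤ c
        at-U  : At U (length pre + length x) (a , (length pre + length x) % s)
        at-V  : At V X′ (a , (length pre + length x) % s)
        late  : length pre′ ≤ X′

      rigid-c : LRigid c U (suc (length pre + length x)) V (suc X′)
      rigid-c = lrigid-c (≤-trans (m≤m+n (suc n) _) rank) rigid

    -- Again an answer of Duplicator provides a candidate, and the first one from `x′` on is taken.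
    -- The field `after` puts it behind those cuts from `v` that were passed in the meantime.
    nextLeft : ∀ {pre pre′ x a y} → LeftCut pre pre′ → u ≡ pre ++ x ++ a ∷ y → StabR pre x →
               ¬ StabR pre (x ++ a ∷ []) → NextLeft pre pre′ x a
    nextLeft {pre} {pre′} {x} {a} {y} (leftCut p t x′ n refl st rigid rank after) eu stx ¬st = record
      { X′ = X′ ; n = n ; rigid = rigid′ ; rank = rank′ ; at-U = atX ; at-V = atX′
      ; late = after (m≤m+n (length (p ++ t)) (length x)) atX atX′ (lrigid-c (≤-trans (m≤m+n (suc n) _) rank′) rigid′) x′≤X′ }
      where
      X = length (p ++ t) + length x
      α = a , X % s
      atX : At U X α
      atX = letter-at u ((p ++ t) ++ x) (trans eu (sym (++-assoc (p ++ t) x (a ∷ y)))) (length-++ (p ++ t))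
      p≤X : length p ≤ X
      p≤X = ≤-trans (≤-trans (m≤m+n (length p) (length t)) (≤-reflexive (sym (length-++ p)))) (m≤m+n _ (length x))
      n≤c : n ≤ c
      n≤c = ≤-trans (m≤m+n n _) rank
      guess = forth up atX
      found = least (λ i → (x′ ≤? i) ×-dec At? _≟ˡ_ V i α) (proj₁ guess)
        (proj₁ guess , ≤-refl ,
         proj₁ (proj₁ rigid atX (sim-≤ (m≤n⇒m≤1+n n≤c) (proj₂ (proj₂ guess)))) p≤X ,
         proj₁ (sim-col (proj₂ (proj₂ guess))) atX)
      X′ = proj₁ found
      x′≤X′ = proj₁ (proj₁ (proj₂ found))
      atX′ = proj₂ (proj₁ (proj₂ found))
      rigid′ : LRigid (suc n) U (suc X) V (suc X′)
      rigid′ = lhalf-step (proj₁ rigid) p≤X atX (λ l q → proj₂ (proj₂ found) (l , q)) ,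
               lhalf-step (proj₂ rigid) x′≤X′ atX′ (first-in-u eu st stx ¬st)
      drop : rankR ((p ++ t) ++ x ++ a ∷ []) < rankR p
      drop = subst (λ z → rankR z < rankR p) (sym (++-assoc p t (x ++ a ∷ [])))
               (rankR-drop (λ st′ → ¬st (stabR-snd {p} {t} {x ++ a ∷ []} st′)))
      rank′ : suc n + rankR ((p ++ t) ++ x ++ a ∷ []) ≤ c
      rank′ = ≤-trans (≤-reflexive (sym (+-suc n _))) (≤-trans (+-monoʳ-≤ n drop) rank)

    split-v : ∀ {pre pre′ x a cur′} (N : NextLeft pre pre′ x a) → v ≡ pre′ ++ cur′ →
              ∃[ x′ ] ∃[ y′ ] cur′ ≡ x′ ++ a ∷ y′ × length pre′ + length x′ ≡ NextLeft.X′ N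
    split-v {pre} {pre′} {x} {a} {cur′} N ev = decompose (at-split at-cur)
      where
      open NextLeft N
      X′≡ : length pre′ + (X′ ∸ length pre′) ≡ X′
      X′≡ = m+[n∸m]≡n late
      at-cur : At cur′ (X′ ∸ length pre′) a
      at-cur = at-++ʳ⁻ pre′ (at-cast (sym X′≡) refl
        (subst (λ z → At z X′ a) ev (proj₁ (letter-at⁻ {r = length pre + length x} at-V))))
      decompose : ∃[ l ] ∃[ r ] cur′ ≡ l ++ a ∷ r × length l ≡ X′ ∸ length pre′ → _
      decompose (l , r , e , f) = l , r , e , trans (cong (length pre′ +_) f) X′≡

    advance : ∀ pre w a y pre′ w′ y′ → u ≡ pre ++ w ++ a ∷ y → v ≡ pre′ ++ w′ ++ a ∷ y′ →
              StabR pre w → StabL (a ∷ y′) w′ → Bound c U (length pre) V (length pre′) →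
              Bound c U (length pre + length w) V (length pre′ + length w′) →
              length pre ≋ length pre′ [ s ] →
              length pre + length w ≋ length pre′ + length w′ [ s ] →
              (pre ++ w ++ a ∷ []) ++ y ~ (pre ++ w ++ a ∷ []) ++ y′ →
              pre ++ w ++ a ∷ y ~ pre ++ w′ ++ a ∷ y′
    advance pre w a y pre′ w′ y′ eu ev st st′ bd bd′ e e′ rec =
      ~-trans (~-cast (snoc-++ pre w a y) (snoc-++ pre w a y′) rec)
        (segment pre w (a ∷ y) pre′ w′ (a ∷ y′) eu ev e
          (≋-cancelˡ (length pre) (≋-trans e′ (≋-+ (≋-sym e) (≋-refl {length w′})))) bd bd′ st st′)

    leftCut-X : ∀ {pre x a pre′ x′} (N : NextLeft pre pre′ x a) →
                length pre′ + length x′ ≡ NextLeft.X′ N →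
                LeftCut (pre ++ x ++ a ∷ []) (pre′ ++ x′ ++ a ∷ [])
    leftCut-X {pre} {x} {a} {pre′} {x′} N e = leftCut (pre ++ x ++ a ∷ []) [] (suc (NextLeft.X′ N)) (suc (NextLeft.n N))
      (sym (++-identityʳ _)) stabR-[]
      (subst (λ z → LRigid (suc (NextLeft.n N)) U z V (suc (NextLeft.X′ N))) (sym (length-snoc pre x a)) (NextLeft.rigid N))
      (NextLeft.rank N)
      (λ _ _ _ _ l → ≤-trans (≤-reflexive (trans (length-snoc pre′ x′ a) (cong suc e))) l)

    -- At a cut coming from `v` the prefix `p` and its boundary stay in force and only `t` grows.
    -- That the next cut from `u` lies behind this one in `v`, too, is the preservation of order by
    -- `cross`.
    leftCut-Y : ∀ {pre pre′} w b w′ {β} → LeftCut pre pre′ → StabR pre (w ++ b ∷ []) →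
                RRigid c U (length pre + length w) V (length pre′ + length w′) →
                At U (length pre + length w) β → At V (length pre′ + length w′) β →
                LeftCut (pre ++ w ++ b ∷ []) (pre′ ++ w′ ++ b ∷ [])
    leftCut-Y {pre} {pre′} w b w′ (leftCut p t x′ n refl st rigid rank after) stw R atY atY′ =
      leftCut p (t ++ w ++ b ∷ []) x′ n (++-assoc p t _) (stabR-++ st stw) rigid rank
        (λ l atX atX′ L _ → ≤-trans (≤-reflexive (length-snoc pre′ w′ b))
           (Ord.above (cross L R atX atX′ atY atY′) (≤-trans (≤-reflexive (sym (length-snoc (p ++ t) w b))) l)))

    bound-cast : ∀ {x y x′ y′} → x ≡ y → x′ ≡ y′ → Bound c U x V x′ → Bound c U y V y′
    bound-cast refl refl b = b

    rightCuts-cast : ∀ {x y x′ y′ w w′} → x ≡ y → x′ ≡ y′ → RightCuts x w x′ w′ → RightCuts y w y′ w′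
    rightCuts-cast refl refl r = r

    snoc-≋ : ∀ pre w pre′ w′ (a : Fin m) → length pre + length w ≋ length pre′ + length w′ [ s ] →
             length (pre ++ w ++ a ∷ []) ≋ length (pre′ ++ w′ ++ a ∷ []) [ s ]
    snoc-≋ pre w pre′ w′ a e = ≋-trans (≋-reflexive (length-snoc pre w a))
      (≋-trans (≋-+ (≋-refl {1}) e) (≋-reflexive (sym (length-snoc pre′ w′ a))))

    bound-end : Bound c U (length u) V (length v)
    bound-end p s = let q , _ = sim₁-both p s in
      (λ _ → subst (_ <_) (length-enr 0 v) (at-< q)) , (λ _ → subst (_ <_) (length-enr 0 u) (at-< p))

    shorter : ∀ {f} (w : Word m) {a y} → length (w ++ a ∷ y) ≤ suc f → length y ≤ f
    shorter w {a} {y} l = s≤s⁻¹ (≤-trans (m≤n+m (suc (length y)) (length w))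
                                         (≤-trans (≤-reflexive (sym (length-++ w))) l))

    Drop : Word m → Word m → Set
    Drop p cur = StabR p cur ⊎
      ∃[ x ] ∃[ a ] ∃[ y ] cur ≡ x ++ a ∷ y × StabR p x × ¬ StabR p (x ++ a ∷ [])

    at-Y : ∀ pre w {b y pre′ w′ y′} → u ≡ pre ++ w ++ b ∷ y → v ≡ pre′ ++ w′ ++ b ∷ y′ →
           length pre + length w ≋ length pre′ + length w′ [ s ] →
           At U (length pre + length w) (b , (length pre + length w) % s) ×
           At V (length pre′ + length w′) (b , (length pre + length w) % s)
    at-Y pre w {b} {y} {pre′} {w′} {y′} eu ev e =
      letter-at u (pre ++ w) (trans eu (sym (++-assoc pre w (b ∷ y)))) (length-++ pre) ,
      at-cast refl (cong (b ,_) (sym (≋⇒% e)))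
        (letter-at v (pre′ ++ w′) (trans ev (sym (++-assoc pre′ w′ (b ∷ y′)))) (length-++ pre′))

    mutual
      -- The drops of `u` are found on the way from left to right, whereas the cuts from `v` arise
      -- from right to left and so have been listed beforehand.
      replace : ∀ f pre cur pre′ cur′ → u ≡ pre ++ cur → v ≡ pre′ ++ cur′ → length cur ≤ f →
                LeftCut pre pre′ → Bound c U (length pre) V (length pre′) → length pre ≋ length pre′ [ s ] →
                RightCuts (length pre) cur (length pre′) cur′ → pre ++ cur ~ pre ++ cur′
      replace f pre cur pre′ cur′ eu ev l L bd e R = dispatch f pre cur pre′ cur′ eu ev l L bd e (firstDrop pre cur) R

      dispatch : ∀ f pre cur pre′ cur′ → u ≡ pre ++ cur → v ≡ pre′ ++ cur′ → length cur ≤ f →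
                 LeftCut pre pre′ → Bound c U (length pre) V (length pre′) → length pre ≋ length pre′ [ s ] →
                 Drop pre cur → RightCuts (length pre) cur (length pre′) cur′ → pre ++ cur ~ pre ++ cur′
      dispatch f pre cur pre′ cur′ eu ev l L bd e (inj₁ st) (end st′) =
        ~-cast (cong (pre ++_) (++-identityʳ cur)) (cong (pre ++_) (++-identityʳ cur′))
          (segment pre cur [] pre′ cur′ []
            (trans eu (cong (pre ++_) (sym (++-identityʳ cur)))) (trans ev (cong (pre′ ++_) (sym (++-identityʳ cur′))))
            e (≋-cancelˡ (length pre) (≋-trans (≋-reflexive lu) (≋-trans u≋v (≋-trans (≋-reflexive (sym lv))
                 (≋-+ (≋-sym e) (≋-refl {length cur′}))))))
            bd (bound-cast (sym lu) (sym lv) bound-end) st st′)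
        where
        lu : length pre + length cur ≡ length u
        lu = trans (sym (length-++ pre)) (cong length (sym eu))
        lv : length pre′ + length cur′ ≡ length v
        lv = trans (sym (length-++ pre′)) (cong length (sym ev))
      dispatch f pre _ pre′ _ eu ev l L bd e (inj₁ st) (cut w b y w′ y′ st′ R e′ rest) =
        at-right f pre w b y pre′ w′ y′ eu ev l L bd e
          (stabR-fst {pre} {w ++ b ∷ []} {y} (subst (StabR pre) (sym (++-assoc w (b ∷ []) y)) st)) st′ R e′ rest
      dispatch f pre cur pre′ cur′ eu ev l L bd e (inj₂ (x , a , y , ec₀ , st , ¬st)) (end st′) =
        onward (split-v N ev)
        where
        eu′ : u ≡ pre ++ x ++ a ∷ y
        eu′ = trans eu (cong (pre ++_) ec₀)
        N : NextLeft pre pre′ x a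
        N = nextLeft L eu′ st ¬st
        onward : ∃[ x′ ] ∃[ y′ ] cur′ ≡ x′ ++ a ∷ y′ × length pre′ + length x′ ≡ NextLeft.X′ N →
                 pre ++ cur ~ pre ++ cur′
        onward (x′ , y′ , ec , ex) = ~-cast (cong (pre ++_) (sym ec₀)) (cong (pre ++_) (sym ec))
          (at-left f pre x a y pre′ x′ y′ eu′ (trans ev (cong (pre′ ++_) ec))
            (≤-trans (≤-reflexive (cong length (sym ec₀))) l) N ex bd e st
            (subst (λ z → StabL z x′) (++-identityʳ (a ∷ y′)) (stabL-fst {[]} {x′} {a ∷ y′} st″))
            (end (stabL-snd {[]} {x′ ++ a ∷ []} (subst (StabL []) (sym (++-assoc x′ (a ∷ []) y′)) st″))))
          where
          st″ : StabL [] (x′ ++ a ∷ y′)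
          st″ = subst (StabL []) ec st′
      dispatch f pre _ pre′ _ eu ev l L bd e (inj₂ (x , a , z , ec , st , ¬st)) (cut w b y w′ y′ st′ R e′ rest) =
        onward (split-v N ev)
        where
        eu′ : u ≡ pre ++ x ++ a ∷ z
        eu′ = trans eu (cong (pre ++_) ec)
        N : NextLeft pre pre′ x a
        N = nextLeft L eu′ st ¬st
        Y = at-Y pre w {b} {y} {pre′} {w′} {y′} eu ev e′
        order : Ord (length pre + length x) (length pre + length w) (NextLeft.X′ N) (length pre′ + length w′)
        order = cross (NextLeft.rigid-c N) R (NextLeft.at-U N) (NextLeft.at-V N) (proj₁ Y) (proj₂ Y)
        onward : ∃[ x′ ] ∃[ z′ ] w′ ++ b ∷ y′ ≡ x′ ++ a ∷ z′ × length pre′ + length x′ ≡ NextLeft.X′ N →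
                 pre ++ w ++ b ∷ y ~ pre ++ w′ ++ b ∷ y′
        onward (x′ , z′ , ec′ , ex) with <-cmp (length x) (length w)
        ... | tri< x<w _ _ = left-first f pre x a w b y z pre′ x′ w′ y′ z′
                (split-< x w (sym ec) x<w)
                (split-< x′ w′ (sym ec′) (+-cancelˡ-< (length pre′) _ _
                  (subst (_< length pre′ + length w′) (sym ex) (Ord.below order (+-monoʳ-< (length pre) x<w)))))
                eu ev l N ex bd e st st′ R e′ rest
        ... | tri≈ _ x≡w _ = same-cut f pre x a w b y z pre′ x′ w′ y′ z′
                (split-≡ x w (sym ec) x≡w)
                (split-≡ x′ w′ (sym ec′) (+-cancelˡ-≡ (length pre′) _ _
                  (trans ex (Ord.same order (cong (length pre +_) x≡w)))))
                eu ev l N ex bd e st st′ rest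
        ... | tri> _ _ w<x = right-first (split-< w x ec w<x)
          where
          right-first : ∃[ t ] x ≡ w ++ b ∷ t × y ≡ t ++ a ∷ z → pre ++ w ++ b ∷ y ~ pre ++ w′ ++ b ∷ y′
          right-first (t , ext , _) = at-right f pre w b y pre′ w′ y′ eu ev l L bd e
            (stabR-fst {pre} {w ++ b ∷ []} {t} (subst (StabR pre) (trans ext (sym (++-assoc w (b ∷ []) t))) st)) st′ R e′ rest

      at-right : ∀ f pre w b y pre′ w′ y′ → u ≡ pre ++ w ++ b ∷ y → v ≡ pre′ ++ w′ ++ b ∷ y′ →
                 length (w ++ b ∷ y) ≤ f → LeftCut pre pre′ → Bound c U (length pre) V (length pre′) →
                 length pre ≋ length pre′ [ s ] → StabR pre (w ++ b ∷ []) → StabL (b ∷ y′) w′ →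
                 RRigid c U (length pre + length w) V (length pre′ + length w′) →
                 length pre + length w ≋ length pre′ + length w′ [ s ] →
                 RightCuts (suc (length pre + length w)) y (suc (length pre′ + length w′)) y′ →
                 pre ++ w ++ b ∷ y ~ pre ++ w′ ++ b ∷ y′
      at-right zero pre w b y pre′ w′ y′ eu ev l =
        contradiction (≤-trans (≤-reflexive (sym (trans (length-++ w) (+-suc (length w) (length y))))) l) λ ()
      at-right (suc f) pre w b y pre′ w′ y′ eu ev l L bd e st st′ R e′ rest =
        advance pre w b y pre′ w′ y′ eu ev (stabR-fst {pre} {w} {b ∷ []} st) st′ bd (rrigid⇒bound R) e e′
          (replace f (pre ++ w ++ b ∷ []) y (pre′ ++ w′ ++ b ∷ []) y′
            (trans eu (sym (snoc-++ pre w b y))) (trans ev (sym (snoc-++ pre′ w′ b y′))) (shorter w l)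
            (leftCut-Y w b w′ L st R (proj₁ Y) (proj₂ Y))
            (bound-cast (sym (length-snoc pre w b)) (sym (length-snoc pre′ w′ b)) (rrigid⇒bound′ R))
            (snoc-≋ pre w pre′ w′ b e′)
            (rightCuts-cast (sym (length-snoc pre w b)) (sym (length-snoc pre′ w′ b)) rest))
        where
        Y = at-Y pre w {b} {y} {pre′} {w′} {y′} eu ev e′

      at-left : ∀ f pre x a y pre′ x′ y′ → u ≡ pre ++ x ++ a ∷ y → v ≡ pre′ ++ x′ ++ a ∷ y′ →
                length (x ++ a ∷ y) ≤ f → (N : NextLeft pre pre′ x a) →
                length pre′ + length x′ ≡ NextLeft.X′ N → Bound c U (length pre) V (length pre′) →
                length pre ≋ length pre′ [ s ] → StabR pre x → StabL (a ∷ y′) x′ →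
                RightCuts (suc (length pre + length x)) y (suc (length pre′ + length x′)) y′ →
                pre ++ x ++ a ∷ y ~ pre ++ x′ ++ a ∷ y′
      at-left zero pre x a y pre′ x′ y′ eu ev l =
        contradiction (≤-trans (≤-reflexive (sym (trans (length-++ x) (+-suc (length x) (length y))))) l) λ ()
      at-left (suc f) pre x a y pre′ x′ y′ eu ev l N ex bd e st st′ rest =
        advance pre x a y pre′ x′ y′ eu ev st st′ bd (bound-cast refl (sym ex) (lrigid⇒bound′ (NextLeft.rigid-c N))) e e′
          (replace f (pre ++ x ++ a ∷ []) y (pre′ ++ x′ ++ a ∷ []) y′
            (trans eu (sym (snoc-++ pre x a y))) (trans ev (sym (snoc-++ pre′ x′ a y′))) (shorter x l)
            (leftCut-X N ex)
            (bound-cast (sym (length-snoc pre x a)) (trans (cong suc (sym ex)) (sym (length-snoc pre′ x′ a)))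
               (lrigid⇒bound (NextLeft.rigid-c N)))
            (snoc-≋ pre x pre′ x′ a e′)
            (rightCuts-cast (sym (length-snoc pre x a)) (sym (length-snoc pre′ x′ a)) rest))
        where
        e′ : length pre + length x ≋ length pre′ + length x′ [ s ]
        e′ = ≋-trans (positions {r = length pre + length x} (NextLeft.at-U N) (NextLeft.at-V N) ≋-refl)
                     (≋-reflexive (sym ex))

      left-first : ∀ f pre x a w b y z pre′ x′ w′ y′ z′ →
                   ∃[ t ] w ≡ x ++ a ∷ t × z ≡ t ++ b ∷ y → ∃[ t ] w′ ≡ x′ ++ a ∷ t × z′ ≡ t ++ b ∷ y′ →
                   u ≡ pre ++ w ++ b ∷ y → v ≡ pre′ ++ w′ ++ b ∷ y′ →
                   length (w ++ b ∷ y) ≤ f → (N : NextLeft pre pre′ x a) →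
                   length pre′ + length x′ ≡ NextLeft.X′ N → Bound c U (length pre) V (length pre′) →
                   length pre ≋ length pre′ [ s ] → StabR pre x → StabL (b ∷ y′) w′ →
                   RRigid c U (length pre + length w) V (length pre′ + length w′) →
                   length pre + length w ≋ length pre′ + length w′ [ s ] →
                   RightCuts (suc (length pre + length w)) y (suc (length pre′ + length w′)) y′ →
                   pre ++ w ++ b ∷ y ~ pre ++ w′ ++ b ∷ y′
      left-first f pre x a _ b y _ pre′ x′ _ y′ _ (t , refl , refl) (t′ , refl , refl)
                 eu ev l N ex bd e st st′ R e′ rest =
        ~-cast (cong (pre ++_) (sym (++-assoc x (a ∷ t) (b ∷ y)))) (cong (pre ++_) (sym (++-assoc x′ (a ∷ t′) (b ∷ y′))))
          (at-left f pre x a (t ++ b ∷ y) pre′ x′ (t′ ++ b ∷ y′)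
            (trans eu (cong (pre ++_) (++-assoc x (a ∷ t) (b ∷ y))))
            (trans ev (cong (pre′ ++_) (++-assoc x′ (a ∷ t′) (b ∷ y′))))
            (≤-trans (≤-reflexive (cong length (sym (++-assoc x (a ∷ t) (b ∷ y))))) l) N ex bd e st
            (stabL-fst {b ∷ y′} {x′} {a ∷ t′} st′)
            (cut t b y t′ y′
              (stabL-snd {b ∷ y′} {x′ ++ a ∷ []} (subst (StabL (b ∷ y′)) (sym (++-assoc x′ (a ∷ []) t′)) st′))
              (subst₂ (λ i j → RRigid c U i V j) (sym (len pre x t)) (sym (len pre′ x′ t′)) R)
              (≋-trans (≋-reflexive (len pre x t)) (≋-trans e′ (≋-reflexive (sym (len pre′ x′ t′)))))
              (rightCuts-cast (cong suc (sym (len pre x t))) (cong suc (sym (len pre′ x′ t′))) rest)))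
        where
        len : ∀ (pre x t : Word m) → suc (length pre + length x) + length t ≡ length pre + length (x ++ a ∷ t)
        len pre x t = trans (cong suc (+-assoc (length pre) (length x) (length t)))
          (trans (sym (+-suc (length pre) _)) (cong (length pre +_)
            (trans (sym (+-suc (length x) (length t))) (sym (length-++ x)))))

      same-cut : ∀ f pre x a w b y z pre′ x′ w′ y′ z′ →
                 x ≡ w × a ≡ b × z ≡ y → x′ ≡ w′ × a ≡ b × z′ ≡ y′ →
                 u ≡ pre ++ w ++ b ∷ y → v ≡ pre′ ++ w′ ++ b ∷ y′ →
                 length (w ++ b ∷ y) ≤ f → (N : NextLeft pre pre′ x a) →
                 length pre′ + length x′ ≡ NextLeft.X′ N → Bound c U (length pre) V (length pre′) →
                 length pre ≋ length pre′ [ s ] → StabR pre x → StabL (b ∷ y′) w′ →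
                 RightCuts (suc (length pre + length w)) y (suc (length pre′ + length w′)) y′ →
                 pre ++ w ++ b ∷ y ~ pre ++ w′ ++ b ∷ y′
      same-cut f pre x a _ _ y _ pre′ x′ _ y′ _ (refl , refl , refl) (refl , _ , refl) eu ev l N ex bd e st st′ rest =
        at-left f pre x a y pre′ x′ y′ eu ev l N ex bd e st st′ rest

    words-~ : u ~ v
    words-~ = replace (length u) [] u [] v refl refl ≤-refl
      (leftCut [] [] 0 0 refl stabR-[] (lhalf-start , lhalf-start) (count-≤-length (BelowR? []) reps) (λ _ _ _ _ _ → z≤n))
      (λ _ _ → (λ ()) , (λ ())) ≋-refl rightCuts

-- A boundary is recognised with `c` rounds, and two more compare boundaries of different kinds.
-- Each further level adds the rounds for the boundaries of its factors.
rounds : ℕ → ℕ → ℕ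
rounds c zero    = suc (suc c)
rounds c (suc k) = rounds c k + suc (suc c)

sim-one : ∀ {B : Set} k {n} {U V : List B} {i j} → Sim (suc k) n U i V j → Sim 1 n U i V j
sim-one zero    s = s
sim-one (suc k) s = sim-one k (sim-k s)

rounds-≥ : ∀ c k → suc (suc c) ≤ rounds c k
rounds-≥ c zero    = ≤-refl
rounds-≥ c (suc k) = m≤n+m (suc (suc c)) (rounds c k)

module _ {m s : ℕ} {{s≢0 : NonZero s}} where

  factor-eqv : ∀ k n c {u v : Word m} pre w post pre′ w′ post′ →
               u ≡ pre ++ w ++ post → v ≡ pre′ ++ w′ ++ post′ →
               length pre ≋ length pre′ [ s ] → length w ≋ length w′ [ s ] →
               Bound c (enr s 0 u) (length pre) (enr s 0 v) (length pre′) →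
               Bound c (enr s 0 u) (length pre + length w) (enr s 0 v) (length pre′ + length w′) →
               Eqv (suc (suc k)) (n + c) s u v → Eqv (suc k) n s w w′
  factor-eqv k n c {u} {v} pre w post pre′ w′ post′ refl refl e l lo hi E =
    eqv l (lower (factor-sub k n F (Eqv.to E)))
          (sub-raise t (zero-sum′) zero-sum (factor-sub k n (factors-flip F) (Eqv.from E)))
    where
    enr³ : ∀ a b c → enr s 0 (a ++ b ++ c) ≡
           enr s 0 a ++ enr s (length a) b ++ enr s (length a + length b) c
    enr³ a b c = trans (enr-++ 0 a (b ++ c)) (cong (enr s 0 a ++_) (enr-++ (length a) b c))
    bound-cast : ∀ {x y x′ y′} → x ≡ y → x′ ≡ y′ →
                 Bound c (enr s 0 u) x (enr s 0 v) x′ → Bound c (enr s 0 u) y (enr s 0 v) y′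
    bound-cast refl refl b = b
    F : Factors c (enr s 0 u) (enr s 0 v) (enr s (length pre) w) (enr s (length pre′) w′)
    F = factors {l = enr s 0 pre} {enr s (length pre + length w) post} {enr s 0 pre′} {enr s (length pre′ + length w′) post′}
      (enr³ pre w post) (enr³ pre′ w′ post′)
      (bound-cast (sym (length-enr 0 pre)) (sym (length-enr 0 pre′)) lo)
      (bound-cast (sym (cong₂ _+_ (length-enr 0 pre) (length-enr _ w)))
                  (sym (cong₂ _+_ (length-enr 0 pre′) (length-enr _ w′))) hi)
    -- Modulo `s` this is the negative of `length pre`; raising by it makes the labels of the factor
    -- start from 0.
    t = length pre * pred s
    zero-sum : t + length pre ≋ 0 [ s ]
    zero-sum = ≋-trans (≋-reflexive (trans (+-comm t (length pre))
      (trans (sym (*-suc (length pre) (pred s))) (cong (length pre *_) (suc-pred s))))) (≋-*0 (length pre) s)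
    zero-sum′ : t + length pre′ ≋ 0 [ s ]
    zero-sum′ = ≋-trans (≋-+ (≋-refl {t}) (≋-sym e)) zero-sum
    lower : Sub (suc k) n (enr s (length pre) w) (enr s (length pre′) w′) → Sub (suc k) n (enr s 0 w) (enr s 0 w′)
    lower = sub-raise t zero-sum zero-sum′

module _ {m s : ℕ} {{s≢0 : NonZero s}} where

  -- The modulus and the number of rounds in the conclusion depend only on the
  -- congruence, those in the hypothesis are arbitrary.
  saturated : ∀ k (C : Congruence m s) q n →
              (∀ u v → Eqv (suc k) n (suc q * s) {{m*n≢0 (suc q) s}} u v → Congruence._~_ C u v) →
              ∀ u v → Eqv (suc k) (rounds (length (Congruence.reps C)) k) s u v → Congruence._~_ C u v
  saturated zero C q n sat u v E =
    Cuts.Match.words-~ C transferʳ transferˡ u v (Eqv.to E) (Eqv.from E) (Eqv.lengths E)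
      (λ pre w post pre′ w′ post′ _ _ _ l _ _ st st′ → segment₁ sat st st′ l)
    where
    open Green C
    open Loops q
    open Derive sat
  saturated (suc k) C q n sat u v E =
    Cuts.Match.words-~ C transferʳ transferˡ u v (one (Eqv.to E)) (one (Eqv.from E)) (Eqv.lengths E) segment
    where
    open Green C
    open Loops q
    open Derive sat
    c = length reps
    N = rounds c k
    one : ∀ {U V : List (Fin m × ℕ)} → Sub (suc (suc k)) (rounds c (suc k)) U V → Sub 1 (suc (suc c)) U V
    one s = sim-one (suc k) (sim-≤ (rounds-≥ c (suc k)) s)
    factor-~ : ∀ w w′ → Eqv (suc k) N s w w′ → w ≈ w′
    -- The induction hypothesis is used for the derived congruence with the same modulus d; the
    -- number of rounds there may grow freely, as it does not enter the conclusion.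
    factor-~ = saturated k derived q (suc n) (derived-saturated sat)
    fewer : ∀ {U V : List (Fin m × ℕ)} → Sub (suc (suc k)) (rounds c (suc k)) U V → Sub (suc (suc k)) (N + c) U V
    fewer s = sim-≤ (+-monoʳ-≤ N (≤-trans (n≤1+n c) (n≤1+n (suc c)))) s
    segment : ∀ pre w post pre′ w′ post′ → u ≡ pre ++ w ++ post → v ≡ pre′ ++ w′ ++ post′ →
       length pre ≋ length pre′ [ s ] → length w ≋ length w′ [ s ] →
       Bound c (enr s 0 u) (length pre) (enr s 0 v) (length pre′) →
       Bound c (enr s 0 u) (length pre + length w) (enr s 0 v) (length pre′ + length w′) →
       StabR pre w → StabL post′ w′ → pre ++ w ++ post′ ~ pre ++ w′ ++ post′
    segment pre w post pre′ w′ post′ eu ev e l lo hi st st′ =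
      -- The cuts make `w` stable for the prefix and `w′` stable for the suffix; the equivalence of
      -- the factors carries the latter over to `w`.
      middle w≈w′ pre post′ st (proj₂ (stabL⇌ w≈w′ post′) st′)
      where
      w≈w′ : w ≈ w′
      w≈w′ = factor-~ w w′ (factor-eqv k N c pre w post pre′ w′ post′ eu ev e l lo hi
               (eqv (Eqv.lengths E) (fewer (Eqv.to E)) (fewer (Eqv.from E))))

-- Formulas and the game

≋-∣ : ∀ {a b d e} → e ∣ d → a ≋ b [ d ] → a ≋ b [ e ]
≋-∣ {a} {b} {e = e} (divides q d≡) l = ≋-factor q e (subst (λ t → a ≋ b [ t ]) d≡ l)

at-lookup : ∀ {A : Set} (w : List A) p → At w (toℕ p) (lookup w p)
at-lookup (a ∷ w) zero    = first
at-lookup (a ∷ w) (suc p) = next (at-lookup w p)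

at-lookup⁻ : ∀ {A : Set} {w : List A} {i a} → At w i a → ∃[ p ] toℕ p ≡ i × lookup w p ≡ a
at-lookup⁻ first    = zero , refl , refl
at-lookup⁻ (next q) = let p , e , f = at-lookup⁻ q in suc p , cong suc e , f

atom? : ∀ P ℓ xs → Dec (⟦ P ⟧ᴺ ℓ xs)
atom? lt        ℓ (p ∷ q ∷ []) = p FinP.<? q
atom? eq        ℓ (p ∷ q ∷ []) = p FinP.≟ q
atom? (MOD d i) ℓ (p ∷ [])     = _%_ (toℕ p) d {{FinP.nonZeroIndex i}} ≟ toℕ i
atom? (D d i)   ℓ []           = _%_ ℓ d {{FinP.nonZeroIndex i}} ≟ toℕ i

sat? : ∀ {m σ n} {Γ : Subset n} (w : Word m) ρ (φ : Formula m σ Γ) → Dec (w , ρ ⊨ φ)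
sat? w ρ (num P _ xs)     = atom? P (length w) (Vec.map ρ xs)
sat? w ρ (letter a x)     = lookup w (ρ x) FinP.≟ a
sat? w ρ (neg φ)          = ¬? (sat? w ρ φ)
sat? w ρ (and φ ψ)        = sat? w ρ φ ×-dec sat? w ρ ψ
sat? w ρ (or φ ψ)         = sat? w ρ φ ⊎-dec sat? w ρ ψ
sat? w ρ (quant ∃ᶠ x φ)   = FinP.any? (λ p → sat? w (ρ [ x ↦ p ]) φ)
sat? w ρ (quant ∀ᶠ x φ)   = FinP.all? (λ p → sat? w (ρ [ x ↦ p ]) φ)

data Source {n} {Γ : Subset n} (x : Fin n) (z : Var (Γ Subset.∪ ⁅ x ⁆)) : Set where
  new : (∀ {ℓ} (ρ : Assignment ℓ Γ) p → (ρ [ x ↦ p ]) z ≡ p) → Source x z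
  old : ∀ y → proj₁ y ≢ x → (∀ {ℓ} (ρ : Assignment ℓ Γ) p → (ρ [ x ↦ p ]) z ≡ ρ y) → Source x z

update-new : ∀ {n ℓ} {Γ : Subset n} (ρ : Assignment ℓ Γ) {x y} p y∈ → y ≡ x → (ρ [ x ↦ p ]) (y , y∈) ≡ p
update-new ρ {x} {y} p y∈ e with y FinP.≟ x
... | yes _  = refl
... | no y≢x = contradiction e y≢x

update-old : ∀ {n ℓ} {Γ : Subset n} (ρ : Assignment ℓ Γ) {x y} p y∈ → y ≢ x → (y∈Γ : y Subset.∈ Γ) →
             (ρ [ x ↦ p ]) (y , y∈) ≡ ρ (y , y∈Γ)
update-old {Γ = Γ} ρ {x} {y} p y∈ y≢x y∈Γ with y FinP.≟ x
... | yes e = contradiction e y≢x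
... | no _ with x∈p∪q⁻ Γ ⁅ x ⁆ y∈
...   | inj₁ q = cong (λ z → ρ (y , z)) ([]=-irrelevant q y∈Γ)
...   | inj₂ q = contradiction (x∈⁅y⁆⇒x≡y x q) y≢x

source : ∀ {n} {Γ : Subset n} x (z : Var (Γ Subset.∪ ⁅ x ⁆)) → Source {Γ = Γ} x z
source {Γ = Γ} x (y , y∈) with y FinP.≟ x
... | yes e = new (λ ρ p → update-new ρ p y∈ e)
... | no y≢x with x∈p∪q⁻ Γ ⁅ x ⁆ y∈
...   | inj₁ y∈Γ = old (y , y∈Γ) y≢x (λ ρ p → update-old ρ p y∈ y≢x y∈Γ)
...   | inj₂ y∈x = contradiction (x∈⁅y⁆⇒x≡y x y∈x) y≢x

bound : ∀ {n} {Γ : Subset n} y → Var (Γ Subset.∪ ⁅ y ⁆)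
bound y = y , x∈p∪q⁺ (inj₂ (x∈⁅x⁆ y))

kept : ∀ {n} {Γ : Subset n} y → Var Γ → Var (Γ Subset.∪ ⁅ y ⁆)
kept y (x , x∈) = x , x∈p∪q⁺ (inj₁ x∈)

numModulus : NumPred → ℕ
numModulus lt        = 1
numModulus eq        = 1
numModulus (MOD d _) = d
numModulus (D d _)   = d

module _ {m n : ℕ} {Γ : Subset n} where

  record Agree (d : ℕ) .{{_ : NonZero d}} (w : Word m) (ρ : Assignment (length w) Γ)
               (w′ : Word m) (ρ′ : Assignment (length w′) Γ) : Set where
    constructor agree
    field
      sizes  : length w ≋ length w′ [ d ]
      colors : ∀ x → Col (enr d 0 w) (toℕ (ρ x)) (enr d 0 w′) (toℕ (ρ′ x))
      orders : ∀ x y → Ord (toℕ (ρ x)) (toℕ (ρ y)) (toℕ (ρ′ x)) (toℕ (ρ′ y))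

  agree-sym : ∀ {d} .{{_ : NonZero d}} {w ρ w′ ρ′} → Agree d w ρ w′ ρ′ → Agree d w′ ρ′ w ρ
  agree-sym (agree l c o) = agree (≋-sym l) (λ x → proj₂ (c x) , proj₁ (c x)) (λ x y → ord-flip (o x y))

  module _ {d : ℕ} .{{d≢0 : NonZero d}} where

    colour : ∀ {w ρ w′ ρ′} → Agree d w ρ w′ ρ′ → ∀ x →
             lookup w (ρ x) ≡ lookup w′ (ρ′ x) × toℕ (ρ x) ≋ toℕ (ρ′ x) [ d ]
    colour {w} {ρ} {w′} {ρ′} A x = cong proj₁ e , %⇒≋ (cong proj₂ e)
      where
      e = at-unique (proj₁ (Agree.colors A x) (at-enr 0 (at-lookup w (ρ x)))) (at-enr 0 (at-lookup w′ (ρ′ x)))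

    atom-agree : ∀ {w ρ w′ ρ′} → Agree d w ρ w′ ρ′ → ∀ P → numModulus P ∣ d → (xs : Vec (Var Γ) (arity P)) →
                 ⟦ P ⟧ᴺ (length w) (Vec.map ρ xs) → ⟦ P ⟧ᴺ (length w′) (Vec.map ρ′ xs)
    atom-agree A lt        _  (x ∷ y ∷ []) p = Ord.below (Agree.orders A x y) p
    atom-agree A eq        _  (x ∷ y ∷ []) p = toℕ-injective (Ord.same (Agree.orders A x y) (cong toℕ p))
    atom-agree A (MOD e i) e∣ (x ∷ [])     p =
      trans (sym (≋⇒% {{FinP.nonZeroIndex i}} (≋-∣ e∣ (proj₂ (colour A x))))) p
    atom-agree A (D e i)   e∣ []           p =
      trans (sym (≋⇒% {{FinP.nonZeroIndex i}} (≋-∣ e∣ (Agree.sizes A)))) p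

modulus : ∀ {m σ n} {Γ : Subset n} → Formula m σ Γ → ℕ
modulus (num P _ _)   = numModulus P
modulus (letter _ _)  = 1
modulus (neg φ)       = modulus φ
modulus (and φ ψ)     = modulus φ * modulus ψ
modulus (or φ ψ)      = modulus φ * modulus ψ
modulus (quant _ _ φ) = modulus φ

modulus-≢0 : ∀ {m σ n} {Γ : Subset n} (φ : Formula m σ Γ) → NonZero (modulus φ)
modulus-≢0 (num lt _ _)        = _
modulus-≢0 (num eq _ _)        = _
modulus-≢0 (num (MOD d i) _ _) = FinP.nonZeroIndex i
modulus-≢0 (num (D d i) _ _)   = FinP.nonZeroIndex i
modulus-≢0 (letter _ _)        = _
modulus-≢0 (neg φ)             = modulus-≢0 φ
modulus-≢0 (and φ ψ)           = m*n≢0 (modulus φ) (modulus ψ) {{modulus-≢0 φ}} {{modulus-≢0 ψ}}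
modulus-≢0 (or φ ψ)            = m*n≢0 (modulus φ) (modulus ψ) {{modulus-≢0 φ}} {{modulus-≢0 ψ}}
modulus-≢0 (quant _ _ φ)       = modulus-≢0 φ

depth : ∀ {m σ n} {Γ : Subset n} → Formula m σ Γ → ℕ
depth (num _ _ _)   = 0
depth (letter _ _)  = 0
depth (neg φ)       = depth φ
depth (and φ ψ)     = depth φ ⊔ depth ψ
depth (or φ ψ)      = depth φ ⊔ depth ψ
depth (quant _ _ φ) = suc (depth φ)

other : Fin 2 → Fin 2
other zero    = suc zero
other (suc _) = zero

other-unique : ∀ {x y : Fin 2} → y ≢ x → y ≡ other x
other-unique {zero}     {zero}     y≢x = contradiction refl y≢x
other-unique {zero}     {suc zero} y≢x = refl
other-unique {suc zero} {zero}     y≢x = refl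
other-unique {suc zero} {suc zero} y≢x = contradiction refl y≢x

module _ {m d : ℕ} .{{d≢0 : NonZero d}} where

  -- Every variable has a game of its own, because a quantifier may reuse either symbol and the
  -- other one is then the pebble that is kept; `whole` is for the case that there is no other one.
  record State {Γ : Subset 2} (k n : ℕ) (w : Word m) (ρ : Assignment (length w) Γ)
               (w′ : Word m) (ρ′ : Assignment (length w′) Γ) : Set where
    constructor state
    field
      sizes  : length w ≋ length w′ [ d ]
      whole  : Sub k n (enr d 0 w) (enr d 0 w′)
      sims   : ∀ x → Sim k n (enr d 0 w) (toℕ (ρ x)) (enr d 0 w′) (toℕ (ρ′ x))
      orders : ∀ x y → Ord (toℕ (ρ x)) (toℕ (ρ y)) (toℕ (ρ′ x)) (toℕ (ρ′ y))

  module _ {Γ : Subset 2} where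

    state-flip : ∀ {k n w ρ w′ ρ′} → State {Γ} (suc k) n w ρ w′ ρ′ → State k n w′ ρ′ w ρ
    state-flip (state l s f o) = state (≋-sym l) (sim-flip s) (λ x → sim-flip (f x)) (λ x y → ord-flip (o x y))

    state⇒agree : ∀ {k n w ρ w′ ρ′} → State {Γ} k n w ρ w′ ρ′ → Agree d w ρ w′ ρ′
    state⇒agree (state l s f o) = agree l (λ x → sim-col (f x)) o

    Answer : ℕ → ℕ → ∀ (w : Word m) → Assignment (length w) Γ → ∀ (w′ : Word m) → Assignment (length w′) Γ →
             Fin 2 → Fin (length w) → Set
    Answer k n w ρ w′ ρ′ x p = Σ[ p′ ∈ Fin (length w′) ] Sim k n (enr d 0 w) (toℕ p) (enr d 0 w′) (toℕ p′) ×
      (∀ z → proj₁ z ≢ x → Ord (toℕ p) (toℕ (ρ z)) (toℕ p′) (toℕ (ρ′ z)))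

    answer-state : ∀ {k n w ρ w′ ρ′} → State {Γ} (suc k) (suc n) w ρ w′ ρ′ → ∀ x p → Answer (suc k) n w ρ w′ ρ′ x p
    answer-state {k} {n} {w} {ρ} {w′} {ρ′} (state l s f o) x p with other x ∈? Γ
    ... | yes y∈ = found (forth (f (other x , y∈)) at-p)
      where
      at-p = at-enr {d = d} 0 (at-lookup w p)
      found : ∃[ j ] Ord (toℕ p) (toℕ (ρ (other x , y∈))) j (toℕ (ρ′ (other x , y∈))) ×
              Sim (suc k) n (enr d 0 w) (toℕ p) (enr d 0 w′) j → Answer (suc k) n w ρ w′ ρ′ x p
      found (j , o , s) with at-enr⁻ 0 (proj₁ (sim-col s) at-p)
      ... | _ , q , _ with at-lookup⁻ q
      ...   | p′ , refl , _ = p′ , s , λ { (z , z∈) z≢x → unique z∈ (other-unique z≢x) }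
        where
        unique : ∀ {z} (z∈ : z Subset.∈ Γ) → z ≡ other x → Ord (toℕ p) (toℕ (ρ (z , z∈))) (toℕ p′) (toℕ (ρ′ (z , z∈)))
        unique z∈ refl rewrite []=-irrelevant z∈ y∈ = o
    ... | no y∉ = found (forth s at-p)
      where
      at-p = at-enr {d = d} 0 (at-lookup w p)
      found : ∃[ j ] Ord (toℕ p) (length (enr d 0 w)) j (length (enr d 0 w′)) ×
              Sim (suc k) n (enr d 0 w) (toℕ p) (enr d 0 w′) j → Answer (suc k) n w ρ w′ ρ′ x p
      found (j , _ , s) with at-enr⁻ 0 (proj₁ (sim-col s) at-p)
      ... | _ , q , _ with at-lookup⁻ q
      ...   | p′ , refl , _ = p′ , s ,
        λ { (z , z∈) z≢x → contradiction (subst (Subset._∈ Γ) (other-unique z≢x) z∈) y∉ }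

    extend : ∀ {k n w ρ w′ ρ′} → State {Γ} (suc k) (suc n) w ρ w′ ρ′ → ∀ x p →
             ∃[ p′ ] State {Γ Subset.∪ ⁅ x ⁆} (suc k) n w (ρ [ x ↦ p ]) w′ (ρ′ [ x ↦ p′ ])
    extend {k} {n} {w} {ρ} {w′} {ρ′} S x p =
      let p′ , s , o = answer-state S x p in
      p′ , state (State.sizes S) (sim-n (State.whole S)) (sims p′ s) (orders p′ o)
      where
      sims : ∀ p′ → Sim (suc k) n (enr d 0 w) (toℕ p) (enr d 0 w′) (toℕ p′) → ∀ z →
             Sim (suc k) n (enr d 0 w) (toℕ ((ρ [ x ↦ p ]) z)) (enr d 0 w′) (toℕ ((ρ′ [ x ↦ p′ ]) z))
      sims p′ s z with source x z
      ... | new e     = subst₂ (λ i j → Sim _ _ _ (toℕ i) _ (toℕ j)) (sym (e ρ p)) (sym (e ρ′ p′)) s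
      ... | old y _ e = subst₂ (λ i j → Sim _ _ _ (toℕ i) _ (toℕ j)) (sym (e ρ p)) (sym (e ρ′ p′))
                          (sim-n (State.sims S y))
      orders : ∀ p′ → (∀ z → proj₁ z ≢ x → Ord (toℕ p) (toℕ (ρ z)) (toℕ p′) (toℕ (ρ′ z))) → ∀ y z →
               Ord (toℕ ((ρ [ x ↦ p ]) y)) (toℕ ((ρ [ x ↦ p ]) z))
                   (toℕ ((ρ′ [ x ↦ p′ ]) y)) (toℕ ((ρ′ [ x ↦ p′ ]) z))
      orders p′ o y z with source x y | source x z
      ... | new e       | new f       rewrite e ρ p | e ρ′ p′ | f ρ p | f ρ′ p′ = ord-eq
      ... | new e       | old a a≢x f rewrite e ρ p | e ρ′ p′ | f ρ p | f ρ′ p′ = o a a≢x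
      ... | old a a≢x e | new f       rewrite e ρ p | e ρ′ p′ | f ρ p | f ρ′ p′ = ord-swap (o a a≢x)
      ... | old a _ e   | old b _ f   rewrite e ρ p | e ρ′ p′ | f ρ p | f ρ′ p′ = State.orders S a b

  -- Truth is always carried from `w` to `w′`. For ∃ a witness is moved forward, for ∀ a position of
  -- `w′` is moved back to `w`, so the game runs the opposite way.
  Polar : ∀ {Γ : Subset 2} → Quantifier → ℕ → ℕ → ∀ (w : Word m) → Assignment (length w) Γ →
          ∀ (w′ : Word m) → Assignment (length w′) Γ → Set
  Polar ∃ᶠ k n w ρ w′ ρ′ = State k n w ρ w′ ρ′
  Polar ∀ᶠ k n w ρ w′ ρ′ = State k n w′ ρ′ w ρ

  polar⇒agree : ∀ {Γ : Subset 2} q {k n w ρ w′ ρ′} → Polar {Γ} q k n w ρ w′ ρ′ → Agree d w ρ w′ ρ′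
  polar⇒agree ∃ᶠ S = state⇒agree S
  polar⇒agree ∀ᶠ S = agree-sym (state⇒agree S)

  Alternating : Quantifier → ℕ → List (List Quantifier) → Set
  Alternating q k = All (λ qs → alternations (q ∷ qs) < k)

  -- Every formula has a leaf, so a bound on all branches is a bound on at least one.
  All-0< : ∀ {σ n} {Γ : Subset n} {k} {f : List Quantifier → ℕ} (φ : Formula m σ Γ) →
           All (λ qs → f qs < k) (branches φ) → 0 < k
  All-0< (num _ _ _)   (p ∷ _) = ≤-trans (s≤s z≤n) p
  All-0< (letter _ _)  (p ∷ _) = ≤-trans (s≤s z≤n) p
  All-0< (neg φ)       ps      = All-0< φ ps
  All-0< (and φ ψ)     ps      = All-0< φ (AllP.++⁻ˡ (branches φ) ps)
  All-0< (or φ ψ)      ps      = All-0< φ (AllP.++⁻ˡ (branches φ) ps)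
  All-0< (quant q x φ) ps      = All-0< φ (AllP.map⁻ ps)

  -- Entering the scope of a quantifier r below a quantifier q: the level drops
  -- and the words are exchanged if q and r differ.
  switch : ∀ {Γ : Subset 2} {σ n₀ Γ′} q r {k n w ρ w′ ρ′} (φ : Formula m σ {n₀} Γ′) →
           All (λ qs → alternations (q ∷ qs) < k) (List.map (r ∷_) (branches φ)) →
           Polar {Γ} q k n w ρ w′ ρ′ →
           ∃[ k′ ] Alternating r (suc k′) (branches φ) × Polar {Γ} r (suc k′) n w ρ w′ ρ′
  switch ∃ᶠ ∃ᶠ {zero}  φ ps S = contradiction (All-0< φ (AllP.map⁻ ps)) λ ()
  switch ∃ᶠ ∃ᶠ {suc k} φ ps S = k , AllP.map⁻ ps , S
  switch ∀ᶠ ∀ᶠ {zero}  φ ps S = contradiction (All-0< φ (AllP.map⁻ ps)) λ ()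
  switch ∀ᶠ ∀ᶠ {suc k} φ ps S = k , AllP.map⁻ ps , S
  switch ∃ᶠ ∀ᶠ {zero}  φ ps S = contradiction (All-0< φ (AllP.map⁻ ps)) λ ()
  switch ∃ᶠ ∀ᶠ {suc zero}    φ ps S = contradiction (All-0< φ (All.map s≤s⁻¹ (AllP.map⁻ ps))) λ ()
  switch ∃ᶠ ∀ᶠ {suc (suc k)} φ ps S = k , All.map s≤s⁻¹ (AllP.map⁻ ps) , state-flip S
  switch ∀ᶠ ∃ᶠ {zero}  φ ps S = contradiction (All-0< φ (AllP.map⁻ ps)) λ ()
  switch ∀ᶠ ∃ᶠ {suc zero}    φ ps S = contradiction (All-0< φ (All.map s≤s⁻¹ (AllP.map⁻ ps))) λ ()
  switch ∀ᶠ ∃ᶠ {suc (suc k)} φ ps S = k , All.map s≤s⁻¹ (AllP.map⁻ ps) , state-flip S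

  ∣-fst : ∀ {a b} → a * b ∣ d → a ∣ d
  ∣-fst = ∣-trans (m∣m*n _)

  ∣-snd : ∀ a {b} → a * b ∣ d → b ∣ d
  ∣-snd a = ∣-trans (n∣m*n a)

  mutual
    -- The negation normal form only measures alternations; the induction follows the formula
    -- itself. Negated subformulas are handled by `pres¬`, where the decidability of satisfaction
    -- takes the place of classical logic.
    pres : ∀ {σ} {Γ : Subset 2} q (φ : Formula m σ Γ) {k n w ρ w′ ρ′} → depth φ ≤ n → modulus φ ∣ d →
           Alternating q k (branches (nnf φ)) → Polar q k n w ρ w′ ρ′ → w , ρ ⊨ φ → w′ , ρ′ ⊨ φ
    pres q (num P _ xs) _ e∣ _ S p = atom-agree (polar⇒agree q S) P e∣ xs p
    pres q (letter a x) _ _ _ S p = trans (sym (proj₁ (colour (polar⇒agree q S) x))) p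
    pres q (neg φ) l e∣ ps S p = pres¬ q φ l e∣ ps S p
    pres q (and φ ψ) l e∣ ps S (p , p′) =
      pres q φ (m⊔n≤o⇒m≤o _ _ l) (∣-fst e∣) (AllP.++⁻ˡ (branches (nnf φ)) ps) S p ,
      pres q ψ (m⊔n≤o⇒n≤o _ _ l) (∣-snd (modulus φ) e∣) (AllP.++⁻ʳ (branches (nnf φ)) ps) S p′
    pres q (or φ ψ) l e∣ ps S (inj₁ p) =
      inj₁ (pres q φ (m⊔n≤o⇒m≤o _ _ l) (∣-fst e∣) (AllP.++⁻ˡ (branches (nnf φ)) ps) S p)
    pres q (or φ ψ) l e∣ ps S (inj₂ p) =
      inj₂ (pres q ψ (m⊔n≤o⇒n≤o _ _ l) (∣-snd (modulus φ) e∣) (AllP.++⁻ʳ (branches (nnf φ)) ps) S p)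
    pres {Γ = Γ} q (quant ∃ᶠ x φ) {n = suc n} (s≤s l) e∣ ps S (p , sat) =
      let k , ps′ , S′ = switch {Γ} q ∃ᶠ (nnf φ) ps S
          p′ , S″ = extend S′ x p
      in p′ , pres ∃ᶠ φ l e∣ ps′ S″ sat
    pres {Γ = Γ} q (quant ∀ᶠ x φ) {n = suc n} (s≤s l) e∣ ps S sat p′ =
      let k , ps′ , S′ = switch {Γ} q ∀ᶠ (nnf φ) ps S
          p , S″ = extend S′ x p′
      in pres ∀ᶠ φ l e∣ ps′ S″ (sat p)

    pres¬ : ∀ {σ} {Γ : Subset 2} q (φ : Formula m σ Γ) {k n w ρ w′ ρ′} → depth φ ≤ n → modulus φ ∣ d →
            Alternating q k (branches (nnf¬ φ)) → Polar q k n w ρ w′ ρ′ → ¬ (w , ρ ⊨ φ) → ¬ (w′ , ρ′ ⊨ φ)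
    pres¬ q (num P _ xs) _ e∣ _ S ¬p p = ¬p (atom-agree (agree-sym (polar⇒agree q S)) P e∣ xs p)
    pres¬ q (letter a x) _ _ _ S ¬p p = ¬p (trans (proj₁ (colour (polar⇒agree q S) x)) p)
    pres¬ q (neg φ) {w = w} {ρ} l e∣ ps S ¬¬p ¬p = ¬p (pres q φ l e∣ ps S (Dec.decidable-stable (sat? w ρ φ) ¬¬p))
    pres¬ q (and φ ψ) {w = w} {ρ} l e∣ ps S ¬p (p , p′) with sat? w ρ φ
    ... | no ¬q = pres¬ q φ (m⊔n≤o⇒m≤o _ _ l) (∣-fst e∣) (AllP.++⁻ˡ (branches (nnf¬ φ)) ps) S ¬q p
    ... | yes r = pres¬ q ψ (m⊔n≤o⇒n≤o _ _ l) (∣-snd (modulus φ) e∣) (AllP.++⁻ʳ (branches (nnf¬ φ)) ps) S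
                        (λ r′ → ¬p (r , r′)) p′
    pres¬ q (or φ ψ) l e∣ ps S ¬p (inj₁ p) =
      pres¬ q φ (m⊔n≤o⇒m≤o _ _ l) (∣-fst e∣) (AllP.++⁻ˡ (branches (nnf¬ φ)) ps) S (¬p ∘ inj₁) p
    pres¬ q (or φ ψ) l e∣ ps S ¬p (inj₂ p) =
      pres¬ q ψ (m⊔n≤o⇒n≤o _ _ l) (∣-snd (modulus φ) e∣) (AllP.++⁻ʳ (branches (nnf¬ φ)) ps) S (¬p ∘ inj₂) p
    pres¬ {Γ = Γ} q (quant ∃ᶠ x φ) {n = suc n} (s≤s l) e∣ ps S ¬p (p′ , sat) =
      let k , ps′ , S′ = switch {Γ} q ∀ᶠ (nnf¬ φ) ps S
          p , S″ = extend S′ x p′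
      in pres¬ ∀ᶠ φ l e∣ ps′ S″ (λ r → ¬p (p , r)) sat
    pres¬ {Γ = Γ} q (quant ∀ᶠ x φ) {n = suc n} {w} {ρ} (s≤s l) e∣ ps S ¬p sat =
      let k , ps′ , S′ = switch {Γ} q ∃ᶠ (nnf¬ φ) ps S
          p , ¬r = FinP.¬∀⟶∃¬ _ _ (λ p → sat? w (ρ [ x ↦ p ]) φ) ¬p
          p′ , S″ = extend S′ x p
      in pres¬ ∃ᶠ φ l e∣ ps′ S″ ¬r (sat p′)

  top : ∀ r {k} bs → All (λ qs → alternations qs < k) (List.map (r ∷_) bs) →
        All (λ qs → alternations (r ∷ qs) < k) (List.map (r ∷_) bs)
  top ∃ᶠ bs ps = AllP.map⁺ (AllP.map⁻ ps)
  top ∀ᶠ bs ps = AllP.map⁺ (AllP.map⁻ ps)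

  polar : ∀ {Γ : Subset 2} r {k n w ρ w′ ρ′} → State {Γ} k n w ρ w′ ρ′ → State {Γ} k n w′ ρ′ w ρ → Polar r k n w ρ w′ ρ′
  polar ∃ᶠ S S′ = S
  polar ∀ᶠ S S′ = S′

  Below : ℕ → List (List Quantifier) → Set
  Below k = All (λ qs → alternations qs < k)

  mutual
    -- Outside all quantifiers it is still open which one a branch starts with, so the games in both
    -- directions are kept until one is met.
    preserves : ∀ {σ} {Γ : Subset 2} (φ : Formula m σ Γ) {k n w ρ w′ ρ′} → depth φ ≤ n → modulus φ ∣ d →
                Below k (branches (nnf φ)) → State k n w ρ w′ ρ′ → State k n w′ ρ′ w ρ →
                w , ρ ⊨ φ → w′ , ρ′ ⊨ φ
    preserves (num P _ xs) _ e∣ _ S _ p = atom-agree (state⇒agree S) P e∣ xs p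
    preserves (letter a x) _ _ _ S _ p = trans (sym (proj₁ (colour (state⇒agree S) x))) p
    preserves (neg φ) l e∣ ps S S′ p = preserves¬ φ l e∣ ps S S′ p
    preserves (and φ ψ) l e∣ ps S S′ (p , p′) =
      preserves φ (m⊔n≤o⇒m≤o _ _ l) (∣-fst e∣) (AllP.++⁻ˡ (branches (nnf φ)) ps) S S′ p ,
      preserves ψ (m⊔n≤o⇒n≤o _ _ l) (∣-snd (modulus φ) e∣) (AllP.++⁻ʳ (branches (nnf φ)) ps) S S′ p′
    preserves (or φ ψ) l e∣ ps S S′ (inj₁ p) =
      inj₁ (preserves φ (m⊔n≤o⇒m≤o _ _ l) (∣-fst e∣) (AllP.++⁻ˡ (branches (nnf φ)) ps) S S′ p)
    preserves (or φ ψ) l e∣ ps S S′ (inj₂ p) =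
      inj₂ (preserves ψ (m⊔n≤o⇒n≤o _ _ l) (∣-snd (modulus φ) e∣) (AllP.++⁻ʳ (branches (nnf φ)) ps) S S′ p)
    preserves (quant r x φ) l e∣ ps S S′ p =
      pres r (quant r x φ) l e∣ (top r (branches (nnf φ)) ps) (polar r S S′) p

    preserves¬ : ∀ {σ} {Γ : Subset 2} (φ : Formula m σ Γ) {k n w ρ w′ ρ′} → depth φ ≤ n → modulus φ ∣ d →
                 Below k (branches (nnf¬ φ)) → State k n w ρ w′ ρ′ → State k n w′ ρ′ w ρ →
                 ¬ (w , ρ ⊨ φ) → ¬ (w′ , ρ′ ⊨ φ)
    preserves¬ (num P _ xs) _ e∣ _ S S′ ¬p p = ¬p (atom-agree (state⇒agree S′) P e∣ xs p)
    preserves¬ (letter a x) _ _ _ S S′ ¬p p = ¬p (trans (proj₁ (colour (state⇒agree S) x)) p)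
    preserves¬ (neg φ) {w = w} {ρ} l e∣ ps S S′ ¬¬p ¬p =
      ¬p (preserves φ l e∣ ps S S′ (Dec.decidable-stable (sat? w ρ φ) ¬¬p))
    preserves¬ (and φ ψ) {w = w} {ρ} l e∣ ps S S′ ¬p (p , p′) with sat? w ρ φ
    ... | no ¬q = preserves¬ φ (m⊔n≤o⇒m≤o _ _ l) (∣-fst e∣) (AllP.++⁻ˡ (branches (nnf¬ φ)) ps) S S′ ¬q p
    ... | yes r = preserves¬ ψ (m⊔n≤o⇒n≤o _ _ l) (∣-snd (modulus φ) e∣) (AllP.++⁻ʳ (branches (nnf¬ φ)) ps) S S′
                             (λ r′ → ¬p (r , r′)) p′
    preserves¬ (or φ ψ) l e∣ ps S S′ ¬p (inj₁ p) =
      preserves¬ φ (m⊔n≤o⇒m≤o _ _ l) (∣-fst e∣) (AllP.++⁻ˡ (branches (nnf¬ φ)) ps) S S′ (¬p ∘ inj₁) p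
    preserves¬ (or φ ψ) l e∣ ps S S′ ¬p (inj₂ p) =
      preserves¬ ψ (m⊔n≤o⇒n≤o _ _ l) (∣-snd (modulus φ) e∣) (AllP.++⁻ʳ (branches (nnf¬ φ)) ps) S S′ (¬p ∘ inj₂) p
    preserves¬ (quant r x φ) l e∣ ps S S′ ¬p p =
      pres¬ (dual r) (quant r x φ) l e∣ (top (dual r) (branches (nnf¬ φ)) ps) (polar (dual r) S S′) ¬p p

  sentence-preserves : ∀ {σ} (φ : Sentence m σ 2) {k u v} → Below k (branches (nnf φ)) → modulus φ ∣ d →
                       Eqv k (depth φ) d u v → ⟦ φ ⟧ u → ⟦ φ ⟧ v
  sentence-preserves φ ps e∣ (eqv l s t) =
    preserves φ ≤-refl e∣ ps (state l s (λ (_ , x∈⊥) → contradiction x∈⊥ ∉⊥) (λ (_ , x∈⊥) → contradiction x∈⊥ ∉⊥))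
                             (state (≋-sym l) t (λ (_ , x∈⊥) → contradiction x∈⊥ ∉⊥) (λ (_ , x∈⊥) → contradiction x∈⊥ ∉⊥))

-- Sentences that define the classes of the game

⇌-cast : ∀ {A B : Set} (S : B → Set) {x y} → x ≡ y → A ⇌ S x → A ⇌ S y
⇌-cast S refl f = f

∅ : ∀ {n ℓ} → Assignment {n} ℓ ⊥
∅ (_ , x∈⊥) = contradiction x∈⊥ ∉⊥

Br : ∀ {m σ n} {Γ : Subset n} → (List Quantifier → Set) → Formula m σ Γ → Set
Br P φ = All P (branches (nnf φ))

module Propositional {m : ℕ} {σ : Signature} (d : ℕ) .{{d≢0 : NonZero d}} (D∈σ : ∀ i → D d i ∈ σ) where

  residue : ℕ → Fin d
  residue r = fromℕ< (m%n<n r d)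

  residue-toℕ : ∀ r → toℕ (residue r) ≡ r % d
  residue-toℕ r = toℕ-fromℕ< (m%n<n r d)

  residue⇌ : ∀ a r → (_%_ a d {{FinP.nonZeroIndex (residue r)}} ≡ toℕ (residue r)) ⇌ (_%_ a d {{d≢0}} ≡ _%_ r d {{d≢0}})
  residue⇌ a r = (λ e → trans e (residue-toℕ r)) , (λ e → trans e (sym (residue-toℕ r)))

  module _ {n : ℕ} {Γ : Subset n} where

    lengthᶠ : ℕ → Formula m σ Γ
    lengthᶠ r = num (D d (residue r)) (D∈σ _) []

    -- Length predicates are the only atoms without variables, so they have to provide the truth
    -- values.
    trueᶠ falseᶠ : Formula m σ Γ
    trueᶠ  = or (lengthᶠ 0) (neg (lengthᶠ 0))
    falseᶠ = and (lengthᶠ 0) (neg (lengthᶠ 0))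

    ⋀ ⋁ : ∀ {ℓ} → (Fin ℓ → Formula m σ Γ) → Formula m σ Γ
    ⋀ {zero}  f = trueᶠ
    ⋀ {suc ℓ} f = and (f zero) (⋀ (f ∘ suc))
    ⋁ {zero}  f = falseᶠ
    ⋁ {suc ℓ} f = or (f zero) (⋁ (f ∘ suc))

    module _ (w : Word m) (ρ : Assignment (length w) Γ) where

      lengthᶠ⇌ : ∀ r → (w , ρ ⊨ lengthᶠ r) ⇌ (length w ≋ r [ d ])
      lengthᶠ⇌ r = (λ e → %⇒≋ (proj₁ (residue⇌ (length w) r) e)) , (λ e → proj₂ (residue⇌ (length w) r) (≋⇒% e))

      true-⊨ : w , ρ ⊨ trueᶠ
      true-⊨ with sat? w ρ (lengthᶠ 0)
      ... | yes p = inj₁ p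
      ... | no ¬p = inj₂ ¬p

      false-⊨ : ¬ (w , ρ ⊨ falseᶠ)
      false-⊨ (p , ¬p) = ¬p p

      ⋀⇌ : ∀ {ℓ} (f : Fin ℓ → Formula m σ Γ) → (w , ρ ⊨ ⋀ f) ⇌ (∀ i → w , ρ ⊨ f i)
      ⋀⇌ {zero}  f = (λ _ ()) , (λ _ → true-⊨)
      ⋀⇌ {suc ℓ} f = (λ { (p , q) zero → p ; (p , q) (suc i) → proj₁ (⋀⇌ (f ∘ suc)) q i }) ,
                     (λ g → g zero , proj₂ (⋀⇌ (f ∘ suc)) (g ∘ suc))

      ⋁⇌ : ∀ {ℓ} (f : Fin ℓ → Formula m σ Γ) → (w , ρ ⊨ ⋁ f) ⇌ (∃[ i ] w , ρ ⊨ f i)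
      ⋁⇌ {zero}  f = (λ p → contradiction p false-⊨) , (λ ())
      ⋁⇌ {suc ℓ} f = (λ { (inj₁ p) → zero , p ; (inj₂ q) → let i , p = proj₁ (⋁⇌ (f ∘ suc)) q in suc i , p }) ,
                     (λ { (zero , p) → inj₁ p ; (suc i , p) → inj₂ (proj₂ (⋁⇌ (f ∘ suc)) (i , p)) })

    br-⋀ : ∀ {P ℓ} (f : Fin ℓ → Formula m σ Γ) → P [] → (∀ i → Br P (f i)) → Br P (⋀ f)
    br-⋀ {ℓ = zero}  f p g = p ∷ p ∷ []
    br-⋀ {ℓ = suc ℓ} f p g = AllP.++⁺ (g zero) (br-⋀ (f ∘ suc) p (g ∘ suc))

    br-⋁ : ∀ {P ℓ} (f : Fin ℓ → Formula m σ Γ) → P [] → (∀ i → Br P (f i)) → Br P (⋁ f)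
    br-⋁ {ℓ = zero}  f p g = p ∷ p ∷ []
    br-⋁ {ℓ = suc ℓ} f p g = AllP.++⁺ (g zero) (br-⋁ (f ∘ suc) p (g ∘ suc))

    unionᶠ : (Word m → Formula m σ Γ) → List (Word m) → Formula m σ Γ
    unionᶠ f us = ⋁ (f ∘ lookup us)

module Hintikka {m : ℕ} {σ : Signature} (d : ℕ) .{{d≢0 : NonZero d}} (D∈σ : ∀ i → D d i ∈ σ)
                (MOD∈σ : ∀ i → MOD d i ∈ σ) (lt∈σ : lt ∈ σ) (u : Word m) where

  open Propositional {m} {σ} d D∈σ public

  -- nothing stands for no pebble.
  Pebbles : Subset 2 → Set
  Pebbles Γ = Maybe (Fin (length u) × Var Γ)

  U : List (Fin m × ℕ)
  U = enr d 0 u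

  posU : ∀ {Γ} → Pebbles Γ → ℕ
  posU (just (i , _)) = toℕ i
  posU nothing        = length U

  posW : ∀ {Γ} (w : Word m) → Assignment (length w) Γ → Pebbles Γ → ℕ
  posW w ρ (just (_ , x)) = toℕ (ρ x)
  posW w ρ nothing        = length (enr d 0 w)

  fresh : ∀ {Γ} → Pebbles Γ → Fin 2
  fresh (just (_ , x , _)) = other x
  fresh nothing            = zero

  module _ {Γ : Subset 2} where

    lessᶠ : Var Γ → Var Γ → Formula m σ Γ
    lessᶠ x y = num lt lt∈σ (x ∷ y ∷ [])

    colorᶠ : Pebbles Γ → Formula m σ Γ
    colorᶠ nothing        = trueᶠ
    colorᶠ (just (i , x)) = and (letter (lookup u i) x) (num (MOD d (residue (toℕ i))) (MOD∈σ _) (x ∷ []))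

  -- Equality of positions is written as the absence of both strict inequalities, because only `lt`
  -- is supposed to belong to the signature.
  orderᶠ : ∀ {Γ} (i : Fin (length u)) (pb : Pebbles Γ) → Formula m σ (Γ Subset.∪ ⁅ fresh pb ⁆)
  orderᶠ i nothing = trueᶠ
  orderᶠ i (just (j , x)) with <-cmp (toℕ i) (toℕ j)
  ... | tri< _ _ _ = lessᶠ (bound _) (kept _ x)
  ... | tri> _ _ _ = lessᶠ (kept _ x) (bound _)
  ... | tri≈ _ _ _ = and (neg (lessᶠ (bound _) (kept _ x))) (neg (lessᶠ (kept _ x) (bound _)))

  forthᶠ backᶠ : ∀ {Γ} (pb : Pebbles Γ) → (Fin (length u) → Formula m σ (Γ Subset.∪ ⁅ fresh pb ⁆)) → Formula m σ Γ
  forthᶠ pb F = ⋀ (λ i → quant ∃ᶠ (fresh pb) (and (orderᶠ i pb) (F i)))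
  backᶠ pb F  = quant ∀ᶠ (fresh pb) (⋁ (λ i → and (orderᶠ i pb) (F i)))

  guard : ∀ {Γ : Subset 2} → ℕ → Formula m σ Γ → Formula m σ Γ
  guard zero    φ = trueᶠ
  guard (suc _) φ = φ

  move : ∀ {Γ} (pb : Pebbles Γ) → Fin (length u) → Pebbles (Γ Subset.∪ ⁅ fresh pb ⁆)
  move pb i = just (i , bound (fresh pb))

  mutual
    -- Hintikka formulas of the game: `upᶠ` describes the game that starts in `u`, and `downᶠ` the
    -- one that starts in the word being read. A block of moves in `u` becomes a block of ∃, and a
    -- block in the other word one of ∀.
    upᶠ downᶠ : ∀ (k n : ℕ) {Γ} → Pebbles Γ → Formula m σ Γ
    upᶠ k zero    pb = colorᶠ pb
    upᶠ k (suc n) pb = and (colorᶠ pb) (and (guard k (forthᶠ pb (λ i → upᶠ k n (move pb i))))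
                                            (guard (pred k) (backᶠ pb (λ i → downᶠ (pred k) n (move pb i)))))
    downᶠ k zero    pb = colorᶠ pb
    downᶠ k (suc n) pb = and (colorᶠ pb) (and (guard k (backᶠ pb (λ i → downᶠ k n (move pb i))))
                                              (guard (pred k) (forthᶠ pb (λ i → upᶠ (pred k) n (move pb i)))))

  module _ {Γ : Subset 2} (w : Word m) (ρ : Assignment (length w) Γ) where

    W : List (Fin m × ℕ)
    W = enr d 0 w

    color⇌ : ∀ pb → (w , ρ ⊨ colorᶠ pb) ⇌ Col U (posU pb) W (posW w ρ pb)
    color⇌ nothing = (λ _ → col-end) , (λ _ → true-⊨ w ρ)
    color⇌ (just (i , x)) = to , from
      where
      atU : At U (toℕ i) (lookup u i , toℕ i % d)
      atU = at-enr 0 (at-lookup u i)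
      atW : At W (toℕ (ρ x)) (lookup w (ρ x) , toℕ (ρ x) % d)
      atW = at-enr 0 (at-lookup w (ρ x))
      to : _ → Col U (toℕ i) W (toℕ (ρ x))
      to (p , q) = (λ r → at-cast refl (trans (sym e) (at-unique atU r)) atW) ,
                   (λ r → at-cast refl (trans e (at-unique atW r)) atU)
        where
        e : (lookup u i , toℕ i % d) ≡ (lookup w (ρ x) , toℕ (ρ x) % d)
        e = cong₂ _,_ (sym p) (sym (proj₁ (residue⇌ (toℕ (ρ x)) (toℕ i)) q))
      from : Col U (toℕ i) W (toℕ (ρ x)) → _
      from (c , _) = let e = at-unique (c atU) atW in
        sym (cong proj₁ e) , proj₂ (residue⇌ (toℕ (ρ x)) (toℕ i)) (sym (cong proj₂ e))

    order⇌ : ∀ i pb p → (w , (ρ [ fresh pb ↦ p ]) ⊨ orderᶠ i pb) ⇌ Ord (toℕ i) (posU pb) (toℕ p) (posW w ρ pb)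
    order⇌ i nothing p = (λ _ → ord-lt (at-< (at-enr {d = d} 0 (at-lookup u i))) (at-< (at-enr {d = d} 0 (at-lookup w p)))) ,
                         (λ _ → true-⊨ w (ρ [ zero ↦ p ]))
    order⇌ i (just (j , x , x∈)) p with <-cmp (toℕ i) (toℕ j) | update-new ρ {other x} p (proj₂ (bound {Γ = Γ} (other x))) refl
        | update-old ρ {other x} p (proj₂ (kept {Γ = Γ} (other x) (x , x∈))) (x≢other x) x∈
      where
      x≢other : ∀ x → x ≢ other x
      x≢other zero ()
      x≢other (suc zero) ()
    ... | tri< i<j _ _ | e | f = (λ q → ord-lt i<j (subst₂ (λ a b → toℕ a < toℕ b) e f q)) ,
                                 (λ o → subst₂ (λ a b → toℕ a < toℕ b) (sym e) (sym f) (Ord.below o i<j))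
    ... | tri> _ _ j<i | e | f = (λ q → ord-gt j<i (subst₂ (λ a b → toℕ a < toℕ b) f e q)) ,
                                 (λ o → subst₂ (λ a b → toℕ a < toℕ b) (sym f) (sym e) (Ord.above o j<i))
    ... | tri≈ _ i≡j _ | e | f =
      (λ (q , r) → subst₂ (λ a b → Ord a (toℕ j) b (toℕ (ρ (x , x∈)))) (sym i≡j)
                     (≤-antisym (≮⇒≥ (λ l → q (subst₂ (λ a b → toℕ a < toℕ b) (sym e) (sym f) l)))
                                (≮⇒≥ (λ l → r (subst₂ (λ a b → toℕ a < toℕ b) (sym f) (sym e) l)))) ord-eq) ,
      (λ o → (λ q → <-irrefl (Ord.same o i≡j) (subst₂ (λ a b → toℕ a < toℕ b) e f q)) ,
             (λ q → <-irrefl (sym (Ord.same o i≡j)) (subst₂ (λ a b → toℕ a < toℕ b) f e q)))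

    forth⇌ : ∀ pb {F k n} → (∀ i p → (w , (ρ [ fresh pb ↦ p ]) ⊨ F i) ⇌ Sim k n U (toℕ i) W (toℕ p)) →
             (w , ρ ⊨ guard k (forthᶠ pb F)) ⇌ Reply (Sim k n) k U (posU pb) W (posW w ρ pb)
    forth⇌ pb {k = zero} _ = (λ _ ()) , (λ _ → true-⊨ w ρ)
    forth⇌ pb {F} {suc k} {n} F⇌ = to , from
      where
      to : w , ρ ⊨ forthᶠ pb F → Reply (Sim (suc k) n) (suc k) U (posU pb) W (posW w ρ pb)
      to sat _ {i₁} q with at-enr⁻ 0 q
      ... | _ , q′ , _ with at-lookup⁻ q′
      ...   | i , refl , _ = let p , o , s = proj₁ (⋀⇌ w ρ (λ i → quant ∃ᶠ (fresh pb) (and (orderᶠ i pb) (F i)))) sat i in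
        toℕ p , proj₁ (order⇌ i pb p) o , proj₁ (F⇌ i p) s
      from : Reply (Sim (suc k) n) (suc k) U (posU pb) W (posW w ρ pb) → w , ρ ⊨ forthᶠ pb F
      from f = proj₂ (⋀⇌ w ρ (λ i → quant ∃ᶠ (fresh pb) (and (orderᶠ i pb) (F i)))) answer
        where
        answer : ∀ i → w , ρ ⊨ quant ∃ᶠ (fresh pb) (and (orderᶠ i pb) (F i))
        answer i with f z<s (at-enr 0 (at-lookup u i))
        ... | j , o , s with at-enr⁻ 0 (proj₁ (sim-col s) (at-enr 0 (at-lookup u i)))
        ...   | _ , q , _ with at-lookup⁻ q
        ...     | p , refl , _ = p , proj₂ (order⇌ i pb p) o , proj₂ (F⇌ i p) s

    back⇌ : ∀ pb {F k n} → (∀ i p → (w , (ρ [ fresh pb ↦ p ]) ⊨ F i) ⇌ Sim k n W (toℕ p) U (toℕ i)) →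
            (w , ρ ⊨ guard k (backᶠ pb F)) ⇌ Reply (Sim k n) k W (posW w ρ pb) U (posU pb)
    back⇌ pb {k = zero} _ = (λ _ ()) , (λ _ → true-⊨ w ρ)
    back⇌ pb {F} {suc k} {n} F⇌ = to , from
      where
      to : w , ρ ⊨ backᶠ pb F → Reply (Sim (suc k) n) (suc k) W (posW w ρ pb) U (posU pb)
      to sat _ {j} q with at-enr⁻ 0 q
      ... | _ , q′ , _ with at-lookup⁻ q′
      ...   | p , refl , _ = let i , o , s = proj₁ (⋁⇌ w (ρ [ fresh pb ↦ p ]) (λ i → and (orderᶠ i pb) (F i))) (sat p) in
        toℕ i , ord-flip (proj₁ (order⇌ i pb p) o) , proj₁ (F⇌ i p) s
      from : Reply (Sim (suc k) n) (suc k) W (posW w ρ pb) U (posU pb) → w , ρ ⊨ backᶠ pb F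
      from f p = proj₂ (⋁⇌ w (ρ [ fresh pb ↦ p ]) (λ i → and (orderᶠ i pb) (F i))) answer
        where
        answer : ∃[ i ] w , (ρ [ fresh pb ↦ p ]) ⊨ and (orderᶠ i pb) (F i)
        answer with f z<s (at-enr 0 (at-lookup w p))
        ... | j , o , s with at-enr⁻ 0 (proj₁ (sim-col s) (at-enr 0 (at-lookup w p)))
        ...   | _ , q , _ with at-lookup⁻ q
        ...     | i , refl , _ = i , proj₂ (order⇌ i pb p) (ord-flip o) , proj₂ (F⇌ i p) s

  bound-≡ : ∀ {Γ : Subset 2} {ℓ} (ρ : Assignment ℓ Γ) y p → (ρ [ y ↦ p ]) (bound y) ≡ p
  bound-≡ {Γ} ρ y p = update-new ρ p (proj₂ (bound {Γ = Γ} y)) refl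

  mutual
    up⇌ : ∀ k n {Γ} (pb : Pebbles Γ) w ρ →
          (w , ρ ⊨ upᶠ k n pb) ⇌ Sim k n U (posU pb) (enr d 0 w) (posW w ρ pb)
    up⇌ k zero pb w ρ = (stop ∘ proj₁ (color⇌ w ρ pb)) , (proj₂ (color⇌ w ρ pb) ∘ sim-col)
    up⇌ k (suc n) pb w ρ =
      (λ (c , f , g) → play (proj₁ (color⇌ w ρ pb) c) (proj₁ F f) (proj₁ G g)) ,
      (λ { (play c f g) → proj₂ (color⇌ w ρ pb) c , proj₂ F f , proj₂ G g })
      where
      F = forth⇌ w ρ pb {λ i → upᶠ k n (move pb i)} {k} {n} (λ i p →
            ⇌-cast (λ z → Sim k n U (toℕ i) (enr d 0 w) (toℕ z)) (bound-≡ ρ (fresh pb) p)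
                  (up⇌ k n (move pb i) w (ρ [ fresh pb ↦ p ])))
      G = back⇌ w ρ pb {λ i → downᶠ (pred k) n (move pb i)} {pred k} {n} (λ i p →
            ⇌-cast (λ z → Sim (pred k) n (enr d 0 w) (toℕ z) U (toℕ i)) (bound-≡ ρ (fresh pb) p)
                  (down⇌ (pred k) n (move pb i) w (ρ [ fresh pb ↦ p ])))

    down⇌ : ∀ k n {Γ} (pb : Pebbles Γ) w ρ →
            (w , ρ ⊨ downᶠ k n pb) ⇌ Sim k n (enr d 0 w) (posW w ρ pb) U (posU pb)
    down⇌ k zero pb w ρ =
      (λ c → let c₁ , c₂ = proj₁ (color⇌ w ρ pb) c in stop (c₂ , c₁)) ,
      (λ s → let c₁ , c₂ = sim-col s in proj₂ (color⇌ w ρ pb) (c₂ , c₁))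
    down⇌ k (suc n) pb w ρ =
      (λ (c , f , g) → let c₁ , c₂ = proj₁ (color⇌ w ρ pb) c in play (c₂ , c₁) (proj₁ F f) (proj₁ G g)) ,
      (λ { (play (c₁ , c₂) f g) → proj₂ (color⇌ w ρ pb) (c₂ , c₁) , proj₂ F f , proj₂ G g })
      where
      F = back⇌ w ρ pb {λ i → downᶠ k n (move pb i)} {k} {n} (λ i p →
            ⇌-cast (λ z → Sim k n (enr d 0 w) (toℕ z) U (toℕ i)) (bound-≡ ρ (fresh pb) p)
                  (down⇌ k n (move pb i) w (ρ [ fresh pb ↦ p ])))
      G = forth⇌ w ρ pb {λ i → upᶠ (pred k) n (move pb i)} {pred k} {n} (λ i p →
            ⇌-cast (λ z → Sim (pred k) n U (toℕ i) (enr d 0 w) (toℕ z)) (bound-≡ ρ (fresh pb) p)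
                  (up⇌ (pred k) n (move pb i) w (ρ [ fresh pb ↦ p ])))

  -- The quantifier in front charges for an alternation at the root. With `pred k` the bound also
  -- makes sense at level 0, where the formulas have no quantifiers.
  Within : Quantifier → ℕ → List Quantifier → Set
  Within q k qs = alternations (q ∷ qs) ≤ pred k

  br-color : ∀ {P Γ} (pb : Pebbles Γ) → P [] → Br P (colorᶠ pb)
  br-color nothing  p = p ∷ p ∷ []
  br-color (just _) p = p ∷ p ∷ []

  br-order : ∀ {P Γ} i (pb : Pebbles Γ) → P [] → Br P (orderᶠ i pb)
  br-order i nothing        p = p ∷ p ∷ []
  br-order i (just (j , x)) p with <-cmp (toℕ i) (toℕ j)
  ... | tri< _ _ _ = p ∷ []
  ... | tri> _ _ _ = p ∷ []
  ... | tri≈ _ _ _ = p ∷ p ∷ []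

  br-forth : ∀ {P Γ} k (pb : Pebbles Γ) F → P [] → (0 < k → P (∃ᶠ ∷ [])) →
             (0 < k → ∀ i → Br (P ∘ (∃ᶠ ∷_)) (F i)) → Br P (guard k (forthᶠ pb F))
  br-forth zero    pb F p q f = p ∷ p ∷ []
  br-forth (suc k) pb F p q f = br-⋀ _ p (λ i → AllP.map⁺ (AllP.++⁺ (br-order i pb (q z<s)) (f z<s i)))

  br-back : ∀ {P Γ} k (pb : Pebbles Γ) F → P [] → (0 < k → P (∀ᶠ ∷ [])) →
            (0 < k → ∀ i → Br (P ∘ (∀ᶠ ∷_)) (F i)) → Br P (guard k (backᶠ pb F))
  br-back zero    pb F p q f = p ∷ p ∷ []
  br-back {P} (suc k) pb F p q f = AllP.map⁺ (br-⋁ {P = P ∘ (∀ᶠ ∷_)} (λ i → and (orderᶠ i pb) (F i)) (q z<s)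
    (λ i → AllP.++⁺ {xs = branches (nnf (orderᶠ i pb))} (br-order i pb (q z<s)) (f z<s i)))

  mutual
    br-up : ∀ k n {Γ} (pb : Pebbles Γ) → Br (Within ∃ᶠ k) (upᶠ k n pb)
    br-up k zero    pb = br-color pb z≤n
    br-up k (suc n) pb = AllP.++⁺ (br-color pb z≤n) (AllP.++⁺
      (br-forth k pb _ z≤n (λ _ → z≤n) (λ _ i → br-up k n (move pb i)))
      (br-back (pred k) pb _ z≤n id (λ k>0 i → All.map (λ {qs} → deeper {qs = qs} k>0) (br-down (pred k) n (move pb i)))))
      where
      deeper : ∀ {k qs} → 0 < k → alternations (∀ᶠ ∷ qs) ≤ pred k → suc (alternations (∀ᶠ ∷ qs)) ≤ k
      deeper {suc k} _ l = s≤s l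

    br-down : ∀ k n {Γ} (pb : Pebbles Γ) → Br (Within ∀ᶠ k) (downᶠ k n pb)
    br-down k zero    pb = br-color pb z≤n
    br-down k (suc n) pb = AllP.++⁺ (br-color pb z≤n) (AllP.++⁺
      (br-back k pb _ z≤n (λ _ → z≤n) (λ _ i → br-down k n (move pb i)))
      (br-forth (pred k) pb _ z≤n id (λ k>0 i → All.map (λ {qs} → deeper {qs = qs} k>0) (br-up (pred k) n (move pb i)))))
      where
      deeper : ∀ {k qs} → 0 < k → alternations (∃ᶠ ∷ qs) ≤ pred k → suc (alternations (∃ᶠ ∷ qs)) ≤ k
      deeper {suc k} _ l = s≤s l

  classᶠ : ℕ → ℕ → Sentence m σ 2
  classᶠ k n = and (lengthᶠ (length u)) (and (upᶠ k n nothing) (downᶠ k n nothing))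

  class⇌ : ∀ k n w → ⟦ classᶠ k n ⟧ w ⇌ Eqv k n d u w
  class⇌ k n w =
    (λ (l , a , b) → eqv (≋-sym (proj₁ (lengthᶠ⇌ {2} {⊥} w ∅ (length u)) l)) (proj₁ (up⇌ k n nothing w ∅) a)
                        (proj₁ (down⇌ k n nothing w ∅) b)) ,
    (λ (eqv l a b) → proj₂ (lengthᶠ⇌ {2} {⊥} w ∅ (length u)) (≋-sym l) , proj₂ (up⇌ k n nothing w ∅) a ,
                     proj₂ (down⇌ k n nothing w ∅) b)

  br-class : ∀ k n → Br (λ qs → alternations qs < suc k) (classᶠ (suc k) n)
  br-class k n = z<s ∷ AllP.++⁺ (All.map (λ {qs} l → s≤s (≤-trans (fewer ∃ᶠ qs) l)) (br-up (suc k) n nothing))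
                                (All.map (λ {qs} l → s≤s (≤-trans (fewer ∀ᶠ qs) l)) (br-down (suc k) n nothing))
    where
    fewer : ∀ q qs → alternations qs ≤ alternations (q ∷ qs)
    fewer q  []        = z≤n
    fewer ∃ᶠ (∃ᶠ ∷ qs) = ≤-refl
    fewer ∃ᶠ (∀ᶠ ∷ qs) = n≤1+n _
    fewer ∀ᶠ (∃ᶠ ∷ qs) = n≤1+n _
    fewer ∀ᶠ (∀ᶠ ∷ qs) = ≤-refl

-- Letter counts modulo 2s

count-++ : ∀ {A : Set} {P : A → Set} (P? : ∀ x → Dec (P x)) xs ys →
           count P? (xs ++ ys) ≡ count P? xs + count P? ys
count-++ P? []       ys = refl
count-++ P? (x ∷ xs) ys with P? x
... | yes _ = cong suc (count-++ P? xs ys)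
... | no _  = count-++ P? xs ys

count>0 : ∀ {A : Set} {P : A → Set} (P? : ∀ x → Dec (P x)) {xs i x} → At xs i x → P x → 0 < count P? xs
count>0 P? {x ∷ xs} first    p with P? x
... | yes _ = z<s
... | no ¬p = contradiction p ¬p
count>0 P? {y ∷ xs} (next q) p with P? y
... | yes _ = z<s
... | no _  = count>0 P? q p

count>0⁻ : ∀ {A : Set} {P : A → Set} (P? : ∀ x → Dec (P x)) xs → 0 < count P? xs → ∃[ i ] ∃[ x ] At xs i x × P x
count>0⁻ P? (x ∷ xs) l with P? x
... | yes p = zero , x , first , p
... | no _  = let i , y , q , p = count>0⁻ P? xs l in suc i , y , next q , p

occ : ∀ {m} → Letter m → List (Letter m) → ℕ
occ b = count (b ≟ˡ_)

occ-++ : ∀ {m} (b : Letter m) xs ys → occ b (xs ++ ys) ≡ occ b xs + occ b ys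
occ-++ b = count-++ (b ≟ˡ_)

occ-at : ∀ {m} {b : Letter m} {xs i} → At xs i b → 0 < occ b xs
occ-at {b = b} p = count>0 (b ≟ˡ_) p refl

occ-at⁻ : ∀ {m} {b : Letter m} xs → 0 < occ b xs → ∃[ i ] At xs i b
occ-at⁻ {b = b} xs l with count>0⁻ (b ≟ˡ_) xs l
... | i , _ , p , refl = i , p

occ-∷ : ∀ {m} (b c : Letter m) xs → occ b (c ∷ xs) ≡ occ b (c ∷ []) + occ b xs
occ-∷ b c xs = occ-++ b (c ∷ []) xs

occ-exchange : ∀ {m} (b x y : Letter m) zs rs → occ b (x ∷ zs ++ y ∷ rs) ≡ occ b (y ∷ zs ++ x ∷ rs)
occ-exchange b x y zs rs = trans (split x y)
  (trans (swap (occ b (x ∷ [])) (occ b zs) (occ b (y ∷ [])) (occ b rs)) (sym (split y x)))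
  where
  split : ∀ x y → occ b (x ∷ zs ++ y ∷ rs) ≡ occ b (x ∷ []) + (occ b zs + (occ b (y ∷ []) + occ b rs))
  split x y = trans (occ-∷ b x (zs ++ y ∷ rs)) (cong (occ b (x ∷ []) +_)
    (trans (occ-++ b zs (y ∷ rs)) (cong (occ b zs +_) (occ-∷ b y rs))))
  swap : ∀ x z y r → x + (z + (y + r)) ≡ y + (z + (x + r))
  swap = solve-∀

enr-middle : ∀ {m d} .{{_ : NonZero d}} o (a b : Fin m) z r → suc (length z) ≋ 0 [ d ] →
             enr d o (a ∷ z ++ b ∷ r) ≡ (a , o % d) ∷ enr d (suc o) z ++ (b , o % d) ∷ enr d (suc o) r
enr-middle {d = d} o a b z r e = cong (_ ∷_) (trans (enr-++ (suc o) z (b ∷ r))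
  (cong (enr d (suc o) z ++_) (cong₂ _∷_ (cong (b ,_) (≋⇒% e′)) (enr-≋ r (≋-+ (≋-refl {1}) e′)))))
  where
  e′ : suc o + length z ≋ o [ d ]
  e′ = ≋-trans (≋-reflexive (sym (+-suc o (length z))))
         (≋-trans (≋-+ (≋-refl {o}) e) (≋-reflexive (+-identityʳ o)))

record CEq {m : ℕ} (n d : ℕ) .{{_ : NonZero d}} (u v : Word m) : Set where
  constructor ceq
  field
    lengths : length u ≋ length v [ d ]
    counts  : ∀ a r → occ (a , r % d) (enr d 0 u) ≡ occ (a , r % d) (enr d 0 v) ⊎
                      (n ≤ occ (a , r % d) (enr d 0 u) × n ≤ occ (a , r % d) (enr d 0 v))

length-exchange : ∀ {A : Set} (x y : A) z r → length (x ∷ z ++ y ∷ r) ≡ length (y ∷ z ++ x ∷ r)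
length-exchange x y z r = cong suc (trans (length-++ z) (sym (length-++ z)))

module Commutative {m s : ℕ} {{s≢0 : NonZero s}} (C : Congruence m s) (q n : ℕ) where

  open Green C
  -- The modulus of the loops is thus an even multiple of `s`, that is, `suc q` times `2 * s`.
  open Loops (suc (q * 2))

  S : ℕ
  S = 2 * s

  instance
    S≢0 : NonZero S
    S≢0 = m*n≢0 2 s

  d≡ : d ≡ suc q * S
  d≡ = lemma q s
    where
    lemma : ∀ q s → suc (suc (q * 2)) * s ≡ suc q * (2 * s)
    lemma = solve-∀

  ≋-S : ∀ {a b} → a ≋ b [ S ] → a ≋ b [ s ]
  ≋-S = ≋-factor 2 s

  module _ (sat : ∀ u v → CEq n d u v → u ~ v) where

    -- As the period is twice the stability index, a gap between two letters at
    -- the same residue contains s letters and can be stretched to a multiple of d.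
    exchange : ∀ {x y z} → suc (length z) ≋ 0 [ S ] → x ∷ z ++ y ∷ [] ~ y ∷ z ++ x ∷ []
    exchange {x} {y} {z} e = ~-trans (stretch x y) (~-trans (sat _ _ balanced) (~-sym (stretch y x)))
      where
      s≤z : s ≤ length z
      s≤z = s≤s⁻¹ (≤-trans (m<m+n s (≤-trans (>-nonZero⁻¹ s) (m≤m+n s 0))) (large e))
        where
        large : suc (length z) ≋ 0 [ S ] → S ≤ suc (length z)
        large (mk≋ i j f) = ≮⇒≥ λ l → 1+n≢0 (trans (sym (m<n⇒m%n≡m l))
          (trans (sym ([m+kn]%n≡m%n (suc (length z)) i S)) (trans (cong (_% S) f) (m*n%n≡0 j S))))
      z₁ z₂ : Word m
      z₁ = List.take s z
      z₂ = List.drop s z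
      z₁-length : length z₁ ≡ s
      z₁-length = trans (ListP.length-take s z) (m≤n⇒m⊓n≡m s≤z)
      z≡ : z ≡ z₁ ++ z₂
      z≡ = sym (ListP.take++drop≡id s z)
      lift = ≋-lift (suc (q * 2)) s (≋-S e)
      j = proj₁ lift
      -- Modulo d the distance of the letters is `j * s`; lengthening the gap by `j * suc (q * 2)`
      -- times `s` turns it into `j * d`.
      adj = adjust z₁ (subst (0 <_) (sym z₁-length) (>-nonZero⁻¹ s))
                      (subst (_≋ 0 [ s ]) (sym z₁-length) s≋0) (j * suc (q * 2))
      z₁′ = proj₁ adj
      z′ : Word m
      z′ = z₁′ ++ z₂
      stretch : ∀ x y → x ∷ z ++ y ∷ [] ~ x ∷ z′ ++ y ∷ []
      stretch x y = ~-++ˡ (x ∷ []) (~-++ʳ (y ∷ []) (~-trans (~-reflexive z≡) (~-++ʳ z₂ (~-sym (proj₂ (proj₂ adj))))))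
      e′ : suc (length z′) ≋ 0 [ d ]
      e′ = ≋-trans (≋-reflexive (trans (cong suc (trans (length-++ z₁′) (cong (_+ length z₂) (proj₁ (proj₂ adj)))))
              (trans (shuffle (j * suc (q * 2)) s (length z₂)) (cong (λ t → suc t + j * suc (q * 2) * s)
                (trans (cong (_+ length z₂) (sym z₁-length)) (trans (sym (length-++ z₁)) (cong length (sym z≡))))))))
           (≋-trans (≋-+ (proj₂ lift) (≋-refl {j * suc (q * 2) * s}))
             (≋-trans (≋-reflexive (total j (suc (q * 2)) s)) (≋-*0 j d)))
        where
        shuffle : ∀ a s b → suc (suc a * s + b) ≡ suc (s + b) + a * s
        shuffle = solve-∀
        total : ∀ j q s → j * s + j * q * s ≡ j * (suc q * s)
        total = solve-∀
      balanced : CEq n d (x ∷ z′ ++ y ∷ []) (y ∷ z′ ++ x ∷ [])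
      balanced = ceq (≋-reflexive (length-exchange x y z′ [])) (λ a r → inj₁
        (trans (cong (occ (a , r % d)) (enr-middle 0 x y z′ [] e′))
          (trans (occ-exchange (a , r % d) _ _ (enr d 1 z′) [])
                 (cong (occ (a , r % d)) (sym (enr-middle 0 y x z′ [] e′))))))

    Same : ℕ → Word m → Word m → Set
    Same o u v = length u ≡ length v × (∀ b → occ b (enr S o u) ≡ occ b (enr S o v))

    to-front : ∀ o {v t x} → At v t x → t ≋ 0 [ S ] → ∃[ v′ ] v ~ x ∷ v′ × Same o v (x ∷ v′)
    to-front o {v} {zero}  {x} (first {u = v′}) _ = v′ , ~-refl , refl , (λ _ → refl)
    to-front o {y ∷ v} {suc t} {x} (next p) e with at-split p
    ... | z , r , refl , refl = z ++ y ∷ r ,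
      ~-cast (cong (y ∷_) (++-assoc z (x ∷ []) r)) (cong (x ∷_) (++-assoc z (y ∷ []) r)) (~-++ʳ r (exchange {y} {x} {z} e)) ,
      length-exchange y x z r ,
      (λ b → trans (cong (occ b) (enr-middle o y x z r e))
        (trans (occ-exchange b _ _ (enr S (suc o) z) _) (cong (occ b) (sym (enr-middle o x y z r e)))))

    -- The letters of `W` are fetched to the front one after the other. Exchanges respect residues,
    -- so the remainder `R` has exactly the labelled letters that are left over.
    pull : ∀ o W u → (∀ b → occ b (enr S o W) ≤ occ b (enr S o u)) → ∃[ R ] u ~ W ++ R × Same o u (W ++ R)
    pull o []      u le = u , ~-refl , refl , (λ _ → refl)
    pull o (x ∷ W) u le = front (occ-at⁻ (enr S o u) (≤-trans (occ-at {xs = enr S o (x ∷ W)} first) (le (x , o % S))))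
      where
      front : ∃[ i ] At (enr S o u) i (x , o % S) → ∃[ R ] u ~ x ∷ W ++ R × Same o u (x ∷ W ++ R)
      front (i , p) with at-enr⁻ o p
      ... | _ , p′ , e with cong proj₁ e
      ... | refl with to-front o p′ (≋-cancelˡ o (≋-trans (≋-sym (%⇒≋ (cong proj₂ e))) (≋-reflexive (sym (+-identityʳ o)))))
      ...   | u′ , u~ , len , same with pull (suc o) W u′ (λ b → +-cancelˡ-≤ (occ b ((x , o % S) ∷ [])) _ _
                (subst₂ _≤_ (occ-∷ b (x , o % S) (enr S (suc o) W))
                  (trans (same b) (occ-∷ b (x , o % S) (enr S (suc o) u′))) (le b)))
      ...     | R , u′~ , len′ , same′ = R , ~-trans u~ (~-++ˡ (x ∷ []) u′~) , trans len (cong suc len′) ,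
        (λ b → trans (same b) (trans (occ-∷ b (x , o % S) (enr S (suc o) u′))
          (trans (cong (occ b ((x , o % S) ∷ []) +_) (same′ b)) (sym (occ-∷ b (x , o % S) (enr S (suc o) (W ++ R)))))))

    same⇒~ : ∀ o u v → (∀ b → occ b (enr S o u) ≡ occ b (enr S o v)) → u ~ v
    same⇒~ o u v same with pull o v u (λ b → ≤-reflexive (sym (same b)))
    ... | []    , u~ , _ = ~-trans u~ (~-reflexive (++-identityʳ v))
    ... | x ∷ R , _ , _ , same′ = contradiction
      (subst (0 <_) (sym zero-occ) (occ-at {xs = enr S (o + length v) (x ∷ R)} first)) (<-irrefl refl)
      where
      b = x , (o + length v) % S
      zero-occ : 0 ≡ occ b (enr S (o + length v) (x ∷ R))
      zero-occ = +-cancelˡ-≡ (occ b (enr S o v)) _ _ (trans (+-identityʳ _)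
        (trans (sym (same b)) (trans (same′ b) (trans (cong (occ b) (enr-++ o v (x ∷ R))) (occ-++ b (enr S o v) _)))))

    -- The number of occurrences of a letter of a loop can be made as large as needed.
    absorb : ∀ {p h} → p ++ h ~ p → length h ≋ s [ d ] → ∀ X Y → length X ≋ length Y [ d ] →
             (∀ a r → occ (a , r % d) (enr d (length p) X) ≡ occ (a , r % d) (enr d (length p) Y) ⊎
                      ∃[ t ] At h t a × length p + t ≋ r [ s ]) →
             p ++ X ~ p ++ Y
    absorb {p} {h} e lh X Y lXY cond =
      ~-trans (~-++ʳ X (~-sym pR)) (~-trans (~-reflexive (++-assoc p R X))
        (~-trans (sat _ _ (ceq len eqs)) (~-trans (~-reflexive (sym (++-assoc p R Y))) (~-++ʳ Y pR))))
      where
      o = length p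
      R = rep n (period h)
      pR : p ++ R ~ p
      pR = period-fixʳ {p} {h} n e
      len : length (p ++ R ++ X) ≋ length (p ++ R ++ Y) [ d ]
      len = subst₂ (λ a b → a ≋ b [ d ]) (sym (length-++³ p R X)) (sym (length-++³ p R Y))
        (≋-+ (≋-refl {o}) (≋-+ (≋-refl {length R}) lXY))
      R≋0 : length R ≋ 0 [ d ]
      R≋0 = ≋-trans (≋-reflexive (length-rep n (period h)))
              (≋-trans (≋-* n (period-length h lh)) (≋-reflexive (*-zeroʳ n)))
      Z = enr d o (period h)
      total : ∀ b X → occ b (enr d 0 (p ++ R ++ X)) ≡ occ b (enr d 0 p) + (occ b (rep n Z) + occ b (enr d o X))
      total b X = trans (cong (occ b) (trans (enr-++ 0 p (R ++ X)) (cong (enr d 0 p ++_)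
                    (trans (enr-++ o R X) (cong₂ _++_ (enr-rep o n (period h) (period-length h lh))
                      (enr-≋ X (≋-trans (≋-+ (≋-refl {o}) R≋0) (≋-reflexive (+-identityʳ o)))))))))
                  (trans (occ-++ b (enr d 0 p) _) (cong (occ b (enr d 0 p) +_) (occ-++ b (rep n Z) _)))
      many : ∀ b k → 0 < occ b Z → k ≤ occ b (rep k Z)
      many b zero    l = z≤n
      many b (suc k) l = ≤-trans (+-mono-≤ l (many b k l)) (≤-reflexive (sym (occ-++ b Z (rep k Z))))
      eqs : ∀ a r → occ (a , r % d) (enr d 0 (p ++ R ++ X)) ≡ occ (a , r % d) (enr d 0 (p ++ R ++ Y)) ⊎
                    (n ≤ occ (a , r % d) (enr d 0 (p ++ R ++ X)) × n ≤ occ (a , r % d) (enr d 0 (p ++ R ++ Y)))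
      eqs a r = choose (cond a r)
        where
        b = a , r % d
        choose : _ ⊎ ∃[ t ] At h t a × o + t ≋ r [ s ] → _
        choose (inj₁ f) = inj₁ (trans (total b X) (trans (cong (λ t → occ b (enr d 0 p) + (occ b (rep n Z) + t)) f) (sym (total b Y))))
        choose (inj₂ (t , at-t , f)) = inj₂ (large X , large Y)
          where
          in-Z : ∃[ i ] At Z i b
          in-Z = lift-⊆ h lh {r} {o} {a ∷ []} (λ { first → t , at-t , ≋-trans (≋-reflexive (+-identityʳ r)) (≋-sym f) }) first
          large : ∀ X → n ≤ occ b (enr d 0 (p ++ R ++ X))
          large X = ≤-trans (many b n (occ-at (proj₂ in-Z)))
            (≤-trans (m≤m+n _ _) (≤-trans (m≤n+m _ (occ b (enr d 0 p))) (≤-reflexive (sym (total b X)))))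

total : ∀ {k} → (Fin k → ℕ) → ℕ
total {zero}  f = 0
total {suc k} f = f zero + total (f ∘ suc)

total-≤ : ∀ {k b} (f : Fin k → ℕ) → (∀ i → f i ≤ b) → total f ≤ k * b
total-≤ {zero}  f le = z≤n
total-≤ {suc k} f le = +-mono-≤ (le zero) (total-≤ (f ∘ suc) (le ∘ suc))

total-mono : ∀ {k} (f g : Fin k → ℕ) → (∀ i → f i ≤ g i) → total f ≤ total g
total-mono {zero}  f g le = z≤n
total-mono {suc k} f g le = +-mono-≤ (le zero) (total-mono (f ∘ suc) (g ∘ suc) (le ∘ suc))

total-< : ∀ {k} (f g : Fin k → ℕ) → (∀ i → f i ≤ g i) → ∀ a → f a < g a → total f < total g
total-< {suc k} f g le zero    l = +-mono-≤ l (total-mono (f ∘ suc) (g ∘ suc) (le ∘ suc))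
total-< {suc k} f g le (suc a) l =
  ≤-trans (≤-reflexive (sym (+-suc (f zero) _))) (+-mono-≤ (le zero) (total-< (f ∘ suc) (g ∘ suc) (le ∘ suc) a l))

atResidue : ∀ {m} → ℕ → List (Letter m) → ℕ
atResidue r = count (λ x → proj₂ x ≟ r)

atResidue-≤ : ∀ {m} r (xs : List (Letter m)) → atResidue r xs ≤ total (λ a → occ (a , r) xs)
atResidue-≤ r []             = z≤n
atResidue-≤ r ((c , t) ∷ xs) with t ≟ r
... | yes refl = ≤-trans (s≤s (atResidue-≤ r xs)) (total-< _ _ (mono c) c
        (≤-trans (+-monoˡ-≤ (occ (c , r) xs) (occ-at {b = c , r} first)) (≤-reflexive (sym (occ-∷ (c , r) (c , r) xs)))))
  where
  mono : ∀ c a → occ (a , r) xs ≤ occ (a , r) ((c , r) ∷ xs)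
  mono c a = ≤-trans (m≤n+m _ _) (≤-reflexive (sym (occ-∷ (a , r) (c , r) xs)))
... | no _ = ≤-trans (atResidue-≤ r xs) (total-mono _ _
        (λ a → ≤-trans (m≤n+m _ _) (≤-reflexive (sym (occ-∷ (a , r) (c , t) xs)))))

row : ∀ {m} → (ℕ → Fin m) → ℕ → ℕ → Word m
row f o zero    = []
row f o (suc k) = f o ∷ row f (suc o) k

length-row : ∀ {m} (f : ℕ → Fin m) o k → length (row f o k) ≡ k
length-row f o zero    = refl
length-row f o (suc k) = cong suc (length-row f (suc o) k)

at-row : ∀ {m} (f : ℕ → Fin m) o {k t} → t < k → At (row f o k) t (f (o + t))
at-row f o {suc k} {zero}  _       = at-cast refl (cong f (sym (+-identityʳ o))) first
at-row f o {suc k} {suc t} (s≤s l) = at-cast refl (cong f (sym (+-suc o t))) (next (at-row f (suc o) l))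

at-row⁻ : ∀ {m} (f : ℕ → Fin m) o {k t a} → At (row f o k) t a → a ≡ f (o + t)
at-row⁻ f o {suc k} first    = cong f (sym (+-identityʳ o))
at-row⁻ f o {suc k} {suc t} (next p) = trans (at-row⁻ f (suc o) p) (cong f (sym (+-suc o t)))

blocks : ∀ {m k} → (Fin k → Word m) → Word m
blocks {k = zero}  g = []
blocks {k = suc k} g = g zero ++ blocks (g ∘ suc)

module _ {m S : ℕ} where

  length-blocks : ∀ {k} (g : Fin k → Word m) → (∀ i → length (g i) ≡ S) → length (blocks g) ≡ k * S
  length-blocks {zero}  g e = refl
  length-blocks {suc k} g e = trans (length-++ (g zero)) (cong₂ _+_ (e zero) (length-blocks (g ∘ suc) (e ∘ suc)))

  skip : ∀ {x t} → length {A = Fin m} x ≡ S → length x + t ≋ t [ S ]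
  skip {t = t} refl = mk≋ 0 1 (trans (+-identityʳ _) (trans (+-comm _ t) (cong (t +_) (sym (+-identityʳ _)))))

  at-blocks : ∀ {k} (g : Fin k → Word m) → (∀ i → length (g i) ≡ S) → ∀ a {t x} → At (g a) t x →
              ∃[ t′ ] At (blocks g) t′ x × t′ ≋ t [ S ]
  at-blocks g e zero    p = _ , at-++ˡ p , ≋-refl
  at-blocks g e (suc a) p = let t′ , p′ , f = at-blocks (g ∘ suc) (e ∘ suc) a p in
    length (g zero) + t′ , at-++ʳ (g zero) p′ , ≋-trans (skip {g zero} (e zero)) f

  at-blocks⁻ : ∀ {k} (g : Fin k → Word m) → (∀ i → length (g i) ≡ S) → ∀ {t x} → At (blocks g) t x →
               ∃[ a ] ∃[ t′ ] At (g a) t′ x × t ≋ t′ [ S ]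
  at-blocks⁻ {suc k} g e p with at-++⁻ (g zero) p
  ... | inj₁ q = zero , _ , q , ≋-refl
  ... | inj₂ (j , refl , q) = let a , t′ , r , f = at-blocks⁻ (g ∘ suc) (e ∘ suc) q in
    suc a , t′ , r , ≋-trans (skip {g zero} (e zero)) f

  atResidue-many : .{{_ : NonZero S}} → ∀ K o (u : Word m) {r} → o ≋ 0 [ S ] → r < S → K * S ≤ length u →
                   K ≤ atResidue r (enr S o u)
  atResidue-many zero    o u o≋0 r<S l = z≤n
  atResidue-many (suc K) o u {r} o≋0 r<S l =
    subst (λ z → suc K ≤ atResidue r (enr S o z)) (ListP.take++drop≡id S u)
      (subst (suc K ≤_) (sym (trans (cong (atResidue r) (enr-++ o u₁ u₂)) (count-++ (λ x → proj₂ x ≟ r) (enr S o u₁) _)))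
        (+-mono-≤ one (atResidue-many K (o + length u₁) u₂
          (≋-trans (≋-+ o≋0 (≋-trans (≋-reflexive u₁-length) (mk≋ 0 1 refl))) ≋-refl) r<S rest)))
    where
    u₁ u₂ : Word m
    u₁ = List.take S u
    u₂ = List.drop S u
    u₁-length : length u₁ ≡ S
    u₁-length = trans (ListP.length-take S u) (m≤n⇒m⊓n≡m (≤-trans (m≤m+n S (K * S)) l))
    rest : K * S ≤ length u₂
    rest = subst (K * S ≤_) (sym (ListP.length-drop S u)) (subst (_≤ length u ∸ S) (m+n∸m≡n S (K * S)) (∸-monoˡ-≤ S l))
    one : 1 ≤ atResidue r (enr S o u₁)
    one with <-at u₁ (subst (r <_) (sym u₁-length) r<S)
    ... | a , p = count>0 (λ x → proj₂ x ≟ r) (at-enr o p)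
      (trans (≋⇒% (≋-+ o≋0 (≋-refl {r}))) (m<n⇒m%n≡m r<S))

module Threshold {m s : ℕ} {{s≢0 : NonZero s}} (C : Congruence m s) (q n : ℕ) where

  open Green C
  open Loops (suc (q * 2))
  open Commutative C q n

  -- `T` is the length of the word `W` below, `suc c` copies of a word of length `m * S`. In a word
  -- of length at least Θ each residue occurs at `suc (m * T)` positions, so one of the m letters
  -- has at least T occurrences there. The summand T ensures that a count of Θ is also one of T.
  c T Θ : ℕ
  c = length reps
  T = suc c * (m * S)
  Θ = T + suc (m * T) * S

  module _ (sat : ∀ u v → CEq n d u v → u ~ v) where

    -- No count in `u` can reach Θ, so all counts agree exactly and exchanges suffice.
    small-case : ∀ u v → CEq Θ S u v → length u < Θ → u ~ v
    small-case u v (ceq l counts) u<Θ = same⇒~ sat 0 u v same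
      where
      same′ : ∀ a r → occ (a , r % S) (enr S 0 u) ≡ occ (a , r % S) (enr S 0 v)
      same′ a r with counts a r
      ... | inj₁ e = e
      ... | inj₂ (Θ≤ , _) = contradiction (≤-trans Θ≤ (≤-trans (count-≤-length _ (enr S 0 u)) (≤-reflexive (length-enr 0 u)))) (<⇒≱ u<Θ)
      absent : ∀ (w : Word m) {a r} → r % S ≢ r → occ (a , r) (enr S 0 w) ≡ 0
      absent w {a} {r} r≢ = n≤0⇒n≡0 (≮⇒≥ (λ l → out (occ-at⁻ (enr S 0 w) l)))
        where
        out : ¬ (∃[ i ] At (enr S 0 w) i (a , r))
        out (i , p) with at-enr⁻ 0 p
        ... | _ , _ , e with cong proj₂ e
        ...   | refl = r≢ (m%n%n≡m%n i S)
      same : ∀ b → occ b (enr S 0 u) ≡ occ b (enr S 0 v)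
      same (a , r) with r % S ≟ r
      ... | yes e = subst (λ t → occ (a , t) (enr S 0 u) ≡ occ (a , t) (enr S 0 v)) e (same′ a r)
      ... | no r≢ = trans (absent u r≢) (sym (absent v r≢))

    module Large (u v : Word m) (equivalent : CEq Θ S u v) (Θ≤u : Θ ≤ length u) where

      U V : List (Letter m)
      U = enr S 0 u
      V = enr S 0 v

      Big : Fin m → ℕ → Set
      Big a r = T ≤ occ (a , r % S) U

      big-≋ : ∀ {a r t} → r ≋ t [ S ] → Big a r → Big a t
      big-≋ {a} e = subst (λ z → T ≤ occ (a , z) U) (≋⇒% e)

      pick : ∀ r → ∃[ a ] Big a r
      pick r with FinP.any? (λ a → T ≤? occ (a , r % S) U)
      ... | yes p = p
      ... | no ¬p = contradiction
        (≤-trans (atResidue-many {S = S} (suc (m * T)) 0 u ≋-refl (m%n<n r S) (≤-trans (m≤n+m _ T) Θ≤u))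
          (≤-trans (atResidue-≤ (r % S) U) (total-≤ _ (λ a → <⇒≤ (≰⇒> (λ l → ¬p (a , l)))))))
        (<-irrefl refl)

      m>0 : 0 < m
      m>0 = ≤-trans z<s (FinP.toℕ<n (proj₁ (pick 0)))

      -- Where `a` has too few occurrences, another frequent letter takes its place, so that every
      -- block has one letter for each residue.
      fill-in : Fin m → ℕ → Fin m
      fill-in a r with T ≤? occ (a , r % S) U
      ... | yes _ = a
      ... | no _  = proj₁ (pick r)

      fill-in-big : ∀ a r → Big (fill-in a r) r
      fill-in-big a r with T ≤? occ (a , r % S) U
      ... | yes p = p
      ... | no _  = proj₂ (pick r)

      fill-in-self : ∀ a r → Big a r → fill-in a r ≡ a
      fill-in-self a r p with T ≤? occ (a , r % S) U
      ... | yes _ = refl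
      ... | no ¬p = contradiction p ¬p

      block : Fin m → Word m
      block a = row (fill-in a) 0 S

      -- β contains every letter with many occurrences in u, at each residue where
      -- it has them.
      β : Word m
      β = blocks block

      block-length : ∀ a → length (block a) ≡ S
      block-length a = length-row (fill-in a) 0 S

      β-length : length β ≡ m * S
      β-length = length-blocks block block-length

      β≋0 : length β ≋ 0 [ S ]
      β≋0 = ≋-trans (≋-reflexive β-length) (≋-*0 m S)

      β-has : ∀ {a r} → Big a r → ∃[ t ] At β t a × t ≋ r [ S ]
      β-has {a} {r} p =
        let t , at-t , e = at-blocks block block-length a
                             (at-cast refl (fill-in-self a (r % S) (big-≋ (≋-sym (%-≋ r S)) p))
                               (at-row (fill-in a) 0 (m%n<n r S)))
        in t , at-t , ≋-trans e (%-≋ r S)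

      β-big : ∀ {t a} → At β t a → Big a t
      β-big p with at-blocks⁻ block block-length p
      ... | a , t′ , p′ , e = subst (λ z → Big z _) (sym (at-row⁻ (fill-in a) 0 p′)) (big-≋ (≋-sym e) (fill-in-big a t′))

      AllBig : ℕ → Word m → Set
      AllBig o x = ∀ {t a} → At x t a → Big a (o + t)

      allBig-++ : ∀ {o} x {y} → AllBig o x → AllBig (o + length x) y → AllBig o (x ++ y)
      allBig-++ {o} x f g p with at-++⁻ x p
      ... | inj₁ r = f r
      ... | inj₂ (j , refl , r) = big-≋ (≋-reflexive (+-assoc o (length x) j)) (g r)

      allBig-≋ : ∀ {o o′ x} → o ≋ o′ [ S ] → AllBig o x → AllBig o′ x
      allBig-≋ e f {t} p = big-≋ (≋-+ e (≋-refl {t})) (f p)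

      rep-big : ∀ k → AllBig 0 (rep k β)
      rep-big zero ()
      rep-big (suc k) = allBig-++ {0} β β-big (allBig-≋ (≋-sym β≋0) (rep-big k))

      rep≋0 : ∀ k → length (rep k β) ≋ 0 [ S ]
      rep≋0 k = ≋-trans (≋-reflexive (length-rep k β)) (≋-trans (≋-* k β≋0) (≋-reflexive (*-zeroʳ k)))

      W : Word m
      W = rep (suc c) β

      W-length : length W ≡ T
      W-length = trans (length-rep (suc c) β) (cong (suc c *_) β-length)

      W-≤ : ∀ w → (∀ a r → Big a r → T ≤ occ (a , r % S) (enr S 0 w)) → ∀ b → occ b (enr S 0 W) ≤ occ b (enr S 0 w)
      W-≤ w big b = ≮⇒≥ (λ l → absurd l (occ-at⁻ (enr S 0 W) (≤-trans (s≤s z≤n) l)))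
        where
        absurd : occ b (enr S 0 w) < occ b (enr S 0 W) → ¬ (∃[ i ] At (enr S 0 W) i b)
        absurd l (i , p) with at-enr⁻ 0 p
        ... | a , p′ , refl = <⇒≱ l (≤-trans (count-≤-length _ (enr S 0 W))
          (≤-trans (≤-reflexive (trans (length-enr 0 W) W-length)) (big a i (rep-big (suc c) p′))))

      big-v : ∀ a r → Big a r → T ≤ occ (a , r % S) V
      big-v a r p with CEq.counts equivalent a r
      ... | inj₁ e = subst (T ≤_) e p
      ... | inj₂ (_ , Θ≤) = ≤-trans (m≤m+n T _) Θ≤

      small : ∀ a r → ¬ Big a r → occ (a , r % S) U ≡ occ (a , r % S) V
      small a r ¬p with CEq.counts equivalent a r
      ... | inj₁ e = e
      ... | inj₂ (Θ≤ , _) = contradiction (≤-trans (m≤m+n T _) Θ≤) ¬p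

      W≋0 : length W ≋ 0 [ S ]
      W≋0 = rep≋0 (suc c)

      occ-none : ∀ {o a r} x → AllBig o x → ¬ Big a r → occ (a , r % S) (enr S o x) ≡ 0
      occ-none {o} {a} {r} x f ¬p = n≤0⇒n≡0 (≮⇒≥ (λ l → absurd (occ-at⁻ (enr S o x) l)))
        where
        absurd : ¬ (∃[ i ] At (enr S o x) i (a , r % S))
        absurd (i , p) with at-enr⁻ o p
        ... | _ , p′ , e with cong proj₁ e
        ...   | refl = ¬p (big-≋ (≋-sym (%⇒≋ (cong proj₂ e))) (f p′))

      occ-W++ : ∀ b R → occ b (enr S 0 (W ++ R)) ≡ occ b (enr S 0 W) + occ b (enr S 0 R)
      occ-W++ b R = trans (cong (occ b) (trans (enr-++ 0 W R) (cong (enr S 0 W ++_) (enr-≋ R W≋0)))) (occ-++ b (enr S 0 W) _)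

      prefix : Fin (suc c) → Fin c
      prefix i = Any.index (reps-complete (rep (toℕ i) β))

      module Remainders (Rᵤ Rᵥ : Word m) (eᵤ : u ~ W ++ Rᵤ) (sᵤ : Same sat 0 u (W ++ Rᵤ))
                        (eᵥ : v ~ W ++ Rᵥ) (sᵥ : Same sat 0 v (W ++ Rᵥ)) where

        small-R : ∀ a r → ¬ Big a r → occ (a , r % S) (enr S 0 Rᵤ) ≡ occ (a , r % S) (enr S 0 Rᵥ)
        small-R a r ¬p = +-cancelˡ-≡ (occ b (enr S 0 W)) _ _
          (trans (sym (occ-W++ b Rᵤ)) (trans (sym (proj₂ sᵤ b))
            (trans (small a r ¬p) (trans (proj₂ sᵥ b) (occ-W++ b Rᵥ)))))
          where b = a , r % S

        R≋ : length Rᵥ ≋ length Rᵤ [ S ]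
        R≋ = ≋-cancelˡ (length W) (subst₂ (λ a b → a ≋ b [ S ])
          (trans (proj₁ sᵥ) (length-++ W)) (trans (proj₁ sᵤ) (length-++ W))
          (≋-sym (CEq.lengths equivalent)))

        γ : Word m
        γ = row (proj₁ ∘ pick) 0 S

        γ-length : length γ ≡ S
        γ-length = length-row (proj₁ ∘ pick) 0 S

        γ-big : AllBig 0 γ
        γ-big {t} p = subst (λ z → Big z t) (sym (at-row⁻ (proj₁ ∘ pick) 0 p)) (proj₂ (pick t))

        γ≋0 : length γ ≋ 0 [ S ]
        γ≋0 = ≋-trans (≋-reflexive γ-length) (mk≋ 0 1 refl)

        module Padding (j : ℕ) (lift : length Rᵥ ≋ length Rᵤ + j * S [ suc q * S ]) where

          -- Filling for `Rᵤ`: `D₁` has length 0 modulo d and supplies each frequent letter at least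
          -- as often as `Rᵥ` can contain it; `D₂` corrects the length by `j * S`.
          D₁ D₂ E₀ : Word m
          D₁ = rep (suc q * length Rᵥ) β
          D₂ = rep j γ
          E₀ = D₁ ++ D₂

          γs-big : ∀ k → AllBig 0 (rep k γ)
          γs-big zero ()
          γs-big (suc k) = allBig-++ {0} γ γ-big (allBig-≋ (≋-sym γ≋0) (γs-big k))

          E₀-big : AllBig 0 E₀
          E₀-big = allBig-++ {0} D₁ (rep-big (suc q * length Rᵥ)) (allBig-≋ (≋-sym (rep≋0 (suc q * length Rᵥ))) (γs-big j))

          D₁-length : length D₁ ≋ 0 [ d ]
          D₁-length = ≋-trans (≋-reflexive (trans (length-rep (suc q * length Rᵥ) β)
            (trans (cong (suc q * length Rᵥ *_) β-length)
              (trans (shuffle (suc q) (length Rᵥ) m S) (cong (length Rᵥ * m *_) (sym d≡)))))) (≋-*0 (length Rᵥ * m) d)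
            where
            shuffle : ∀ q r m S → q * r * (m * S) ≡ r * m * (q * S)
            shuffle = solve-∀

          E₀-length : length E₀ ≋ j * S [ d ]
          E₀-length = ≋-trans (≋-reflexive (length-++ D₁)) (≋-trans (≋-+ D₁-length
            (≋-reflexive (trans (length-rep j γ) (cong (j *_) γ-length)))) ≋-refl)

          E₀≋0 : length E₀ ≋ 0 [ S ]
          E₀≋0 = ≋-trans (≋-factor (suc q) S (subst (length E₀ ≋ j * S [_]) d≡ E₀-length)) (≋-*0 j S)

          Rᵥ-≤ : ∀ b → occ b (enr S 0 Rᵥ) ≤ occ b (enr S 0 (E₀ ++ Rᵤ))
          Rᵥ-≤ b = ≮⇒≥ (λ l → absurd l (occ-at⁻ (enr S 0 Rᵥ) (≤-trans (s≤s z≤n) l)))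
            where
            split : ∀ b → occ b (enr S 0 (E₀ ++ Rᵤ)) ≡ occ b (enr S 0 E₀) + occ b (enr S 0 Rᵤ)
            split b = trans (cong (occ b) (trans (enr-++ 0 E₀ Rᵤ) (cong (enr S 0 E₀ ++_) (enr-≋ Rᵤ E₀≋0)))) (occ-++ b (enr S 0 E₀) _)
            many : ∀ b k → 0 < occ b (enr S 0 β) → k ≤ occ b (enr S 0 (rep k β))
            many b zero    l = z≤n
            many b (suc k) l = ≤-trans (+-mono-≤ l (many b k l)) (≤-reflexive (sym
              (trans (cong (occ b) (trans (enr-++ 0 β (rep k β)) (cong (enr S 0 β ++_) (enr-≋ (rep k β) β≋0)))) (occ-++ b (enr S 0 β) _))))
            absurd : occ b (enr S 0 (E₀ ++ Rᵤ)) < occ b (enr S 0 Rᵥ) → ¬ (∃[ i ] At (enr S 0 Rᵥ) i b)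
            absurd l (i , p) with at-enr⁻ 0 p
            ... | a , _ , refl = clash (T ≤? occ (a , i % S) U)
              where
              clash : Dec (Big a i) → _
              clash (no ¬p) = <⇒≱ l (≤-trans (≤-reflexive (sym (small-R a i ¬p)))
                (≤-trans (m≤n+m _ _) (≤-reflexive (sym (split (a , i % S))))))
              clash (yes p) = let t , at-t , e = β-has p in <⇒≱ l
                (≤-trans (count-≤-length _ (enr S 0 Rᵥ)) (≤-trans (≤-reflexive (length-enr 0 Rᵥ))
                  (≤-trans (m≤m+n (length Rᵥ) (q * length Rᵥ))
                  (≤-trans (many (a , i % S) (suc q * length Rᵥ)
                     (occ-at (at-cast refl (cong (a ,_) (≋⇒% e)) (at-enr 0 at-t))))
                  (≤-trans (≤-trans (m≤m+n _ _) (≤-reflexive (sym (trans (cong (occ (a , i % S)) (enr-++ 0 D₁ D₂)) (occ-++ (a , i % S) (enr S 0 D₁) _)))))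
                    (≤-trans (m≤m+n _ _) (≤-reflexive (sym (split (a , i % S))))))))))

          module Exchange (E : Word m) (eₑ : E₀ ++ Rᵤ ~ Rᵥ ++ E) (sₑ : Same sat 0 (E₀ ++ Rᵤ) (Rᵥ ++ E)) where

            -- The rare letters have the same counts in `Rᵤ` and `Rᵥ`, and the filling has none of
            -- them; after `Rᵥ` has been pulled out, none remains.
            E-big : AllBig (length Rᵥ) E
            E-big {t} {a} p = go (T ≤? occ (a , (length Rᵥ + t) % S) U)
              where
              r = length Rᵥ + t
              b = a , r % S
              go : Dec (Big a r) → Big a r
              go (yes p) = p
              go (no ¬p) = contradiction (subst (0 <_) none (occ-at (at-enr (length Rᵥ) p))) (<-irrefl refl)
                where
                none : occ b (enr S (length Rᵥ) E) ≡ 0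
                none = +-cancelˡ-≡ (occ b (enr S 0 Rᵥ)) _ _ (trans (sym (occ-++ b (enr S 0 Rᵥ) _))
                  (trans (cong (occ b) (sym (enr-++ 0 Rᵥ E))) (trans (sym (proj₂ sₑ b))
                  (trans (cong (occ b) (trans (enr-++ 0 E₀ Rᵤ) (cong (enr S 0 E₀ ++_) (enr-≋ Rᵤ E₀≋0))))
                  (trans (occ-++ b (enr S 0 E₀) _) (trans (cong₂ _+_ (occ-none {0} {a} {r} E₀ E₀-big ¬p) (small-R a r ¬p))
                    (sym (+-identityʳ _))))))))

            E≋0 : length E ≋ 0 [ d ]
            E≋0 = ≋-cancelˡ (length Rᵥ) (≋-trans (≋-reflexive (trans (sym (length-++ Rᵥ)) (trans (sym (proj₁ sₑ)) (length-++ E₀))))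
              (≋-trans (≋-+ E₀-length (≋-refl {length Rᵤ})) (≋-trans (≋-reflexive (+-comm (j * S) (length Rᵤ)))
                (≋-trans (≋-sym (subst (length Rᵥ ≋ length Rᵤ + j * S [_]) (sym d≡) lift)) (≋-reflexive (sym (+-identityʳ (length Rᵥ))))))))

            module Loop (x k : ℕ) (x≤c : x ≤ suc c) (loop : rep x β ++ rep (suc k) β ~ rep x β) where

              P z P₂ : Word m
              P = rep x β
              z = rep (suc k) β
              P₂ = rep (suc c ∸ x) β

              W≡ : W ≡ P ++ P₂
              W≡ = trans (cong (λ t → rep t β) (sym (m+[n∸m]≡n x≤c))) (rep-+ x (suc c ∸ x) β)

              P≋0 : length P ≋ 0 [ S ]
              P≋0 = rep≋0 x

              z>0 : 0 < length z
              z>0 = >0-++ˡ β (rep k β) (subst (0 <_) (sym β-length) (*-mono-≤ m>0 (>-nonZero⁻¹ S)))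

              looped = loopʳ {P} {z} z>0 loop
              h : Word m
              h = z ++ proj₁ looped
              lh : length h ≋ s [ d ]
              lh = proj₁ (proj₂ looped)
              fix : P ++ h ~ P
              fix = proj₂ (proj₂ looped)

              big-cover : ∀ {o o′ X} → AllBig o′ X → o ≋ o′ [ s ] → Cover s o X (length P) h
              big-cover {o} {o′} f e {t} p with β-has (f p)
              ... | t′ , at-t′ , e′ = t′ , at-++ˡ (at-++ˡ at-t′) ,
                ≋-trans (≋-+ e (≋-refl {t})) (≋-sym (≋-trans (≋-+ (≋-S P≋0) (≋-refl {t′})) (≋-S e′)))

              -- Both `A` and `B` are covered by the loop, so only letters which it supplies in
              -- abundance can change their counts; equal lengths modulo d keep the labels of `R`.
              absorb-between : ∀ Y A B R → Cover s (length P + length Y) A (length P) h →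
                               Cover s (length P + length Y) B (length P) h → length A ≋ length B [ d ] →
                               P ++ Y ++ A ++ R ~ P ++ Y ++ B ++ R
              absorb-between Y A B R cA cB l = absorb sat fix lh (Y ++ A ++ R) (Y ++ B ++ R)
                (subst₂ (λ a b → a ≋ b [ d ]) (sym (length-++³ Y A R)) (sym (length-++³ Y B R))
                  (≋-+ (≋-refl {length Y}) (≋-+ l (≋-refl {length R}))))
                (λ a r → cond a r (0 <? occ (a , r % d) (enr d o A)) (0 <? occ (a , r % d) (enr d o B)))
                where
                o = length P + length Y
                parts : ∀ b X → occ b (enr d (length P) (Y ++ X ++ R)) ≡
                        occ b (enr d (length P) Y) + (occ b (enr d o X) + occ b (enr d (o + length X) R))
                parts b X = trans (cong (occ b) (trans (enr-++ (length P) Y (X ++ R)) (cong (enr d (length P) Y ++_) (enr-++ o X R))))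
                  (trans (occ-++ b (enr d (length P) Y) _) (cong (occ b (enr d (length P) Y) +_) (occ-++ b (enr d o X) _)))
                found : ∀ {a r X} → Cover s o X (length P) h → 0 < occ (a , r % d) (enr d o X) →
                        ∃[ t ] At h t a × length P + t ≋ r [ s ]
                found {a} {r} {X} cov l = locate (occ-at⁻ (enr d o X) l)
                  where
                  locate : ∃[ i ] At (enr d o X) i (a , r % d) → ∃[ t ] At h t a × length P + t ≋ r [ s ]
                  locate (i , p) with at-enr⁻ o p
                  ... | _ , p′ , e with cong proj₁ e
                  ...   | refl = let t , at-t , f = cov p′ in
                    t , at-t , ≋-trans (≋-sym f) (≋-s (≋-sym (%⇒≋ (cong proj₂ e))))
                cond : ∀ a r → Dec (0 < occ (a , r % d) (enr d o A)) → Dec (0 < occ (a , r % d) (enr d o B)) →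
                       occ (a , r % d) (enr d (length P) (Y ++ A ++ R)) ≡ occ (a , r % d) (enr d (length P) (Y ++ B ++ R)) ⊎
                       ∃[ t ] At h t a × length P + t ≋ r [ s ]
                cond a r (yes l) _       = inj₂ (found cA l)
                cond a r _       (yes l) = inj₂ (found cB l)
                cond a r (no ¬l) (no ¬l′) = inj₁ (trans (parts b A) (trans (cong (occ b (enr d (length P) Y) +_)
                    (cong₂ _+_ (trans (n≤0⇒n≡0 (≮⇒≥ ¬l)) (sym (n≤0⇒n≡0 (≮⇒≥ ¬l′))))
                               (cong (occ b) (enr-≋ R (≋-+ (≋-refl {o}) l))))) (sym (parts b B))))
                  where b = a , r % d

              u~v : u ~ v
              -- The filling is created with the help of the loop, `Rᵥ` is pulled out of filling and
              -- `Rᵤ`, and the loop absorbs the remainder `E`.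
              u~v = ~-trans (eᵤ) (~-trans (~-reflexive (trans (cong (_++ Rᵤ) W≡) (++-assoc P P₂ Rᵤ)))
                (~-trans insert-E₀ (~-trans (~-++ˡ P (~-++ˡ P₂ (eₑ)))
                (~-trans remove-E (~-trans (~-reflexive (sym (trans (cong (_++ Rᵥ) W≡) (++-assoc P P₂ Rᵥ))))
                  (~-sym (eᵥ)))))))
                where
                hs : Word m
                -- Twice `j` copies of length `s` have the length of `E₀` modulo d; they are traded
                -- for it.
                hs = rep (j * 2) h
                hs-length : length hs ≋ j * S [ d ]
                hs-length = ≋-trans (≋-reflexive (length-rep (j * 2) h)) (≋-trans (≋-* (j * 2) lh) (≋-reflexive (*-assoc j 2 s)))
                h≋0 : length h ≋ 0 [ s ]
                h≋0 = ≋-trans (≋-s lh) s≋0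
                hs≋0 : length hs ≋ 0 [ s ]
                hs≋0 = ≋-trans (≋-s hs-length) (≋-trans (≋-reflexive (sym (*-assoc j 2 s))) (≋-*0 (j * 2) s))
                P+0 : length P + 0 ≋ length P [ s ]
                P+0 = ≋-reflexive (+-identityʳ (length P))
                P₂≋0 : length P₂ ≋ 0 [ s ]
                P₂≋0 = ≋-S (rep≋0 (suc c ∸ x))
                insert-E₀ : P ++ P₂ ++ Rᵤ ~ P ++ P₂ ++ E₀ ++ Rᵤ
                insert-E₀ = ~-trans (~-++ʳ (P₂ ++ Rᵤ) (~-sym (rep-fixʳ (j * 2) fix)))
                  (~-trans (~-reflexive (lemma P hs P₂ Rᵤ))
                  (~-trans (absorb-between [] (hs ++ P₂) (P₂ ++ E₀) Rᵤ
                    (cover-≋ {o₂′ = length P} P+0 ≋-refl (cover-++ {o = length P} {u = hs} (cover-rep {o = length P} (j * 2) h≋0)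
                      (big-cover (rep-big (suc c ∸ x)) (≋-+ (≋-S P≋0) hs≋0))))
                    (big-cover (allBig-++ {0} P₂ (rep-big (suc c ∸ x)) (allBig-≋ (≋-sym (rep≋0 (suc c ∸ x))) E₀-big))
                      (≋-trans P+0 (≋-S P≋0)))
                    (≋-trans (≋-reflexive (trans (length-++ hs) (+-comm (length hs) (length P₂))))
                      (≋-trans (≋-+ (≋-refl {length P₂}) (≋-trans hs-length (≋-sym E₀-length))) (≋-reflexive (sym (length-++ P₂))))))
                    (~-reflexive (cong (P ++_) (++-assoc P₂ E₀ Rᵤ)))))
                  where
                  lemma : (a b c d : Word m) → (a ++ b) ++ c ++ d ≡ a ++ [] ++ (b ++ c) ++ d
                  lemma a b c d = solve (++-monoid (Fin m))
                remove-E : P ++ P₂ ++ Rᵥ ++ E ~ P ++ P₂ ++ Rᵥ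
                remove-E = ~-cast (cong (P ++_) (trans (cong ((P₂ ++ Rᵥ) ++_) (++-identityʳ E)) (++-assoc P₂ Rᵥ E)))
                                  (cong (P ++_) (++-identityʳ (P₂ ++ Rᵥ)))
                  (absorb-between (P₂ ++ Rᵥ) E [] []
                    (big-cover {length P + length (P₂ ++ Rᵥ)} {length Rᵥ} E-big (≋-trans (≋-+ (≋-S P≋0)
                       (≋-trans (≋-reflexive (length-++ P₂)) (≋-+ P₂≋0 (≋-refl {length Rᵥ})))) ≋-refl))
                    (λ ()) E≋0)

      large-case : u ~ v
      -- Two of the powers 0 to `c` of β have the same representative; the copies of β between them
      -- form a loop.
      large-case with FinP.pigeonhole (n<1+n c) prefix
      ... | i , j , i<j , e = from-pull (pull sat 0 W u (W-≤ u (λ a r p → p))) (pull sat 0 W v (W-≤ v big-v))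
        where
        k = toℕ j ∸ suc (toℕ i)
        j≡ : toℕ i + suc k ≡ toℕ j
        j≡ = trans (+-suc (toℕ i) k) (m+[n∸m]≡n i<j)
        represented : ∀ w → List.lookup reps (Any.index (reps-complete w)) ~ w
        represented w = AnyP.lookup-index (reps-complete w)
        loop : rep (toℕ i) β ++ rep (suc k) β ~ rep (toℕ i) β
        loop = ~-trans (~-reflexive (trans (sym (rep-+ (toℕ i) (suc k) β)) (cong (λ t → rep t β) j≡)))
          (~-trans (~-sym (represented (rep (toℕ j) β)))
            (~-trans (~-reflexive (cong (List.lookup reps) (sym e))) (represented (rep (toℕ i) β))))
        from-pull : ∃[ Rᵤ ] u ~ W ++ Rᵤ × Same sat 0 u (W ++ Rᵤ) → ∃[ Rᵥ ] v ~ W ++ Rᵥ × Same sat 0 v (W ++ Rᵥ) → u ~ v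
        from-pull (Rᵤ , eᵤ , sᵤ) (Rᵥ , eᵥ , sᵥ) = from-lift (≋-lift q S R≋)
          where
          open Remainders Rᵤ Rᵥ eᵤ sᵤ eᵥ sᵥ
          from-lift : ∃[ l ] length Rᵥ ≋ length Rᵤ + l * S [ suc q * S ] → u ~ v
          from-lift (l , lift) = from-E (pull sat 0 Rᵥ (E₀ ++ Rᵤ) Rᵥ-≤)
            where
            open Padding l lift
            from-E : ∃[ E ] E₀ ++ Rᵤ ~ Rᵥ ++ E × Same sat 0 (E₀ ++ Rᵤ) (Rᵥ ++ E) → u ~ v
            from-E (E , eₑ , sₑ) = Exchange.Loop.u~v E eₑ sₑ (toℕ i) k (<⇒≤ (FinP.toℕ<n i)) loop

    counts-saturated : ∀ u v → CEq Θ S u v → u ~ v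
    counts-saturated u v e with length u <? Θ
    ... | yes l = small-case u v e l
    ... | no ¬l = Large.large-case u v e (≮⇒≥ ¬l)

-- Formulas without order

infixr 5 _▸_

_▸_ : ∀ {A : Set} {k} → A → (Fin k → A) → Fin (suc k) → A
(x ▸ f) zero    = x
(x ▸ f) (suc i) = f i

-- Enumerating the occurrences turns comparisons of counts into injections between finite sets.
nth : ∀ {m} (b : Letter m) xs → Fin (occ b xs) → ℕ
nth b (x ∷ xs) i with b ≟ˡ x
nth b (x ∷ xs) zero    | yes _ = zero
nth b (x ∷ xs) (suc i) | yes _ = suc (nth b xs i)
nth b (x ∷ xs) i       | no _  = suc (nth b xs i)

nth-at : ∀ {m} (b : Letter m) xs i → At xs (nth b xs i) b
nth-at b (x ∷ xs) i with b ≟ˡ x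
nth-at b (x ∷ xs) zero    | yes refl = first
nth-at b (x ∷ xs) (suc i) | yes _    = next (nth-at b xs i)
nth-at b (x ∷ xs) i       | no _     = next (nth-at b xs i)

nth-injective : ∀ {m} (b : Letter m) xs {i j} → nth b xs i ≡ nth b xs j → i ≡ j
nth-injective b (x ∷ xs) {i} {j} e with b ≟ˡ x
nth-injective b (x ∷ xs) {zero}  {zero}  e | yes _ = refl
nth-injective b (x ∷ xs) {suc i} {suc j} e | yes _ = cong suc (nth-injective b xs (suc-injective e))
nth-injective b (x ∷ xs) {i}     {j}     e | no _  = nth-injective b xs (suc-injective e)

nth-surjective : ∀ {m} {b : Letter m} {xs k} → At xs k b → ∃[ i ] nth b xs i ≡ k
nth-surjective {b = b} {x ∷ xs} p with b ≟ˡ x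
nth-surjective first    | yes _ = zero , refl
nth-surjective (next p) | yes _ = let i , e = nth-surjective p in suc i , cong suc e
nth-surjective first    | no ¬p = contradiction refl ¬p
nth-surjective (next p) | no _  = let i , e = nth-surjective p in i , cong suc e

occ-≤ : ∀ {m k} {b : Letter m} {xs} (g : Fin k → ℕ) → (∀ {i} → At xs i b → ∃[ j ] g j ≡ i) → occ b xs ≤ k
occ-≤ {b = b} {xs} g f = FinP.injective⇒≤ {f = λ i → proj₁ (f (nth-at b xs i))}
  (λ {i} {j} e → nth-injective b xs (trans (sym (proj₂ (f (nth-at b xs i))))
                   (trans (cong g e) (proj₂ (f (nth-at b xs j))))))

≤-occ : ∀ {m k} {b : Letter m} {xs} (g : Fin k → ℕ) → (∀ {i j} → g i ≡ g j → i ≡ j) → (∀ i → At xs (g i) b) → k ≤ occ b xs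
≤-occ {b = b} {xs} g inj at-g = FinP.injective⇒≤ {f = λ i → proj₁ (nth-surjective (at-g i))}
  (λ {i} {j} e → inj (trans (sym (proj₂ (nth-surjective (at-g i))))
                       (trans (cong (nth b xs) e) (proj₂ (nth-surjective (at-g j))))))

module _ {m n d : ℕ} .{{d≢0 : NonZero d}} where

  -- The counts do not change during play, so no number of rounds appears; the threshold has to
  -- exceed only the number `n` of variables.
  record State₌ (Γ : Subset n) (w : Word m) (ρ : Assignment (length w) Γ)
                (w′ : Word m) (ρ′ : Assignment (length w′) Γ) : Set where
    constructor state₌
    field
      sizes  : length w ≋ length w′ [ d ]
      counts : ∀ b → (∃[ i ] At (enr d 0 w) i b) ⊎ (∃[ i ] At (enr d 0 w′) i b) →
               occ b (enr d 0 w) ≡ occ b (enr d 0 w′) ⊎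
               (suc n ≤ occ b (enr d 0 w) × suc n ≤ occ b (enr d 0 w′))
      colors : ∀ x → Col (enr d 0 w) (toℕ (ρ x)) (enr d 0 w′) (toℕ (ρ′ x))
      equals : ∀ x y → ρ x ≡ ρ y ⇌ ρ′ x ≡ ρ′ y

  state₌-sym : ∀ {Γ w ρ w′ ρ′} → State₌ Γ w ρ w′ ρ′ → State₌ Γ w′ ρ′ w ρ
  state₌-sym (state₌ l c k e) = state₌ (≋-sym l) (λ b ex → flip (c b ([ inj₂ , inj₁ ]′ ex)))
    (λ x → proj₂ (k x) , proj₁ (k x)) (λ x y → proj₂ (e x y) , proj₁ (e x y))
    where
    flip : ∀ {a b : ℕ} → a ≡ b ⊎ (suc n ≤ a × suc n ≤ b) → b ≡ a ⊎ (suc n ≤ b × suc n ≤ a)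
    flip (inj₁ e)       = inj₁ (sym e)
    flip (inj₂ (p , q)) = inj₂ (q , p)

  hit? : ∀ {ℓ} {Γ : Subset n} (ρ : Assignment ℓ Γ) p → Dec (∃[ x ] ρ x ≡ p)
  hit? {Γ = Γ} ρ p = map′ (λ (y , y∈ , e) → (y , y∈) , e) (λ ((y , y∈) , e) → y , y∈ , e)
    (FinP.any? (λ y → at y (y ∈? Γ)))
    where
    at : ∀ y → Dec (y Subset.∈ Γ) → Dec (∃[ y∈ ] ρ (y , y∈) ≡ p)
    at y (no y∉)  = no (λ (y∈ , _) → y∉ y∈)
    at y (yes y∈) with ρ (y , y∈) FinP.≟ p
    ... | yes e = yes (y∈ , e)
    ... | no ¬e = no (λ (z , e) → ¬e (trans (cong (λ t → ρ (y , t)) ([]=-irrelevant y∈ z)) e))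

  Answer₌ : ∀ {Γ : Subset n} (w : Word m) → Assignment (length w) Γ → (w′ : Word m) → Assignment (length w′) Γ → Fin (length w) → Set
  Answer₌ w ρ w′ ρ′ p = Σ[ p′ ∈ Fin (length w′) ]
    Col (enr d 0 w) (toℕ p) (enr d 0 w′) (toℕ p′) × (∀ x → (ρ x ≡ p) ⇌ (ρ′ x ≡ p′))

  col-at : ∀ {w w′ : Word m} {p p′ b} → At (enr d 0 w) p b → At (enr d 0 w′) p′ b → Col (enr d 0 w) p (enr d 0 w′) p′
  col-at q q′ = (λ r → at-cast refl (at-unique q r) q′) , (λ r → at-cast refl (at-unique q′ r) q)

  -- If `p` carries no variable but all occurrences of its labelled letter in `w′` do, then `w′` has
  -- at most `n` of them, while `w` has as many and `p` in addition; this contradicts the counts.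
  answer₌ : ∀ {Γ : Subset n} {w ρ w′ ρ′} → State₌ Γ w ρ w′ ρ′ → ∀ p → Answer₌ w ρ w′ ρ′ p
  answer₌ {Γ} {w} {ρ} {w′} {ρ′} S p = go (hit? ρ p)
    where
    b = lookup w p , toℕ p % d
    at-p : At (enr d 0 w) (toℕ p) b
    at-p = at-enr 0 (at-lookup w p)
    Good : Fin (length w′) → Set
    Good p′ = At (enr d 0 w′) (toℕ p′) b × ¬ (∃[ x ] ρ′ x ≡ p′)
    go : Dec (∃[ x ] ρ x ≡ p) → Answer₌ w ρ w′ ρ′ p
    go (yes (x , refl)) = ρ′ x , State₌.colors S x , (λ y → State₌.equals S y x)
    go (no ¬hit) = search (FinP.any? (λ p′ → At? _≟ˡ_ (enr d 0 w′) (toℕ p′) b ×-dec ¬? (hit? ρ′ p′)))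
      where
      search : Dec (∃ Good) → Answer₌ w ρ w′ ρ′ p
      search (yes (p′ , q , ¬hit′)) = p′ , col-at {w} {w′} at-p q ,
        (λ x → (λ e → contradiction (x , e) ¬hit) , (λ e → contradiction (x , e) ¬hit′))
      search (no none) = impossible (State₌.counts S b (inj₁ (_ , at-p)))
        where
        hit : ∀ {i} → At (enr d 0 w′) i b → Σ[ x ∈ Var Γ ] toℕ (ρ′ x) ≡ i
        hit q with at-enr⁻ 0 q
        ... | _ , r , _ with at-lookup⁻ r
        ...   | p′ , refl , _ with hit? ρ′ p′
        ...     | yes (x , e) = x , cong toℕ e
        ...     | no ¬h       = contradiction (p′ , q , ¬h) none
        var : Fin (occ b (enr d 0 w′)) → Var Γ
        var i = proj₁ (hit (nth-at b (enr d 0 w′) i))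
        var-pos : ∀ i → toℕ (ρ′ (var i)) ≡ nth b (enr d 0 w′) i
        var-pos i = proj₂ (hit (nth-at b (enr d 0 w′) i))
        var-injective : ∀ {i j} → ρ′ (var i) ≡ ρ′ (var j) → i ≡ j
        var-injective {i} {j} e = nth-injective b (enr d 0 w′)
          (trans (sym (var-pos i)) (trans (cong toℕ e) (var-pos j)))
        few : occ b (enr d 0 w′) ≤ n
        few = FinP.injective⇒≤ {f = proj₁ ∘ var} (λ {i} {j} e → var-injective (cong ρ′ (same-var (var i) (var j) e)))
          where
          same-var : ∀ (x y : Var Γ) → proj₁ x ≡ proj₁ y → x ≡ y
          same-var (x , x∈) (.x , x∈′) refl = cong (x ,_) ([]=-irrelevant x∈ x∈′)
        places : Fin (suc (occ b (enr d 0 w′))) → ℕ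
        places zero    = toℕ p
        places (suc i) = toℕ (ρ (var i))
        places-injective : ∀ {i j} → places i ≡ places j → i ≡ j
        places-injective {zero}  {zero}  e = refl
        places-injective {zero}  {suc j} e = contradiction (var j , toℕ-injective (sym e)) ¬hit
        places-injective {suc i} {zero}  e = contradiction (var i , toℕ-injective e) ¬hit
        places-injective {suc i} {suc j} e =
          cong suc (var-injective (proj₁ (State₌.equals S (var i) (var j)) (toℕ-injective e)))
        more : suc (occ b (enr d 0 w′)) ≤ occ b (enr d 0 w)
        more = ≤-occ places places-injective (λ where
          zero    → at-p
          (suc i) → proj₂ (State₌.colors S (var i)) (at-cast (sym (var-pos i)) refl (nth-at b (enr d 0 w′) i)))
        impossible : ∀ {A : Set} → _ ≡ occ b (enr d 0 w′) ⊎ (suc n ≤ occ b (enr d 0 w) × suc n ≤ occ b (enr d 0 w′)) → A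
        impossible (inj₁ e)       = contradiction (≤-trans more (≤-reflexive e)) (<-irrefl refl)
        impossible (inj₂ (_ , l)) = contradiction (≤-trans l few) (<-irrefl refl)

  extend₌ : ∀ {Γ : Subset n} {w ρ w′ ρ′} → State₌ Γ w ρ w′ ρ′ → ∀ x p →
            ∃[ p′ ] State₌ (Γ Subset.∪ ⁅ x ⁆) w (ρ [ x ↦ p ]) w′ (ρ′ [ x ↦ p′ ])
  extend₌ {Γ} {w} {ρ} {w′} {ρ′} S x p =
    let p′ , c , o = answer₌ S p in p′ , state₌ (State₌.sizes S) (State₌.counts S) (colors p′ c) (equals p′ o)
    where
    colors : ∀ p′ → Col (enr d 0 w) (toℕ p) (enr d 0 w′) (toℕ p′) → ∀ z →
             Col (enr d 0 w) (toℕ ((ρ [ x ↦ p ]) z)) (enr d 0 w′) (toℕ ((ρ′ [ x ↦ p′ ]) z))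
    colors p′ c z with source x z
    ... | new e     rewrite e ρ p | e ρ′ p′ = c
    ... | old y _ e rewrite e ρ p | e ρ′ p′ = State₌.colors S y
    equals : ∀ p′ → (∀ x → (ρ x ≡ p) ⇌ (ρ′ x ≡ p′)) → ∀ y z →
             ((ρ [ x ↦ p ]) y ≡ (ρ [ x ↦ p ]) z) ⇌ ((ρ′ [ x ↦ p′ ]) y ≡ (ρ′ [ x ↦ p′ ]) z)
    equals p′ o y z with source x y | source x z
    ... | new e     | new f     rewrite e ρ p | e ρ′ p′ | f ρ p | f ρ′ p′ = (λ _ → refl) , (λ _ → refl)
    ... | new e     | old b _ f rewrite e ρ p | e ρ′ p′ | f ρ p | f ρ′ p′ =
          (λ g → sym (proj₁ (o b) (sym g))) , (λ g → sym (proj₂ (o b) (sym g)))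
    ... | old a _ e | new f     rewrite e ρ p | e ρ′ p′ | f ρ p | f ρ′ p′ = o a
    ... | old a _ e | old b _ f rewrite e ρ p | e ρ′ p′ | f ρ p | f ρ′ p′ = State₌.equals S a b

  pres₌ : ∀ {σ Γ} → ¬ (lt ∈ σ) → (φ : Formula m σ Γ) → ∀ {w ρ w′ ρ′} → modulus φ ∣ d →
          State₌ Γ w ρ w′ ρ′ → w , ρ ⊨ φ → w′ , ρ′ ⊨ φ
  pres₌ no-lt (num lt lt∈ xs) _ S p = contradiction lt∈ no-lt
  pres₌ no-lt (num eq _ (x ∷ y ∷ [])) _ S p = proj₁ (State₌.equals S x y) p
  pres₌ no-lt (num (MOD e i) _ (x ∷ [])) {w} {ρ} {w′} {ρ′} e∣ S p =
    trans (sym (≋⇒% {{FinP.nonZeroIndex i}} (≋-∣ e∣ (%⇒≋ (cong proj₂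
      (at-unique (proj₁ (State₌.colors S x) (at-enr 0 (at-lookup w (ρ x)))) (at-enr 0 (at-lookup w′ (ρ′ x))))))))) p
  pres₌ no-lt (num (D e i) _ []) e∣ S p = trans (sym (≋⇒% {{FinP.nonZeroIndex i}} (≋-∣ e∣ (State₌.sizes S)))) p
  pres₌ no-lt (letter a x) {w} {ρ} {w′} {ρ′} _ S p = trans (sym (cong proj₁
      (at-unique (proj₁ (State₌.colors S x) (at-enr {d = d} 0 (at-lookup w (ρ x)))) (at-enr 0 (at-lookup w′ (ρ′ x)))))) p
  pres₌ no-lt (neg φ) e∣ S ¬p p = ¬p (pres₌ no-lt φ e∣ (state₌-sym S) p)
  pres₌ no-lt (and φ ψ) e∣ S (p , q) =
    pres₌ no-lt φ (∣-trans (m∣m*n _) e∣) S p , pres₌ no-lt ψ (∣-trans (n∣m*n (modulus φ)) e∣) S q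
  pres₌ no-lt (or φ ψ) e∣ S (inj₁ p) = inj₁ (pres₌ no-lt φ (∣-trans (m∣m*n _) e∣) S p)
  pres₌ no-lt (or φ ψ) e∣ S (inj₂ q) = inj₂ (pres₌ no-lt ψ (∣-trans (n∣m*n (modulus φ)) e∣) S q)
  pres₌ no-lt (quant ∃ᶠ x φ) e∣ S (p , sat) =
    let p′ , S′ = extend₌ S x p in p′ , pres₌ no-lt φ e∣ S′ sat
  pres₌ no-lt (quant ∀ᶠ x φ) e∣ S sat p′ =
    let p , S′ = extend₌ (state₌-sym S) x p′ in pres₌ no-lt φ e∣ (state₌-sym S′) (sat p)

  sentence-preserves₌ : ∀ {σ} → ¬ (lt ∈ σ) → (φ : Sentence m σ n) → ∀ {u v} → modulus φ ∣ d →
                        CEq (suc n) d u v → ⟦ φ ⟧ u → ⟦ φ ⟧ v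
  sentence-preserves₌ no-lt φ {u} {v} e∣ (ceq l c) = pres₌ no-lt φ e∣
    (state₌ l counts (λ (_ , x∈⊥) → contradiction x∈⊥ ∉⊥) (λ (_ , x∈⊥) → contradiction x∈⊥ ∉⊥))
    where
    counts : ∀ b → (∃[ i ] At (enr d 0 u) i b) ⊎ (∃[ i ] At (enr d 0 v) i b) → _
    counts _ (inj₁ (i , p)) with at-enr⁻ 0 p
    ... | a , _ , refl = c a i
    counts _ (inj₂ (i , p)) with at-enr⁻ 0 p
    ... | a , _ , refl = c a i

module Counting {m : ℕ} {σ : Signature} (d : ℕ) .{{d≢0 : NonZero d}} (D∈σ : ∀ i → D d i ∈ σ)
                (MOD∈σ : ∀ i → MOD d i ∈ σ) (eq∈σ : eq ∈ σ) (N : ℕ) where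

  open Propositional {m} {σ} d D∈σ

  Colored : Letter m → ∀ w → Fin (length w) → Set
  Colored (a , r) w p = lookup w p ≡ a × _%_ (toℕ p) d {{d≢0}} ≡ _%_ r d {{d≢0}}

  Further : Letter m → (w : Word m) → ℕ → ∀ {k} → (Fin k → Fin (length w)) → Set
  Further b w zero    g = ⊤
  Further b w (suc t) g = ∃[ p ] Colored b w p × (∀ i → p ≢ g i) × Further b w t (p ▸ g)

  variable-no : ∀ {t} → suc t ≤ N → Fin N
  variable-no l = fromℕ< l

  -- The variables are taken in decreasing order, so the quantifiers that follow do not overwrite
  -- those of `xs`, whose numbers are larger.
  furtherᶠ : Letter m → ∀ t → t ≤ N → ∀ {k} {Γ : Subset N} → (Fin k → Var Γ) → Formula m σ Γ
  furtherᶠ b       zero    _   xs = trueᶠ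
  furtherᶠ (a , r) (suc t) t<N {k} {Γ} xs = quant ∃ᶠ x
    (and (and (letter a (bound x)) (num (MOD d (residue r)) (MOD∈σ _) (bound x ∷ [])))
    (and (⋀ (λ i → neg (num eq eq∈σ (bound x ∷ kept x (xs i) ∷ []))))
         (furtherᶠ (a , r) t (<⇒≤ t<N) {suc k} (bound x ▸ (kept x ∘ xs)))))
    where
    x : Fin N
    x = variable-no t<N

  further-cong : ∀ b w t {k} {g g′ : Fin k → Fin (length w)} → (∀ i → g i ≡ g′ i) → Further b w t g → Further b w t g′
  further-cong b w zero    e f = tt
  further-cong b w (suc t) e (p , c , ≢g , f) = p , c , (λ i q → ≢g i (trans q (sym (e i)))) ,
    further-cong b w t (λ { zero → refl ; (suc i) → e i }) f

  further⇌ : ∀ b t (t≤N : t ≤ N) w {k} {Γ : Subset N} (xs : Fin k → Var Γ) ρ →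
             (∀ i → t ≤ toℕ (proj₁ (xs i))) →
             (w , ρ ⊨ furtherᶠ b t t≤N xs) ⇌ Further b w t (ρ ∘ xs)
  further⇌ b       zero    t≤N w xs ρ used = (λ _ → tt) , (λ _ → true-⊨ w ρ)
  further⇌ (a , r) (suc t) t<N w {k} {Γ} xs ρ used = to , from
    where
    x = variable-no t<N
    xs′ : Fin (suc k) → Var (Γ Subset.∪ ⁅ x ⁆)
    xs′ = bound x ▸ (kept x ∘ xs)
    x-no : toℕ x ≡ t
    x-no = toℕ-fromℕ< t<N
    val : ∀ p → (ρ [ x ↦ p ]) (bound x) ≡ p
    val p = update-new ρ p (proj₂ (bound {Γ = Γ} x)) refl
    keep : ∀ p i → (ρ [ x ↦ p ]) (kept x (xs i)) ≡ ρ (xs i)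
    keep p i = update-old ρ p (proj₂ (kept {Γ = Γ} x (xs i)))
      (λ e → <-irrefl (sym (trans (cong toℕ e) x-no)) (used i)) (proj₂ (xs i))
    rec : ∀ p → (w , (ρ [ x ↦ p ]) ⊨ furtherᶠ (a , r) t (<⇒≤ t<N) xs′) ⇌ Further (a , r) w t ((ρ [ x ↦ p ]) ∘ xs′)
    rec p = further⇌ (a , r) t (<⇒≤ t<N) w xs′ (ρ [ x ↦ p ])
      (λ { zero → ≤-reflexive (sym x-no) ; (suc i) → <⇒≤ (used i) })
    vals : ∀ p i → ((ρ [ x ↦ p ]) ∘ xs′) i ≡ (p ▸ (ρ ∘ xs)) i
    vals p zero    = val p
    vals p (suc i) = keep p i
    F : ∀ {k} → (Fin k → Var Γ) → Fin k → Formula m σ (Γ Subset.∪ ⁅ x ⁆)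
    F xs i = neg (num eq eq∈σ (bound x ∷ kept x (xs i) ∷ []))
    to : w , ρ ⊨ furtherᶠ (a , r) (suc t) t<N xs → Further (a , r) w (suc t) (ρ ∘ xs)
    to (p , (c , c′) , ds , f) = p ,
      (trans (cong (lookup w) (sym (val p))) c ,
       subst (λ z → _%_ (toℕ z) d {{d≢0}} ≡ _%_ r d {{d≢0}}) (val p) (proj₁ (residue⇌ (toℕ ((ρ [ x ↦ p ]) (bound x))) r) c′)) ,
      (λ i e → proj₁ (⋀⇌ w (ρ [ x ↦ p ]) (F xs)) ds i (trans (val p) (trans e (sym (keep p i))))) ,
      further-cong (a , r) w t (vals p) (proj₁ (rec p) f)
    from : Further (a , r) w (suc t) (ρ ∘ xs) → w , ρ ⊨ furtherᶠ (a , r) (suc t) t<N xs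
    from (p , (c , c′) , ds , f) = p ,
      (trans (cong (lookup w) (val p)) c ,
       proj₂ (residue⇌ (toℕ ((ρ [ x ↦ p ]) (bound x))) r)
         (subst (λ z → _%_ (toℕ z) d {{d≢0}} ≡ _%_ r d {{d≢0}}) (sym (val p)) c′)) ,
      proj₂ (⋀⇌ w (ρ [ x ↦ p ]) (F xs)) (λ i e → ds i (trans (sym (val p)) (trans e (keep p i)))) ,
      proj₂ (rec p) (further-cong (a , r) w t (λ i → sym (vals p i)) f)

  module _ (a : Fin m) (r : ℕ) (w : Word m) where

    b : Letter m
    b = a , _%_ r d {{d≢0}}

    W : List (Letter m)
    W = enr d 0 w

    colored⇒at : ∀ {p} → Colored (a , r) w p → At W (toℕ p) b
    colored⇒at {p} (e , f) = at-cast refl (cong₂ _,_ e f) (at-enr 0 (at-lookup w p))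

    at⇒colored : ∀ {i} → At W i b → ∃[ p ] toℕ p ≡ i × Colored (a , r) w p
    at⇒colored q with at-enr⁻ 0 q
    ... | _ , q′ , e with at-lookup⁻ q′
    ...   | p , refl , f = p , refl , trans f (sym (cong proj₁ e)) , sym (cong proj₂ e)

    further⇒≤ : ∀ t {k} (g : Fin k → Fin (length w)) → (∀ {i j} → g i ≡ g j → i ≡ j) → (∀ i → Colored (a , r) w (g i)) →
                Further (a , r) w t g → t + k ≤ occ b W
    further⇒≤ zero    g inj col f = ≤-occ (toℕ ∘ g) (inj ∘ toℕ-injective) (colored⇒at ∘ col)
    further⇒≤ (suc t) {k} g inj col (p , c , ≢g , f) = ≤-trans (≤-reflexive (sym (+-suc t k)))
      (further⇒≤ t _ (λ {i} {j} → inj′ i j) (λ { zero → c ; (suc i) → col i }) f)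
      where
      g′ : Fin (suc k) → Fin (length w)
      g′ = p ▸ g
      inj′ : ∀ i j → g′ i ≡ g′ j → i ≡ j
      inj′ zero    zero    e = refl
      inj′ zero    (suc j) e = contradiction e (≢g j)
      inj′ (suc i) zero    e = contradiction (sym e) (≢g i)
      inj′ (suc i) (suc j) e = cong suc (inj e)

    ≤⇒further : ∀ t {k} (g : Fin k → Fin (length w)) → t + k ≤ occ b W → Further (a , r) w t g
    ≤⇒further zero    g l = tt
    ≤⇒further (suc t) {k} g l = search (FinP.any? (λ p → At? _≟ˡ_ W (toℕ p) b ×-dec FinP.all? (λ i → ¬? (p FinP.≟ g i))))
      where
      search : Dec (∃[ p ] At W (toℕ p) b × (∀ i → p ≢ g i)) → Further (a , r) w (suc t) g
      search (yes (p , q , ≢g)) = p , found (at⇒colored q) , ≢g ,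
        ≤⇒further t _ (≤-trans (≤-reflexive (+-suc t k)) l)
        where
        found : ∃[ p′ ] toℕ p′ ≡ toℕ p × Colored (a , r) w p′ → Colored (a , r) w p
        found (p′ , e , c) = subst (Colored (a , r) w) (toℕ-injective e) c
      search (no none) = contradiction (≤-trans l (occ-≤ (toℕ ∘ g) cover)) (m+n≮n t k)
        where
        cover : ∀ {i} → At W i b → ∃[ j ] toℕ (g j) ≡ i
        cover q with at⇒colored q
        ... | p , refl , _ with FinP.any? (λ i → p FinP.≟ g i)
        ...   | yes (j , e) = j , cong toℕ (sym e)
        ...   | no ¬p       = contradiction (p , q , (λ i e → ¬p (i , e))) none

  atLeastᶠ : Fin m → ℕ → ∀ t → t ≤ N → Sentence m σ N
  atLeastᶠ a r t t≤N = furtherᶠ (a , r) t t≤N {0} (λ ())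

  atLeast⇌ : ∀ a r t t≤N w → ⟦ atLeastᶠ a r t t≤N ⟧ w ⇌ (t ≤ occ (a , _%_ r d {{d≢0}}) (enr d 0 w))
  atLeast⇌ a r t t≤N w =
    (λ f → subst (_≤ occ (a , _%_ r d {{d≢0}}) (enr d 0 w)) (+-identityʳ t)
             (further⇒≤ a r w t {0} (λ ()) (λ {i} → λ { {()} }) (λ ())
               (further-cong (a , r) w t (λ ()) (proj₁ (further⇌ (a , r) t t≤N w (λ ()) ∅ (λ ())) f)))) ,
    (λ l → proj₂ (further⇌ (a , r) t t≤N w (λ ()) ∅ (λ ()))
             (further-cong (a , r) w t (λ ()) (≤⇒further a r w t {0} (λ ()) (subst (_≤ _) (sym (+-identityʳ t)) l))))

  module Class (u : Word m) where

    occᵤ : Fin m → ℕ → ℕ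
    occᵤ a r = occ (a , _%_ r d {{d≢0}}) (enr d 0 u)

    countᶠ : Fin m → ℕ → Sentence m σ N
    countᶠ a r with N ≤? occᵤ a r
    ... | yes _ = atLeastᶠ a r N ≤-refl
    ... | no ¬l = and (atLeastᶠ a r (occᵤ a r) (<⇒≤ (≰⇒> ¬l))) (neg (atLeastᶠ a r (suc (occᵤ a r)) (≰⇒> ¬l)))

    count⇌ : ∀ a r w → ⟦ countᶠ a r ⟧ w ⇌
             (occᵤ a r ≡ occ (a , _%_ r d {{d≢0}}) (enr d 0 w) ⊎
              (N ≤ occᵤ a r × N ≤ occ (a , _%_ r d {{d≢0}}) (enr d 0 w)))
    count⇌ a r w with N ≤? occᵤ a r
    ... | yes l = (λ f → inj₂ (l , proj₁ (atLeast⇌ a r N ≤-refl w) f)) ,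
                  (λ { (inj₁ e) → proj₂ (atLeast⇌ a r N ≤-refl w) (subst (N ≤_) e l)
                     ; (inj₂ (_ , l′)) → proj₂ (atLeast⇌ a r N ≤-refl w) l′ })
    ... | no ¬l = (λ (f , g) → inj₁ (≤-antisym (proj₁ (atLeast⇌ a r _ _ w) f)
                     (≮⇒≥ (λ l → g (proj₂ (atLeast⇌ a r _ _ w) l))))) ,
                  (λ { (inj₁ e) → proj₂ (atLeast⇌ a r _ _ w) (≤-reflexive e) ,
                                  (λ f → <-irrefl e (proj₁ (atLeast⇌ a r _ _ w) f))
                     ; (inj₂ (l , _)) → contradiction l ¬l })

    countsᶠ : Fin m → Fin d → Sentence m σ N
    countsᶠ a r = countᶠ a (toℕ r)

    classᶠ : Sentence m σ N
    classᶠ = and (lengthᶠ (length u)) (⋀ (λ a → ⋀ (countsᶠ a)))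

    class⇌ : ∀ w → ⟦ classᶠ ⟧ w ⇌ CEq N d {{d≢0}} u w
    class⇌ w =
      (λ (l , f) → ceq (≋-sym (proj₁ (lengthᶠ⇌ {N} {⊥} w ∅ (length u)) l)) (λ a r →
         subst (λ t → occ (a , t) (enr d 0 u) ≡ occ (a , t) (enr d 0 w) ⊎
                      (N ≤ occ (a , t) (enr d 0 u) × N ≤ occ (a , t) (enr d 0 w)))
           (trans (cong (λ t → _%_ t d {{d≢0}}) (residue-toℕ r)) (m%n%n≡m%n r d))
           (proj₁ (count⇌ a (toℕ (residue r)) w)
             (proj₁ (⋀⇌ w ∅ (countsᶠ a)) (proj₁ (⋀⇌ w ∅ (λ a → ⋀ (countsᶠ a))) f a) (residue r))))) ,
      (λ (ceq l c) → proj₂ (lengthᶠ⇌ {N} {⊥} w ∅ (length u)) (≋-sym l) ,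
         proj₂ (⋀⇌ w ∅ (λ a → ⋀ (countsᶠ a))) (λ a → proj₂ (⋀⇌ w ∅ (countsᶠ a)) (λ r →
           proj₂ (count⇌ a (toℕ r) w) (c a (toℕ r)))))

-- Finite index

words : ∀ {m} → ℕ → List (Word m)
words {m} zero    = [] ∷ []
words {m} (suc n) = [] ∷ List.cartesianProductWith _∷_ (List.allFin m) (words n)

words-complete : ∀ {m} n (w : Word m) → length w ≤ n → w ∈ˡ words n
words-complete zero    []      _       = here refl
words-complete (suc n) []      _       = here refl
words-complete (suc n) (a ∷ w) (s≤s l) =
  there (MemP.∈-cartesianProductWith⁺ _∷_ (MemP.∈-allFin a) (words-complete n w l))

module _ {m K : ℕ} (_≈_ : Word m → Word m → Set) (≈-refl : ∀ {u} → u ≈ u)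
         (≈-trans : ∀ {u v w} → u ≈ v → v ≈ w → u ≈ w)
         (≈-++ʳ : ∀ {u v} w → u ≈ v → (u ++ w) ≈ (v ++ w))
         (code : Word m → Fin K) (code⇒≈ : ∀ {u v} → code u ≡ code v → u ≈ v) where

  -- In a word longer than K, two prefixes of length at most K have the same code, and the part
  -- between them can be cut out.
  shorten : ∀ f w → length w ≤ f → ∃[ w′ ] length w′ ≤ K × w′ ≈ w
  shorten f w l with length w ≤? K
  ... | yes l′ = w , l′ , ≈-refl
  shorten zero    w l | no ¬l = contradiction (≤-trans l z≤n) ¬l
  shorten (suc f) w l | no ¬l with FinP.pigeonhole (n<1+n K) (λ i → code (List.take (toℕ i) w))
  ... | i , j , i<j , e =
    let w′ , l′ , w′≈ = shorten f shorter (s≤s⁻¹ (≤-trans shorter-< l)) in w′ , l′ , ≈-trans w′≈ shorter≈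
    where
    u v r shorter : Word m
    u = List.take (toℕ i) w
    v = List.take (toℕ j) w
    r = List.drop (toℕ j) w
    shorter = u ++ r
    vr : v ++ r ≡ w
    vr = ListP.take++drop≡id (toℕ j) w
    shorter≈ : shorter ≈ w
    shorter≈ = subst (shorter ≈_) vr (≈-++ʳ r (code⇒≈ e))
    j≤w : toℕ j ≤ length w
    j≤w = ≤-trans (s≤s⁻¹ (FinP.toℕ<n j)) (<⇒≤ (≰⇒> ¬l))
    u<v : length u < length v
    u<v = subst₂ _<_ (sym (trans (ListP.length-take (toℕ i) w) (m≤n⇒m⊓n≡m (≤-trans (<⇒≤ i<j) j≤w))))
                     (sym (trans (ListP.length-take (toℕ j) w) (m≤n⇒m⊓n≡m j≤w))) i<j
    shorter-< : length shorter < length w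
    shorter-< = subst₂ _<_ (sym (length-++ u)) (trans (sym (length-++ v)) (cong length vr)) (+-monoˡ-< (length r) u<v)

  representatives : ∀ u → Any (_≈ u) (words K)
  representatives u = let w , l , e = shorten (length u) u ≤-refl in
    Any.map (λ { refl → e }) (words-complete K w l)

funToFin-injective : ∀ {a b} {f g : Fin a → Fin b} → funToFin f ≡ funToFin g → ∀ i → f i ≡ g i
funToFin-injective {f = f} {g} e i =
  trans (sym (FinP.finToFun-funToFin f i)) (trans (cong (λ t → finToFun t i) e) (FinP.finToFun-funToFin g i))

bit : ∀ {A : Set} → Dec A → Fin 2
bit (yes _) = zero
bit (no _)  = suc zero

bit-transfer : ∀ {A B : Set} {a : Dec A} {b : Dec B} → bit a ≡ bit b → A → B
bit-transfer {b = yes q} _ _ = q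
bit-transfer {a = no ¬p} {no _} _ p = contradiction p ¬p

side : ℕ → ℕ → Fin 3
side i j with <-cmp i j
... | tri< _ _ _ = zero
... | tri≈ _ _ _ = suc zero
... | tri> _ _ _ = suc (suc zero)

side⇒ord : ∀ {i₁ i j₁ j} → side i₁ i ≡ side j₁ j → Ord i₁ i j₁ j
side⇒ord {i₁} {i} {j₁} {j} e with <-cmp i₁ i | <-cmp j₁ j
... | tri< p _ _    | tri< q _ _    = ord-lt p q
... | tri≈ _ refl _ | tri≈ _ refl _ = ord-eq
... | tri> _ _ p    | tri> _ _ q    = ord-gt p q

module GameCode {m d : ℕ} .{{d≢0 : NonZero d}} where

  size : ℕ → ℕ
  size zero    = suc (m * d)
  size (suc n) = suc (m * d) * 2 ^ (3 * size n)

  posCode : (w : Word m) → ℕ → Fin (suc (m * d))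
  posCode w i with i <? length w
  ... | yes l = suc (combine (lookup w (fromℕ< l)) (fromℕ< (m%n<n i d)))
  ... | no _  = zero

  posCode-col : ∀ {w v i j} → posCode w i ≡ posCode v j → ∀ {b} → At (enr d 0 w) i b → At (enr d 0 v) j b
  posCode-col {w} {v} {i} {j} e p with at-enr⁻ 0 p
  ... | a , p′ , refl with i <? length w
  ...   | no ¬l = contradiction (at-< p′) ¬l
  ...   | yes l with j <? length v
  ...     | yes l′ = at-cast (toℕ-fromℕ< l′) (cong₂ _,_ same-letter same-residue) (at-enr 0 (at-lookup v (fromℕ< l′)))
    where
    parts = FinP.combine-injective _ _ _ _ (FinP.suc-injective e)
    same-letter : lookup v (fromℕ< l′) ≡ a
    same-letter = trans (sym (proj₁ parts))
      (at-unique (at-cast (toℕ-fromℕ< l) refl (at-lookup w (fromℕ< l))) p′)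
    same-residue : toℕ (fromℕ< l′) % d ≡ i % d
    same-residue = trans (cong (_% d) (toℕ-fromℕ< l′))
      (trans (sym (toℕ-fromℕ< (m%n<n j d))) (trans (cong toℕ (sym (proj₂ parts))) (toℕ-fromℕ< (m%n<n i d))))

  -- The type of a position: its label together with the set of types of lower rank to its left, at
  -- it and to its right. The level is ignored, so equal codes yield games of all levels.
  code : ∀ n (w : Word m) → ℕ → Fin (size n)
  code zero    w i = posCode w i
  code (suc n) w i = combine (posCode w i) (funToFin (λ x → bit (FinP.any? {length w} (λ p →
                       combine (side (toℕ p) i) (code n w (toℕ p)) FinP.≟ x))))

  code⇒sim : ∀ n k {w v i j} → code n w i ≡ code n v j → Sim k n (enr d 0 w) i (enr d 0 v) j
  code⇒sim zero    k {w} {v} e = stop (posCode-col {w} {v} e , posCode-col {v} {w} (sym e))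
  code⇒sim (suc n) k {w} {v} {i} {j} e =
    play (posCode-col {w} {v} (proj₁ parts) , posCode-col {v} {w} (sym (proj₁ parts)))
         (λ _ → answer same k) (λ _ → answer (sym ∘ same) (pred k))
    where
    Seen : (w : Word m) → ℕ → Fin (3 * size n) → Set
    Seen w i x = Σ[ p ∈ Fin (length w) ] combine (side (toℕ p) i) (code n w (toℕ p)) ≡ x
    seen? : ∀ w i x → Dec (Seen w i x)
    seen? w i x = FinP.any? {length w} (λ p → combine (side (toℕ p) i) (code n w (toℕ p)) FinP.≟ x)
    parts = FinP.combine-injective (posCode w i) (funToFin (λ x → bit (seen? w i x)))
                                   (posCode v j) (funToFin (λ x → bit (seen? v j x))) e
    same : ∀ x → bit (seen? w i x) ≡ bit (seen? v j x)
    same = funToFin-injective {f = λ x → bit (seen? w i x)} {λ x → bit (seen? v j x)} (proj₂ parts)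
    answer : ∀ {w v i j} → (∀ x → bit (seen? w i x) ≡ bit (seen? v j x)) → ∀ k {i₁ b} → At (enr d 0 w) i₁ b →
             ∃[ j₁ ] Ord i₁ i j₁ j × Sim k n (enr d 0 w) i₁ (enr d 0 v) j₁
    answer {w} {v} {i} {j} same k q with at-enr⁻ 0 q
    ... | _ , q′ , _ with at-lookup⁻ q′
    ...   | p , refl , _ =
      let x = combine (side (toℕ p) i) (code n w (toℕ p))
          p′ , f = bit-transfer {Seen w i x} {Seen v j x} {seen? w i x} {seen? v j x} (same x) (p , refl)
          s , c = FinP.combine-injective _ _ _ _ f
      in toℕ p′ , side⇒ord (sym s) , code⇒sim n k (sym c)

  residueCode : Word m → Fin d
  residueCode w = fromℕ< (m%n<n (length w) d)

  residueCode⇒≋ : ∀ {u v} → residueCode u ≡ residueCode v → length u ≋ length v [ d ]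
  residueCode⇒≋ {u} {v} e = %⇒≋ (trans (sym (toℕ-fromℕ< (m%n<n (length u) d)))
    (trans (cong toℕ e) (toℕ-fromℕ< (m%n<n (length v) d))))

  eqvCode : ∀ n → Word m → Fin (d * size n)
  eqvCode n w = combine (residueCode w) (code n w (length (enr d 0 w)))

  eqvCode⇒eqv : ∀ k n {u v} → eqvCode n u ≡ eqvCode n v → Eqv k n d u v
  eqvCode⇒eqv k n {u} {v} e =
    let e₁ , e₂ = FinP.combine-injective (residueCode u) _ (residueCode v) _ e in
    eqv (residueCode⇒≋ {u} {v} e₁) (code⇒sim n k e₂) (code⇒sim n k (sym e₂))

  ceqCode : ∀ n → Word m → Fin (d * suc n ^ (m * d))
  ceqCode n w = combine (residueCode w) (funToFin (λ x → fromℕ< (s≤s (m⊓n≤n (occ-of x) n))))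
    where
    occ-of : Fin (m * d) → ℕ
    occ-of x = let a , r = Fin.remQuot {m} d x in occ (a , toℕ r) (enr d 0 w)

  ceqCode⇒ceq : ∀ n {u v} → ceqCode n u ≡ ceqCode n v → CEq n d u v
  ceqCode⇒ceq n {u} {v} e = ceq (residueCode⇒≋ {u} {v} (proj₁ parts)) by-residue
    where
    parts = FinP.combine-injective (residueCode u) _ (residueCode v) _ e
    cap : ∀ a r → occ (a , toℕ r) (enr d 0 u) ⊓ n ≡ occ (a , toℕ r) (enr d 0 v) ⊓ n
    cap a r = subst (λ (a , r) → occ (a , toℕ r) (enr d 0 u) ⊓ n ≡ occ (a , toℕ r) (enr d 0 v) ⊓ n)
      (FinP.remQuot-combine {m} {d} a r)
      (trans (sym (toℕ-fromℕ< _)) (trans (cong toℕ (funToFin-injective (proj₂ parts) (combine a r))) (toℕ-fromℕ< _)))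
    thresholds : ∀ x y → x ⊓ n ≡ y ⊓ n → x ≡ y ⊎ (n ≤ x × n ≤ y)
    thresholds x y f with n ≤? x | n ≤? y
    ... | yes p | yes q = inj₂ (p , q)
    ... | yes p | no ¬q = contradiction (≤-trans (≤-reflexive (trans (sym (m≥n⇒m⊓n≡n p)) f)) (m⊓n≤m y n)) ¬q
    ... | no ¬p | yes q = contradiction (≤-trans (≤-reflexive (trans (sym (m≥n⇒m⊓n≡n q)) (sym f))) (m⊓n≤m x n)) ¬p
    ... | no ¬p | no ¬q = inj₁ (trans (sym (m≤n⇒m⊓n≡m (<⇒≤ (≰⇒> ¬p)))) (trans f (m≤n⇒m⊓n≡m (<⇒≤ (≰⇒> ¬q)))))
    by-residue : ∀ a r → occ (a , r % d) (enr d 0 u) ≡ occ (a , r % d) (enr d 0 v) ⊎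
                      (n ≤ occ (a , r % d) (enr d 0 u) × n ≤ occ (a , r % d) (enr d 0 v))
    by-residue a r = subst (λ t → occ (a , t) (enr d 0 u) ≡ occ (a , t) (enr d 0 v) ⊎
                               (n ≤ occ (a , t) (enr d 0 u) × n ≤ occ (a , t) (enr d 0 v)))
      (toℕ-fromℕ< (m%n<n r d)) (thresholds _ _ (cap a (fromℕ< (m%n<n r d))))

occ-raise : ∀ {m d} .{{_ : NonZero d}} (a : Fin m) {o r r′} → o + r′ ≋ r [ d ] → ∀ t u →
            occ (a , r % d) (enr d (o + t) u) ≡ occ (a , r′ % d) (enr d t u)
occ-raise a e t [] = refl
occ-raise {d = d} a {o} {r} {r′} e t (c ∷ u) = trans (occ-∷ (a , r % d) (c , (o + t) % d) _)
  (trans (cong₂ _+_ (one (a FinP.≟ c) (r % d ≟ (o + t) % d)) (trans (cong (λ z → occ (a , r % d) (enr d z u)) (sym (+-suc o t)))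
            (occ-raise a e (suc t) u)))
         (sym (occ-∷ (a , r′ % d) (c , t % d) _)))
  where
  hit : ∀ {m} (b : Letter m) → occ b (b ∷ []) ≡ 1
  hit b with b ≟ˡ b
  ... | yes _ = refl
  ... | no ¬p = contradiction refl ¬p
  miss : ∀ {m} (b c : Letter m) → b ≢ c → occ b (c ∷ []) ≡ 0
  miss b c ≢ with b ≟ˡ c
  ... | yes p = contradiction p ≢
  ... | no _  = refl
  one : Dec (a ≡ c) → Dec (r % d ≡ (o + t) % d) → occ (a , r % d) ((c , (o + t) % d) ∷ []) ≡ occ (a , r′ % d) ((c , t % d) ∷ [])
  one (no ¬p) _ = trans (miss (a , r % d) (c , (o + t) % d) (¬p ∘ cong proj₁))
    (sym (miss (a , r′ % d) (c , t % d) (¬p ∘ cong proj₁)))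
  one (yes refl) (yes p) = trans (trans (cong (λ z → occ (a , r % d) ((a , z) ∷ [])) (sym p)) (hit (a , r % d)))
    (sym (trans (cong (λ z → occ (a , r′ % d) ((a , z) ∷ [])) (sym q)) (hit (a , r′ % d))))
    where
    q : r′ % d ≡ t % d
    q = ≋⇒% (≋-cancelˡ o (≋-trans e (%⇒≋ p)))
  one (yes refl) (no ¬p) = trans (miss (a , r % d) (c , (o + t) % d) (¬p ∘ cong proj₂))
    (sym (miss (a , r′ % d) (c , t % d) (λ q → ¬p (≋⇒% (≋-trans (≋-sym e) (≋-+ (≋-refl {o}) (%⇒≋ (cong proj₂ q))))))))

ceq-++ : ∀ {m n d} .{{_ : NonZero d}} {u u′ : Word m} x y → CEq n d u u′ → CEq n d (x ++ u ++ y) (x ++ u′ ++ y)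
ceq-++ {m} {n} {d} {u} {u′} x y (ceq l c) = ceq
  (subst₂ (λ a b → a ≋ b [ d ]) (sym (length-++³ x u y)) (sym (length-++³ x u′ y))
    (≋-+ (≋-refl {length x}) (≋-+ l (≋-refl {length y}))))
  -- Modulo d the summand `length x * pred d` takes back the shift caused by `x`.
  (λ a r → combined a r (c a (r + length x * pred d)))
  where
  parts : ∀ b u → occ b (enr d 0 (x ++ u ++ y)) ≡
          occ b (enr d 0 x) + (occ b (enr d (length x) u) + occ b (enr d (length x + length u) y))
  parts b u = trans (cong (occ b) (trans (enr-++ 0 x (u ++ y)) (cong (enr d 0 x ++_) (enr-++ (length x) u y))))
    (trans (occ-++ b (enr d 0 x) _) (cong (occ b (enr d 0 x) +_) (occ-++ b (enr d (length x) u) _)))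
  shifted : ∀ r → length x + (r + length x * pred d) ≋ r [ d ]
  shifted r = ≋-trans (≋-reflexive (trans (lemma (length x) r (pred d)) (cong (λ z → r + length x * z) (suc-pred d))))
    (≋-trans (≋-+ (≋-refl {r}) (≋-*0 (length x) d)) (≋-reflexive (+-identityʳ r)))
    where
    lemma : ∀ x r p → x + (r + x * p) ≡ r + x * suc p
    lemma = solve-∀
  raise : ∀ a r u → occ (a , r % d) (enr d (length x) u) ≡ occ (a , (r + length x * pred d) % d) (enr d 0 u)
  raise a r u = trans (cong (λ z → occ (a , r % d) (enr d z u)) (sym (+-identityʳ (length x)))) (occ-raise a (shifted r) 0 u)
  combined : ∀ a r → occ (a , (r + length x * pred d) % d) (enr d 0 u) ≡ occ (a , (r + length x * pred d) % d) (enr d 0 u′) ⊎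
                     (n ≤ occ (a , (r + length x * pred d) % d) (enr d 0 u) × n ≤ occ (a , (r + length x * pred d) % d) (enr d 0 u′)) →
             occ (a , r % d) (enr d 0 (x ++ u ++ y)) ≡ occ (a , r % d) (enr d 0 (x ++ u′ ++ y)) ⊎
             (n ≤ occ (a , r % d) (enr d 0 (x ++ u ++ y)) × n ≤ occ (a , r % d) (enr d 0 (x ++ u′ ++ y)))
  combined a r (inj₁ e) = inj₁ (trans (parts (a , r % d) u) (trans (cong (occ (a , r % d) (enr d 0 x) +_)
    (cong₂ _+_ (trans (raise a r u) (trans e (sym (raise a r u′))))
               (cong (occ (a , r % d)) (enr-≋ y (≋-+ (≋-refl {length x}) l))))) (sym (parts (a , r % d) u′))))
  combined a r (inj₂ (p , q)) = inj₂ (large u p , large u′ q)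
    where
    large : ∀ u → n ≤ occ (a , (r + length x * pred d) % d) (enr d 0 u) → n ≤ occ (a , r % d) (enr d 0 (x ++ u ++ y))
    large u p = ≤-trans p (≤-trans (≤-reflexive (sym (raise a r u)))
      (≤-trans (m≤m+n _ _) (≤-trans (m≤n+m _ (occ (a , r % d) (enr d 0 x))) (≤-reflexive (sym (parts (a , r % d) u))))))

-- Automata and stability

module Automaton {m : ℕ} (M : DFA m) where

  open DFA M

  infix 4 _≈δ_

  record _≈δ_ (u v : Word m) : Set where
    constructor runs
    field run : ∀ q → foldl δ q u ≡ foldl δ q v

  open _≈δ_

  ≈δ-refl : ∀ {u} → u ≈δ u
  ≈δ-refl = runs (λ _ → refl)

  ≈δ-sym : ∀ {u v} → u ≈δ v → v ≈δ u
  ≈δ-sym (runs e) = runs (sym ∘ e)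

  ≈δ-trans : ∀ {u v w} → u ≈δ v → v ≈δ w → u ≈δ w
  ≈δ-trans (runs e) (runs f) = runs (λ q → trans (e q) (f q))

  δ-size : ℕ
  δ-size = states ^ states

  δ-code : Word m → Fin δ-size
  δ-code u = funToFin (λ q → foldl δ q u)

  δ-code⇒≈ : ∀ {u v} → δ-code u ≡ δ-code v → u ≈δ v
  δ-code⇒≈ e = runs (funToFin-injective e)

  ≈δ-++ : ∀ {u u′ v v′} → u ≈δ u′ → v ≈δ v′ → u ++ v ≈δ u′ ++ v′
  ≈δ-++ {u} {u′} {v} {v′} (runs e) (runs f) = runs (λ q → trans (ListP.foldl-++ δ q u v)
    (trans (cong (λ z → foldl δ z v) (e q)) (trans (f (foldl δ q u′)) (sym (ListP.foldl-++ δ q u′ v′)))))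

  ≈δ-++ʳ : ∀ {u v} w → u ≈δ v → u ++ w ≈δ v ++ w
  ≈δ-++ʳ w e = ≈δ-++ e ≈δ-refl

  ≈δ-++ˡ : ∀ w {u v} → u ≈δ v → w ++ u ≈δ w ++ v
  ≈δ-++ˡ w e = ≈δ-++ (≈δ-refl {w}) e

  ≈δ⇒∈ : ∀ {u v} → u ≈δ v → u ∈ language → v ∈ language
  ≈δ⇒∈ (runs e) = subst (Subset._∈ final) (e start)

  language? : ∀ w → Dec (w ∈ language)
  language? w = foldl δ start w ∈? final

  infix 4 _∼_

  _∼_ : Word m → Word m → Set
  u ∼ v = ∀ x y → (x ++ u ++ y) ∈ language ⇌ (x ++ v ++ y) ∈ language

  ≈δ⇒∼ : ∀ {u v} → u ≈δ v → u ∼ v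
  ≈δ⇒∼ e x y = ≈δ⇒∈ (≈δ-++ˡ x (≈δ-++ʳ y e)) , ≈δ⇒∈ (≈δ-++ˡ x (≈δ-++ʳ y (≈δ-sym e)))

  short : List (Word m)
  short = words δ-size

  short-complete : ∀ u → Any (_≈δ u) short
  short-complete = representatives _≈δ_ ≈δ-refl ≈δ-trans ≈δ-++ʳ δ-code δ-code⇒≈

  ∀-short : ∀ {P : Word m → Set} → (∀ {u v} → u ≈δ v → P u → P v) → (∀ u → Dec (P u)) → Dec (∀ u → P u)
  ∀-short {P} resp P? with All.all? P? short
  ... | yes ps = yes (λ u → let r , r∈ , e = Mem.find (short-complete u) in resp e (All.lookup ps r∈))
  ... | no ¬ps = no (λ f → ¬ps (All.universal f short))

  -- A context matters only up to the transformations of the automaton that it induces, so finitely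
  -- many contexts have to be tested.
  _∼?_ : ∀ u v → Dec (u ∼ v)
  u ∼? v = ∀-short {λ x → ∀ y → (x ++ u ++ y) ∈ language ⇌ (x ++ v ++ y) ∈ language}
    (λ e f y → transport (≈δ-++ʳ (u ++ y) e) (≈δ-++ʳ (v ++ y) e) (f y))
    (λ x → ∀-short {λ y → (x ++ u ++ y) ∈ language ⇌ (x ++ v ++ y) ∈ language}
      (λ e → transport (≈δ-++ˡ x (≈δ-++ˡ u e)) (≈δ-++ˡ x (≈δ-++ˡ v e)))
      (λ y → (language? (x ++ u ++ y) →-dec language? (x ++ v ++ y)) ×-dec
             (language? (x ++ v ++ y) →-dec language? (x ++ u ++ y))))
    where
    transport : ∀ {a a′ b b′} → a ≈δ a′ → b ≈δ b′ → a ∈ language ⇌ b ∈ language → a′ ∈ language ⇌ b′ ∈ language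
    transport e f (g , h) = ≈δ⇒∈ f ∘ g ∘ ≈δ⇒∈ (≈δ-sym e) , ≈δ⇒∈ e ∘ h ∘ ≈δ⇒∈ (≈δ-sym f)

  ∼-++ : ∀ {u u′ v v′} → u ∼ u′ → v ∼ v′ → u ++ v ∼ u′ ++ v′
  ∼-++ {u} {u′} {v} {v′} e f x y = cast (re₁ u v) (re₁ u′ v) (e x (v ++ y)) ⇌∘
                                   cast (re₂ u′ v) (re₂ u′ v′) (f (x ++ u′) y)
    where
    _⇌∘_ : ∀ {A B C : Set} → A ⇌ B → B ⇌ C → A ⇌ C
    (f , g) ⇌∘ (f′ , g′) = f′ ∘ f , g ∘ g′
    cast : ∀ {a a′ b b′} → a ≡ a′ → b ≡ b′ → a ∈ language ⇌ b ∈ language → a′ ∈ language ⇌ b′ ∈ language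
    cast refl refl h = h
    re₁ : ∀ u v → x ++ u ++ v ++ y ≡ x ++ (u ++ v) ++ y
    re₁ u v = cong (x ++_) (sym (++-assoc u v y))
    re₂ : ∀ u v → (x ++ u) ++ v ++ y ≡ x ++ (u ++ v) ++ y
    re₂ u v = trans (++-assoc x u (v ++ y)) (re₁ u v)

  -- For the syntactic congruence this is the inclusion of η(A^a) in η(A^b).
  Shift : (Word m → Word m → Set) → ℕ → ℕ → Set
  Shift R a b = ∀ u → length u ≡ a → ∃[ v ] length v ≡ b × R v u

  StableAt : ℕ → Set
  StableAt s = Shift _∼_ s (2 * s) × Shift _∼_ (2 * s) s

  take-length : ∀ (u : Word m) {a b} → length u ≡ a + b → length (List.take a u) ≡ a × length (List.drop a u) ≡ b
  take-length u {a} {b} e = trans (ListP.length-take a u) (m≤n⇒m⊓n≡m (≤-trans (m≤m+n a b) (≤-reflexive (sym e)))) ,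
    trans (ListP.length-drop a u) (trans (cong (_∸ a) e) (m+n∸m≡n a b))

  shift-+ : ∀ {R : Word m → Word m → Set} → (∀ {u v} w → R u v → R (u ++ w) (v ++ w)) → ∀ {a b} c → Shift R a b → Shift R (a + c) (b + c)
  shift-+ {R} R-++ {a} {b} c S u e =
    let e₁ , e₂ = take-length u e
        v , l , r = S (List.take a u) e₁
    in v ++ List.drop a u , trans (length-++ v) (cong₂ _+_ l e₂) ,
       subst (R (v ++ List.drop a u)) (ListP.take++drop≡id a u) (R-++ (List.drop a u) r)

  shift-trans : ∀ {R : Word m → Word m → Set} → (∀ {u v w} → R u v → R v w → R u w) → ∀ {a b c} → Shift R a b → Shift R b c → Shift R a c
  shift-trans tr S T u e = let v , l , r = S u e ; w , l′ , r′ = T v l in w , l′ , tr r′ r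

  ∼-trans : ∀ {u v w} → u ∼ v → v ∼ w → u ∼ w
  ∼-trans e f x y = proj₁ (f x y) ∘ proj₁ (e x y) , proj₂ (e x y) ∘ proj₂ (f x y)

  ∼-++ʳ : ∀ {u v} w → u ∼ v → u ++ w ∼ v ++ w
  ∼-++ʳ w e = ∼-++ e (λ _ _ → id , id)

  module _ {s : ℕ} (stable : StableAt s) where

    grow : ∀ j → Shift _∼_ (suc j * s) (suc (suc j) * s)
    grow j = subst (Shift _∼_ (suc j * s)) (lemma j s) (shift-+ ∼-++ʳ (j * s) (proj₁ stable))
      where
      lemma : ∀ j s → 2 * s + j * s ≡ suc (suc j) * s
      lemma = solve-∀

    shrink : ∀ j → Shift _∼_ (suc (suc j) * s) (suc j * s)
    shrink j = subst (λ t → Shift _∼_ t (suc j * s)) (lemma j s) (shift-+ ∼-++ʳ (j * s) (proj₂ stable))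
      where
      lemma : ∀ j s → 2 * s + j * s ≡ suc (suc j) * s
      lemma = solve-∀

    shift-one : ∀ j → Shift _∼_ (suc j * s) (1 * s) × Shift _∼_ (1 * s) (suc j * s)
    shift-one zero    = (λ u e → u , e , λ _ _ → id , id) , (λ u e → u , e , λ _ _ → id , id)
    shift-one (suc j) = shift-trans ∼-trans (shrink j) (proj₁ (shift-one j)) ,
                        shift-trans ∼-trans (proj₂ (shift-one j)) (grow j)

    shift-any : ∀ i j → Shift _∼_ (suc i * s) (suc j * s)
    shift-any i j = shift-trans ∼-trans (proj₁ (shift-one i)) (proj₂ (shift-one j))

    -- The images of words of length s, 2s, 3s and so on all coincide, in particular those for a
    -- multiple of s and for its double.
    stable-* : ∀ k → StableAt (suc k * s)
    stable-* k = subst (Shift _∼_ (suc k * s)) (lemma k s) (shift-any k (suc k + k)) ,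
                 subst (λ t → Shift _∼_ t (suc k * s)) (lemma k s) (shift-any (suc k + k) k)
      where
      lemma : ∀ k s → suc (suc k + k) * s ≡ 2 * (suc k * s)
      lemma = solve-∀

    module _ {{s≢0 : NonZero s}} where

      multiple : ∀ {g} → 0 < g → g ≋ 0 [ s ] → ∃[ e ] g ≡ suc e * s
      multiple {g} g>0 (mk≋ x y e) = pos (y ∸ x) (trans (sym (m+n∸n≡m g (x * s))) (trans (cong (_∸ x * s) e) (sym (*-distribʳ-∸ s y x))))
        where
        pos : ∀ k → g ≡ k * s → ∃[ e ] g ≡ suc e * s
        pos zero    f = contradiction (subst (0 <_) f g>0) (<-irrefl refl)
        pos (suc k) f = k , f

      -- Syntactically congruent words may differ in length modulo `s`, so the length is made part
      -- of the relation. Stability still gives `adjust`, which compares lengths divisible by `s`.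
      syntactic : Congruence m s
      syntactic = record
        { _~_ = λ u v → length u ≋ length v [ s ] × u ∼ v
        ; ~-refl = ≋-refl , λ _ _ → id , id
        ; ~-sym = λ (l , e) → ≋-sym l , λ x y → proj₂ (e x y) , proj₁ (e x y)
        ; ~-trans = λ (l , e) (l′ , e′) → ≋-trans l l′ , ∼-trans e e′
        ; ~-++ = λ {u} {u′} (l , e) (l′ , e′) →
            subst₂ (λ a b → a ≋ b [ s ]) (sym (length-++ u)) (sym (length-++ u′)) (≋-+ l l′) , ∼-++ e e′
        ; _~?_ = λ u v → map′ %⇒≋ ≋⇒% (length u % s ≟ length v % s) ×-dec (u ∼? v)
        ; ~-length = proj₁
        ; reps = words (s * δ-size)
        ; reps-complete = λ u → Any.map (λ (l , e) → l , ≈δ⇒∼ e) (complete u)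
        ; adjust = λ g g>0 g≋0 j →
            let e , f = multiple g>0 g≋0 ; g′ , l , r = shift-any e j g f in
            g′ , l , ≋-trans (≋-trans (≋-reflexive l) (≋-*0 (suc j) s)) (≋-sym g≋0) , r
        }
        where
        open GameCode {m} {s} using (residueCode; residueCode⇒≋)
        complete : ∀ u → Any (λ r → length r ≋ length u [ s ] × r ≈δ u) (words (s * δ-size))
        complete = representatives (λ r u → length r ≋ length u [ s ] × r ≈δ u) (≋-refl , ≈δ-refl)
          (λ (l , e) (l′ , e′) → ≋-trans l l′ , ≈δ-trans e e′)
          (λ {u} {v} w (l , e) → subst₂ (λ a b → a ≋ b [ s ]) (sym (length-++ u)) (sym (length-++ v)) (≋-+ l (≋-refl {length w})) ,
                                 ≈δ-++ʳ w e)
          (λ u → combine (residueCode u) (δ-code u))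
          (λ {u} {v} e → let e₁ , e₂ = FinP.combine-injective (residueCode u) _ (residueCode v) _ e in
                         residueCode⇒≋ {u} {v} e₁ , δ-code⇒≈ e₂)

  reachable? : ∀ n x → Dec (∃[ u ] length u ≡ n × δ-code u ≡ x)
  reachable? n x = map′ (λ a → let u , _ , p = Mem.find a in u , p)
    (λ (u , l , e) → Mem.lose (words-complete n u (≤-reflexive l)) (l , e))
    (Any.any? (λ u → (length u ≟ n) ×-dec (δ-code u FinP.≟ x)) (words n))

  stable-index : ∃[ s ] 0 < s × StableAt s
  stable-index with FinP.pigeonhole (n<1+n (2 ^ δ-size)) (λ i → funToFin (λ x → bit (reachable? (toℕ i) x)))
  -- Words of lengths i and j induce the same transformations, so their sets have period `p` from i
  -- on; `p * suc i` is a multiple of `p` beyond i, and going on by `suc i` periods doubles it.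
  ... | i , j , i<j , e = p * suc (toℕ i) , s>0 , double , halve
    where
    p = toℕ j ∸ toℕ i
    p>0 : 0 < p
    p>0 = m<n⇒0<n∸m i<j
    s>0 : 0 < p * suc (toℕ i)
    s>0 = *-mono-≤ p>0 (s≤s z≤n)
    there-back : ∀ a b → (∀ x → bit (reachable? a x) ≡ bit (reachable? b x)) → Shift _≈δ_ a b
    there-back a b same u l =
      let x = δ-code u
          v , l′ , f = bit-transfer {a = reachable? a x} {reachable? b x} (same x) (u , l , refl)
      in v , l′ , δ-code⇒≈ f
    same : ∀ x → bit (reachable? (toℕ i) x) ≡ bit (reachable? (toℕ j) x)
    same = funToFin-injective e
    period-there : ∀ c n → Shift _≈δ_ (toℕ i + c) (toℕ i + c + n * p)
    period-there c zero    = λ u l → u , trans l (sym (+-identityʳ _)) , ≈δ-refl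
    period-there c (suc n) = shift-trans {_≈δ_} ≈δ-trans (shift-+ {_≈δ_} ≈δ-++ʳ c (there-back _ _ same))
      (subst₂ (Shift _≈δ_) (re₁ c) (re₂ c n) (period-there (p + c) n))
      where
      i+p : toℕ i + p ≡ toℕ j
      i+p = m+[n∸m]≡n (<⇒≤ i<j)
      re₁ : ∀ c → toℕ i + (p + c) ≡ toℕ j + c
      re₁ c = trans (sym (+-assoc (toℕ i) p c)) (cong (_+ c) i+p)
      re₂ : ∀ c n → toℕ i + (p + c) + n * p ≡ toℕ i + c + suc n * p
      re₂ c n = lemma (toℕ i) p c n
        where
        lemma : ∀ i p c n → i + (p + c) + n * p ≡ i + c + suc n * p
        lemma = solve-∀
    period-back : ∀ c n → Shift _≈δ_ (toℕ i + c + n * p) (toℕ i + c)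
    period-back c zero    = λ u l → u , trans l (+-identityʳ _) , ≈δ-refl
    period-back c (suc n) = shift-trans {_≈δ_} ≈δ-trans
      (subst₂ (Shift _≈δ_) (re₂ c n) (re₁ c) (period-back (p + c) n))
      (shift-+ {_≈δ_} ≈δ-++ʳ c (there-back _ _ (sym ∘ same)))
      where
      re₁ : ∀ c → toℕ i + (p + c) ≡ toℕ j + c
      re₁ c = trans (sym (+-assoc (toℕ i) p c)) (cong (_+ c) (m+[n∸m]≡n (<⇒≤ i<j)))
      re₂ : ∀ c n → toℕ i + (p + c) + n * p ≡ toℕ i + c + suc n * p
      re₂ c n = lemma (toℕ i) p c n
        where
        lemma : ∀ i p c n → i + (p + c) + n * p ≡ i + c + suc n * p
        lemma = solve-∀
    gap : ∀ i → ∃[ c ] p * suc i ≡ i + c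
    gap i = p * suc i ∸ i , sym (m+[n∸m]≡n (≤-trans (n≤1+n i) (≤-trans (≤-reflexive (sym (*-identityˡ (suc i)))) (*-monoˡ-≤ (suc i) p>0))))
    two : ∀ i → p * suc i + suc i * p ≡ 2 * (p * suc i)
    two i = lemma i p
      where
      lemma : ∀ i p → p * suc i + suc i * p ≡ 2 * (p * suc i)
      lemma = solve-∀
    double : Shift _∼_ (p * suc (toℕ i)) (2 * (p * suc (toℕ i)))
    double u l = let c , f = gap (toℕ i)
                     v , l′ , r = period-there c (suc (toℕ i)) u (trans l f)
                 in v , trans l′ (trans (cong (_+ suc (toℕ i) * p) (sym f)) (two (toℕ i))) , ≈δ⇒∼ r
    halve : Shift _∼_ (2 * (p * suc (toℕ i))) (p * suc (toℕ i))
    halve u l = let c , f = gap (toℕ i)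
                    v , l′ , r = period-back c (suc (toℕ i)) u
                      (trans l (trans (sym (two (toℕ i))) (cong (_+ suc (toℕ i) * p) f)))
                in v , trans l′ (sym f) , ≈δ⇒∼ r

-- The fragments

module Classes {m : ℕ} (M : DFA m) (_≈_ : Word m → Word m → Set) (≈-refl : ∀ {u} → u ≈ u)
  (≈-sym : ∀ {u v} → u ≈ v → v ≈ u) (≈-trans : ∀ {u v w} → u ≈ v → v ≈ w → u ≈ w)
  (≈-++ʳ : ∀ {u v} w → u ≈ v → (u ++ w) ≈ (v ++ w)) (_≈?_ : ∀ u v → Dec (u ≈ v))
  {K : ℕ} (code : Word m → Fin K) (code⇒≈ : ∀ {u v} → code u ≡ code v → u ≈ v) where

  open Automaton M
  open DFA M using (language)

  Saturated : Set
  Saturated = ∀ {u v} → u ≈ v → u ∈ language → v ∈ language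

  samples : List (Word m)
  samples = words (δ-size * K)

  samples-complete : ∀ u → Any (λ r → r ≈δ u × r ≈ u) samples
  samples-complete = representatives (λ r u → r ≈δ u × r ≈ u) (≈δ-refl , ≈-refl)
    (λ (e , f) (e′ , f′) → ≈δ-trans e e′ , ≈-trans f f′) (λ w (e , f) → ≈δ-++ʳ w e , ≈-++ʳ w f)
    (λ u → combine (δ-code u) (code u))
    (λ {u} {v} e → let e₁ , e₂ = FinP.combine-injective (δ-code u) _ (δ-code v) _ e in δ-code⇒≈ e₁ , code⇒≈ e₂)

  -- The samples represent both relations at once: each word of a pair violating saturation can be
  -- replaced by a sample that is equivalent to it and on which the automaton agrees.
  saturated? : Dec Saturated
  saturated? with All.all? (λ u → All.all? (λ v → (u ≈? v) →-dec (language? u →-dec language? v)) samples) samples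
  ... | yes ps = yes λ {u} {v} e u∈ →
    let r , r∈ , eᵣ , fᵣ = Mem.find (samples-complete u)
        t , t∈ , eₜ , fₜ = Mem.find (samples-complete v)
    in ≈δ⇒∈ eₜ (All.lookup (All.lookup ps r∈) t∈ (≈-trans fᵣ (≈-trans e (≈-sym fₜ))) (≈δ⇒∈ (≈δ-sym eᵣ) u∈))
  ... | no ¬ps = no (λ sat → ¬ps (All.universal (λ u → All.universal (λ v e → sat e) samples) samples))

  accepted : List (Word m)
  accepted = List.filter language? samples

  module _ {σ : Signature} (d : ℕ) .{{d≢0 : NonZero d}} (D∈σ : ∀ i → D d i ∈ σ) {n : ℕ}
           (class : Word m → Sentence m σ n) (class⇌ : ∀ u w → ⟦ class u ⟧ w ⇌ u ≈ w) where

    open Propositional {m} {σ} d D∈σ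

    union-≐ : Saturated → ∀ {L : Language m} → L ≐ language → L ≐ ⟦ unionᶠ class accepted ⟧
    union-≐ sat {L} (to , from) = (λ {w} w∈ → ⊆ w (to w∈)) , (λ {w} w⊨ → from (⊇ w w⊨))
      where
      ⊆ : ∀ w → w ∈ language → w ∈ ⟦ unionᶠ class accepted ⟧
      ⊆ w w∈ = proj₂ (⋁⇌ w ∅ (class ∘ lookup accepted)) (Any.index r∈accepted ,
        subst (λ z → ⟦ class z ⟧ w) (AnyP.lookup-index r∈accepted) (proj₂ (class⇌ _ w) (proj₂ (proj₂ (proj₂ found)))))
        where
        found = Mem.find (samples-complete w)
        r∈accepted : proj₁ found ∈ˡ accepted
        r∈accepted = MemP.∈-filter⁺ language? (proj₁ (proj₂ found)) (≈δ⇒∈ (≈δ-sym (proj₁ (proj₂ (proj₂ found)))) w∈)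
      ⊇ : ∀ w → w ∈ ⟦ unionᶠ class accepted ⟧ → w ∈ language
      ⊇ w w⊨ = let i , c = proj₁ (⋁⇌ w ∅ (class ∘ lookup accepted)) w⊨ in
        sat (proj₁ (class⇌ _ w) c) (proj₂ (MemP.∈-filter⁻ language? {xs = samples} (MemP.∈-lookup i)))

module FragmentFO² {m : ℕ} (M : DFA m) {s : ℕ} {{s≢0 : NonZero s}} (stable : Automaton.StableAt M s) (k : ℕ) where

  open Automaton M
  open DFA M using (language)
  open GameCode {m} {s}

  C : Congruence m s
  C = syntactic stable

  N : ℕ
  N = rounds (length (Congruence.reps C)) k

  eqv? : ∀ u v → Dec (Eqv (suc k) N s u v)
  eqv? u v = map′ (proj₁ (class⇌ (suc k) N v)) (proj₂ (class⇌ (suc k) N v)) (sat? v ∅ (classᶠ (suc k) N))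
    where open Hintikka {m} {[<] ∪ [MOD]} s (λ i → inj₂ (s , D i)) (λ i → inj₂ (s , MOD i)) (inj₁ lt) u

  open Classes M (Eqv (suc k) N s) eqv-refl eqv-sym eqv-trans (λ w e → eqv-++ e eqv-refl) eqv?
               (eqvCode N) (eqvCode⇒eqv (suc k) N) public

  -- The modulus of φ is enlarged to a multiple of `s`. Equivalence for it is a congruence
  -- preserving φ, so it implies syntactic congruence, and `saturated` then lowers the modulus to
  -- `s`.
  definable⇒saturated : ∀ {σ} {L : Language m} → L ≐ language → L ∈ FO²[ suc k , σ ] → Saturated
  definable⇒saturated (to , from) (φ , ps , to′ , from′) {u} {v} E u∈ =
    subst (_∈ language) (++-identityʳ v)
      (proj₁ (proj₂ (saturated k C q (depth φ) syntactic-saturated u v E) [] [])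
        (subst (_∈ language) (sym (++-identityʳ u)) u∈))
    where
    q = pred (modulus φ)
    φ≢0 = modulus-≢0 φ
    q≡ : suc q ≡ modulus φ
    q≡ = suc-pred (modulus φ) {{φ≢0}}
    instance
      d≢0 : NonZero (suc q * s)
      d≢0 = m*n≢0 (suc q) s
    φ∣d : modulus φ ∣ suc q * s
    φ∣d = subst (_∣ suc q * s) q≡ (m∣m*n s)
    keeps : ∀ u v → Eqv (suc k) (depth φ) (suc q * s) u v → u ∈ language → v ∈ language
    keeps u v E u∈ = to (from′ (sentence-preserves φ ps φ∣d E (to′ (from u∈))))
    syntactic-saturated : ∀ u v → Eqv (suc k) (depth φ) (suc q * s) u v → length u ≋ length v [ s ] × u ∼ v
    syntactic-saturated u v E = ≋-factor (suc q) s (Eqv.lengths E) ,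
      (λ x y → keeps _ _ (eqv-++ (eqv-refl {u = x}) (eqv-++ E eqv-refl)) ,
               keeps _ _ (eqv-++ (eqv-refl {u = x}) (eqv-++ (eqv-sym E) eqv-refl)))

  saturated⇒definable : ∀ {σ} {L : Language m} → (∀ i → D s i ∈ σ) → (∀ i → MOD s i ∈ σ) → lt ∈ σ →
                        L ≐ language → Saturated → L ∈ FO²[ suc k , σ ]
  saturated⇒definable {σ} {L} D∈ MOD∈ lt∈ L≐ sat =
    unionᶠ class accepted , br-⋁ (class ∘ lookup accepted) z<s (λ i → Hintikka.br-class s D∈ MOD∈ lt∈ (lookup accepted i) k N) ,
    union-≐ s D∈ class class⇌ sat L≐
    where
    open Propositional {m} {σ} s D∈
    class : Word m → Sentence m σ 2
    class u = Hintikka.classᶠ s D∈ MOD∈ lt∈ u (suc k) N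
    class⇌ : ∀ u w → ⟦ class u ⟧ w ⇌ Eqv (suc k) N s u w
    class⇌ u w = Hintikka.class⇌ s D∈ MOD∈ lt∈ u (suc k) N w

module FragmentFO₌ {m : ℕ} (M : DFA m) {s : ℕ} {{s≢0 : NonZero s}} (stable : Automaton.StableAt M s) where

  open Automaton M
  open DFA M using (language)

  C : Congruence m s
  C = syntactic stable

  S : ℕ
  S = 2 * s

  instance
    S≢0 : NonZero S
    S≢0 = m*n≢0 2 s

  open GameCode {m} {S}

  Θ : ℕ
  -- The threshold is computed from `C` alone; the values 0 stand for the modulus and the counts of
  -- the given sentence.
  Θ = Threshold.Θ C 0 0

  ceq? : ∀ u v → Dec (CEq Θ S u v)
  ceq? u v = map′ (proj₁ (class⇌ v)) (proj₂ (class⇌ v)) (sat? v ∅ classᶠ)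
    where open Counting.Class {m} {[=] ∪ [MOD]} S (λ i → inj₂ (S , D i)) (λ i → inj₂ (S , MOD i)) (inj₁ eq) Θ u

  ceq-refl : ∀ {u : Word m} → CEq Θ S u u
  ceq-refl = ceq ≋-refl (λ _ _ → inj₁ refl)

  ceq-sym : ∀ {u v : Word m} → CEq Θ S u v → CEq Θ S v u
  ceq-sym (ceq l c) = ceq (≋-sym l) (λ a r → [ inj₁ ∘ sym , (λ (p , q) → inj₂ (q , p)) ]′ (c a r))

  ceq-trans : ∀ {u v w : Word m} → CEq Θ S u v → CEq Θ S v w → CEq Θ S u w
  ceq-trans (ceq l c) (ceq l′ c′) = ceq (≋-trans l l′) (λ a r → chain (c a r) (c′ a r))
    where
    chain : ∀ {x y z : ℕ} → x ≡ y ⊎ (Θ ≤ x × Θ ≤ y) → y ≡ z ⊎ (Θ ≤ y × Θ ≤ z) → x ≡ z ⊎ (Θ ≤ x × Θ ≤ z)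
    chain (inj₁ refl)    f              = f
    chain (inj₂ (p , q)) (inj₁ refl)    = inj₂ (p , q)
    chain (inj₂ (p , _)) (inj₂ (_ , q)) = inj₂ (p , q)

  open Classes M (CEq Θ S) ceq-refl ceq-sym ceq-trans (λ w e → ceq-++ [] w e) ceq?
               (ceqCode Θ) (ceqCode⇒ceq Θ) public

  definable⇒saturated : ∀ {σ} {L : Language m} → ¬ (lt ∈ σ) → L ≐ language → L ∈ FO[ σ ] → Saturated
  definable⇒saturated no-lt (to , from) (n , φ , to′ , from′) {u} {v} E u∈ =
    subst (_∈ language) (++-identityʳ v)
      (proj₁ (proj₂ (Threshold.counts-saturated C q (suc n) syntactic-saturated u v E) [] [])
        (subst (_∈ language) (sym (++-identityʳ u)) u∈))
    where
    q = pred (modulus φ)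
    φ≢0 = modulus-≢0 φ
    q≡ : suc q ≡ modulus φ
    q≡ = suc-pred (modulus φ) {{φ≢0}}
    -- This is the modulus of φ times `2 * s`.
    d = suc (suc (q * 2)) * s
    instance
      d≢0 : NonZero d
      d≢0 = m*n≢0 (suc (suc (q * 2))) s
    φ∣d : modulus φ ∣ d
    φ∣d = subst₂ _∣_ q≡ (sym (Commutative.d≡ C q 0)) (m∣m*n S)
    keeps : ∀ u v → CEq (suc n) d u v → u ∈ language → v ∈ language
    keeps u v E u∈ = to (from′ (sentence-preserves₌ no-lt φ φ∣d E (to′ (from u∈))))
    flip : ∀ {u v : Word m} → CEq (suc n) d u v → CEq (suc n) d v u
    flip (ceq l c) = ceq (≋-sym l) (λ a r → [ inj₁ ∘ sym , (λ (p , q) → inj₂ (q , p)) ]′ (c a r))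
    syntactic-saturated : ∀ u v → CEq (suc n) d u v → length u ≋ length v [ s ] × u ∼ v
    syntactic-saturated u v E = ≋-factor (suc (suc (q * 2))) s (CEq.lengths E) ,
      (λ x y → keeps _ _ (ceq-++ x y E) , keeps _ _ (ceq-++ x y (flip E)))

  saturated⇒definable : ∀ {σ} {L : Language m} → (∀ i → D S i ∈ σ) → (∀ i → MOD S i ∈ σ) → eq ∈ σ →
                        L ≐ language → Saturated → L ∈ FO[ σ ]
  saturated⇒definable {σ} {L} D∈ MOD∈ eq∈ L≐ sat =
    -- Counting up to Θ takes Θ variables.
    Θ , unionᶠ class accepted , union-≐ S D∈ class class⇌ sat L≐
    where
    open Propositional {m} {σ} S D∈
    class : Word m → Sentence m σ Θ
    class u = Counting.Class.classᶠ S D∈ MOD∈ eq∈ Θ u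
    class⇌ : ∀ u w → ⟦ class u ⟧ w ⇌ CEq Θ S u w
    class⇌ u w = Counting.Class.class⇌ S D∈ MOD∈ eq∈ Θ u w

index⇒stable : ∀ {m} {L : Language m} (M : DFA m) → L ≐ DFA.language M → ∀ {s} → IsStabilityIndex L s →
               Automaton.StableAt M s
index⇒stable {m} {L} M (to , from) {s} (_ , (up , down) , _) =
  (λ u l → convert (up {u} (u , l , λ _ _ → mk⇔ id id))) , (λ u l → convert (down {u} (u , l , λ _ _ → mk⇔ id id)))
  where
  open Automaton M using (_∼_)
  convert : ∀ {n u} → ∃[ w ] (length w ≡ n × (∀ x y → (x ++ w ++ y) ∈ L ⇔ (x ++ u ++ y) ∈ L)) →
            ∃[ v ] length v ≡ n × v ∼ u
  convert (w , l , e) = w , l , (λ x y → to ∘ Equivalence.to (e x y) ∘ from , to ∘ Equivalence.from (e x y) ∘ from)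

corollary26 : (∀ {m} (L : Language m) (s k : ℕ) →
    Regular L → IsStabilityIndex L s → 0 < k →
    (L ∈ FO²[ k , [<] ∪ [MOD] ] ⇔ L ∈ FO²[ k , [<] ∪ MOD^ (2 * k * s) ])
    × (L ∈ FO[ [=] ∪ [MOD] ] ⇔ L ∈ FO[ [=] ∪ MOD^ (2 * s) ]))
    × DecidableFragment FO[ [=] ∪ [MOD] ]
    × (∀ k → 0 < k → DecidableFragment FO²[ k , [<] ∪ [MOD] ])
corollary26 = equivalences , decidable₌ , decidable²
  where
  no-lt-MOD : ¬ (lt ∈ ([=] ∪ [MOD]))
  no-lt-MOD (inj₂ (_ , ()))

  equivalences : ∀ {m} (L : Language m) (s k : ℕ) → Regular L → IsStabilityIndex L s → 0 < k →
    (L ∈ FO²[ k , [<] ∪ [MOD] ] ⇔ L ∈ FO²[ k , [<] ∪ MOD^ (2 * k * s) ])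
    × (L ∈ FO[ [=] ∪ [MOD] ] ⇔ L ∈ FO[ [=] ∪ MOD^ (2 * s) ])
  equivalences {m} L s (suc k) (M , L≐) index _ =
    mk⇔ (λ f → F².saturated⇒definable (λ i → inj₂ (D i)) (λ i → inj₂ (MOD i)) (inj₁ lt) L≐ (F².definable⇒saturated L≐ f))
        (λ f → F².saturated⇒definable (λ i → inj₂ (t , D i)) (λ i → inj₂ (t , MOD i)) (inj₁ lt) L≐ (F².definable⇒saturated L≐ f)) ,
    mk⇔ (λ f → F₌.saturated⇒definable (λ i → inj₂ (D i)) (λ i → inj₂ (MOD i)) (inj₁ eq) L≐
                 (F₌.definable⇒saturated no-lt-MOD L≐ f))
        (λ f → F₌.saturated⇒definable (λ i → inj₂ (2 * s , D i)) (λ i → inj₂ (2 * s , MOD i)) (inj₁ eq) L≐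
                 (F₌.definable⇒saturated (λ { (inj₂ ()) }) L≐ f))
    where
    t : ℕ
    t = 2 * suc k * s
    instance
      s≢0 : NonZero s
      s≢0 = >-nonZero (proj₁ index)
      t≢0 : NonZero t
      t≢0 = m*n≢0 (2 * suc k) s
    stable : Automaton.StableAt M s
    stable = index⇒stable M L≐ index
    -- `suc (k + (suc k + 0))` is what `2 * suc k` reduces to, so the multiple of `s` obtained here
    -- is the modulus of the statement.
    module F² = FragmentFO² M {t} (Automaton.stable-* M {s} stable (k + (suc k + 0))) k
    module F₌ = FragmentFO₌ M {s} stable

  decidable₌ : DecidableFragment FO[ [=] ∪ [MOD] ]
  decidable₌ {m} M = map′
    (F.saturated⇒definable (λ i → inj₂ (2 * s , D i)) (λ i → inj₂ (2 * s , MOD i)) (inj₁ eq) (id , id))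
    (F.definable⇒saturated no-lt-MOD (id , id)) F.saturated?
    where
    s : ℕ
    s = proj₁ (Automaton.stable-index M)
    instance
      s≢0 : NonZero s
      s≢0 = >-nonZero (proj₁ (proj₂ (Automaton.stable-index M)))
    module F = FragmentFO₌ M {s} (proj₂ (proj₂ (Automaton.stable-index M)))

  decidable² : ∀ k → 0 < k → DecidableFragment FO²[ k , [<] ∪ [MOD] ]
  decidable² (suc k) _ {m} M = map′
    (F.saturated⇒definable (λ i → inj₂ (s , D i)) (λ i → inj₂ (s , MOD i)) (inj₁ lt) (id , id))
    (F.definable⇒saturated (id , id)) F.saturated?
    where
    s : ℕ
    s = proj₁ (Automaton.stable-index M)
    instance
      s≢0 : NonZero s
      s≢0 = >-nonZero (proj₁ (proj₂ (Automaton.stable-index M)))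
    module F = FragmentFO² M {s} (proj₂ (proj₂ (Automaton.stable-index M))) k
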